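{- For each integer $k\geqslant 0$ let $\mathrm{M}_k=\mathrm{M}\cap\mathbf{Z}^{\mathcal{B}_k}$. Then for each $k\geqslant1$, $$\mathrm{M}_k=\alpha_k^{ -1}\Big(\bigoplus_{0\leqslant k'<k}\mathrm{M}_{k'}\Big)=\bigcap_{0\leqslant k'<k}\alpha_{k',k}^{ -1}(\mathrm{M}_{k'}).$$
   Context: A composition is a finite sequence $\mathbf{a}=(a_1,\ldots,a_r)$ of positive integers ($r\geqslant0$), of weight $\sum a_i$; admissible if $r=0$ or $a_1\geqslant2$. $\mathcal{A}$ is the set of admissible compositions. Binary word $\mathbf{w}(\mathbf{a})=0^{a_1-1}1\cdots0^{a_r-1}1$; the dual of a word $\varepsilon_1\cdots\varepsilon_k$ is $\overline{\varepsilon_k}\cdots\overline{\varepsilon_1}$ ($\overline0=1,\overline1=0$); $\overline{\mathbf{a}}$ is the admissible composition with word dual to $\mathbf{w}(\mathbf{a})$. $\mathcal{B}=\mathcal{A}/(\mathbf{a}\sim\overline{\mathbf{a}})$ with classes $[\mathbf{a}]$, $\mathcal{B}_k$ the classes of weight $k$, $\mathcal{B}^*=\mathcal{B}\setminus\{[\varnothing]\}$; $\mathbf{Z}^{(X)}$ is the free $\mathbf{Z}$-module on $X$. $(a_1,\ldots,a_r)^{\rm init}=(a_1,\ldots,a_{r-1})$; for admissible $\mathbf{a}$, $\mathbf{a}^{\rm fin}$ is the dual of $(\overline{\mathbf{a}})^{\rm init}$ and $\mathbf{a}^{\rm mid}=(\mathbf{a}^{\rm fin})^{\rm init}$. $\alpha:\mathbf{Z}^{(\mathcal{B}^*)}\to\mathbf{Z}^{(\mathcal{B})}$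 is the $\mathbf{Z}$-linear map $[\mathbf{a}]\mapsto[\mathbf{a}^{\rm init}]+[\mathbf{a}^{\rm mid}]+[\mathbf{a}^{\rm fin}]$ (well defined); for $k\geqslant1$ it induces $\alpha_k:\mathbf{Z}^{\mathcal{B}_k}\to\bigoplus_{0\leqslant k'<k}\mathbf{Z}^{\mathcal{B}_{k'}}$, whose $k'$-component is denoted $\alpha_{k',k}:\mathbf{Z}^{\mathcal{B}_k}\to\mathbf{Z}^{\mathcal{B}_{k'}}$. For non-empty admissible $\mathbf{a}$ and $n\geqslant0$, $\zeta(\mathbf{a})_{n,n}=\sum_{n_1>\cdots>n_r>n}\binom{n_1+n}{n}^{ -1}n_1^{ -a_1}\cdots n_r^{ -a_r}$, $\zeta(\varnothing)_{n,n}=\binom{2n}{n}^{ -1}$; since $\zeta(\mathbf{a})_{n,n}=\zeta(\overline{\mathbf{a}})_{n,n}$ this gives a $\mathbf{Z}$-linear map $\ell\mapsto\zeta(\ell)_{n,n}$ on $\mathbf{Z}^{(\mathcal{B})}$. $\mathrm{M}$ is the set of $\ell\in\mathbf{Z}^{(\mathcal{B})}$ with $\zeta(\ell)_{n,n}=0$ for all $n\geqslant0$. -}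

module Defs where

open import Data.Nat as ℕ using (ℕ; zero; suc; _∸_; _^_; _≤_; _<_; _≟_)
open import Data.Nat.Combinatorics using (_C_)
open import Data.Integer as ℤ using (ℤ; +_)
open import Data.Rational as ℚ using (ℚ; 0ℚ; 1ℚ)
open import Data.Bool using (Bool; true; false; not)
open import Data.List using (List; []; _∷_; _++_; replicate; reverse; map; filter; concatMap; foldr; length)
open import Data.List.Relation.Unary.All using (All)
open import Relation.Binary.PropositionalEquality using (_≡_)
open import Data.Product using (_×_; _,_; proj₁; proj₂; Σ; ∃)

-- Compositions are lists of naturals (entries required ≥ 1 by predicate).

weight : List ℕ → ℕ
weight = foldr ℕ._+_ 0

data HeadOK : List ℕ → Set where
  nil  : HeadOK []
  cons : ∀ {a as} → 2 ≤ a → HeadOK (a ∷ as)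

record Admissible (a : List ℕ) : Set where
  field
    positive : All (1 ≤_) a
    headOK   : HeadOK a

-- binary word w(a) = 0^{a₁-1}1 ⋯ 0^{a_r-1}1   (false = 0, true = 1)
word : List ℕ → List Bool
word []       = []
word (a ∷ as) = replicate (a ∸ 1) false ++ (true ∷ word as)

dualWord : List Bool → List Bool
dualWord w = reverse (map not w)

fromWordAux : ℕ → List Bool → List ℕ
fromWordAux c []            = []
fromWordAux c (false ∷ ws)  = fromWordAux (suc c) ws
fromWordAux c (true ∷ ws)   = suc c ∷ fromWordAux 0 ws

fromWord : List Bool → List ℕ
fromWord = fromWordAux 0

dual : List ℕ → List ℕ
dual a = fromWord (dualWord (word a))

init : List ℕ → List ℕ
init []           = []
init (x ∷ [])     = []
init (x ∷ y ∷ xs) = x ∷ init (y ∷ xs)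

fin : List ℕ → List ℕ
fin a = dual (init (dual a))

mid : List ℕ → List ℕ
mid a = init (fin a)

-- Formal ℤ-linear combinations of (representatives of) classes.
-- An element of Z^(B) is represented by a finite list of pairs
-- (coefficient, admissible composition); a and ā represent the same class.

LinComb : Set
LinComb = List (ℤ × List ℕ)

AllAdmissible : LinComb → Set
AllAdmissible ℓ = All (λ p → Admissible (proj₂ p)) ℓ

Homogeneous : ℕ → LinComb → Set
Homogeneous k ℓ = All (λ p → weight (proj₂ p) ≡ k) ℓ

α : LinComb → LinComb
α = concatMap (λ { (c , a) → (c , init a) ∷ (c , mid a) ∷ (c , fin a) ∷ [] })

component : ℕ → LinComb → LinComb
component k' = filter (λ p → weight (proj₂ p) ≟ k')

-- 1/m for m ≥ 1 (only ever applied to positive m)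
inv : ℕ → ℚ
inv zero    = 0ℚ
inv (suc m) = (+ 1) ℚ./ (suc m)

-- Σ_{i = lo+1}^{hi} f i
sumRange : ℕ → ℕ → (ℕ → ℚ) → ℚ
sumRange lo hi f = go (hi ∸ lo)
  where
  go : ℕ → ℚ
  go zero    = 0ℚ
  go (suc c) = go c ℚ.+ f (suc (lo ℕ.+ c))

-- tail n bs m = Σ_{m > n₂ > ⋯ > n_r > n} n₂^{-b₂} ⋯ n_r^{-b_r}
tailSum : ℕ → List ℕ → ℕ → ℚ
tailSum n []       m       = 1ℚ
tailSum n (b ∷ bs) zero    = 0ℚ
tailSum n (b ∷ bs) (suc m) = sumRange n m (λ j → inv (j ^ b) ℚ.* tailSum n bs j)

-- truncation of ζ(a)_{n,n} to n₁ ≤ N; for a = ∅ the constant binom(2n,n)^{-1}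
ζTrunc : List ℕ → ℕ → ℕ → ℚ
ζTrunc []       n N = inv ((n ℕ.+ n) C n)
ζTrunc (a ∷ as) n N =
  sumRange n N (λ n₁ → inv ((n₁ ℕ.+ n) C n) ℚ.* (inv (n₁ ^ a) ℚ.* tailSum n as n₁))

ζTruncLin : LinComb → ℕ → ℕ → ℚ
ζTruncLin ℓ n N = foldr ℚ._+_ 0ℚ (map (λ { (c , a) → (c ℚ./ 1) ℚ.* ζTrunc a n N }) ℓ)

TendsToZero : (ℕ → ℚ) → Set
TendsToZero s = ∀ (ε : ℚ) → 0ℚ ℚ.< ε →
  ∃ λ N → ∀ N' → N ≤ N' → ℚ.∣ s N' ∣ ℚ.< ε

-- ℓ ∈ M  ⇔  ζ(ℓ)_{n,n} = 0 for all n ≥ 0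
InM : LinComb → Set
InM ℓ = ∀ (n : ℕ) → TendsToZero (ζTruncLin ℓ n)

InDirectSumM : ℕ → LinComb → Set
InDirectSumM k ℓ =
  (∀ k' → k' ℕ.< k → InM (component k' ℓ)) ×
  (∀ k' → k ≤ k' → component k' ℓ ≡ [])

{-# OPTIONS --safe #-}
-- Modulo null sequences in the truncation parameter N, ζ(a)_{n-1,n-1} − ζ(a)_{n,n} is the sum over
-- x ∈ {init a, mid a, fin a} of n^{-(|a| − |x|)} ζ(x)_{n,n}: the init terms split off n_r = n, and the fin
-- terms come from 1/C(m+q-1,q-1) = (1 + m/q)/C(m+q,q) followed by telescoping sums over the outer indices.
-- Since ζ(a)_{n,n} → 0 as n → ∞, iterating down to ζ(∅)_{n,n} = 1/C(2n,n) expands ζ(ℓ)_{n,n} in the nested sums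
--   S_s(n) = Σ_{n < m_1 < ⋯ < m_r} m_1^{-s_1} ⋯ m_r^{-s_r} / C(2m_r, m_r)
-- with integer coefficients, and the coefficient of S_{js'} in ℓ is that of S_{s'} in α_{k-j,k} ℓ.
-- So both directions follow once the S_s with s_r ≥ 2 are linearly independent. They are independent even over
-- the polynomials in n: in a relation with leading coefficient P₀ at a word j t of maximal length, eliminating that
-- word between n and n-1 gives a smaller relation, hence a trivial one, so the rational function R = P_t / P₀
-- satisfies a(n) R(n) = b(n) R(n-1) + Σ_i c_i n^{-i} with c_j = 1. Such an R would have a pole at every integer n ≥ 0
-- or at every integer n < 0.
module Submission where

open import Defs
open import Data.Nat as ℕ using (ℕ; zero; suc; _≤_; _<_; _^_; _∸_; z≤n; s≤s)
import Data.Nat.Properties as ℕₚ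
open import Data.Nat.Combinatorics using (_C_; nCn≡1; nCk≡nC[n∸k]; nCk+nC[k+1]≡[n+1]C[k+1])
open import Data.Bool using (Bool; true; false; not)
open import Data.Bool.Properties using (not-involutive)
import Data.Integer as ℤ
import Data.Integer.Properties as ℤₚ
open import Data.Integer.Tactic.RingSolver using () renaming (solve-∀ to ℤ-solve-∀)
open import Data.Rational as ℚ using (ℚ; 0ℚ; 1ℚ; ½; _+_; _*_; _-_; -_; ∣_∣)
import Data.Rational.Properties as ℚₚ
import Data.Rational.Unnormalised as ℚᵘ
import Data.Rational.Unnormalised.Properties as ℚᵘₚ
open import Data.List using (List; []; _∷_; _++_; length; map; replicate; reverse; upTo; cartesianProductWith)
open import Data.List.Properties using (map-++; map-∘; map-id-local; reverse-++; reverse-map; reverse-involutive; ++-assoc; ++-identityʳ; filter-accept; filter-reject; filter-none)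
open import Data.List.Relation.Unary.All using (All; []; _∷_; universal; zipWith) renaming (map to mapᴬ)
open import Data.List.Relation.Unary.All.Properties using (++⁺; filter⁺; all-filter)
open import Data.List.Membership.Propositional using (_∈_)
open import Data.List.Membership.Propositional.Properties using (∈-cartesianProductWith⁺; ∈-cartesianProductWith⁻; ∈-upTo⁺; ∈-upTo⁻)
open import Data.List.Relation.Unary.Any using (here; there)
open import Data.Product using (_×_; _,_; proj₁; proj₂; ∃)
open import Data.Sum using (_⊎_; inj₁; inj₂)
open import Data.Empty using (⊥; ⊥-elim)
open import Function.Bundles using (_⇔_; mk⇔)
open import Level using (0ℓ)
open import Relation.Nullary using (¬_; yes; no)
open import Relation.Nullary.Decidable using (dec⇒maybe)
open import Relation.Binary.PropositionalEquality using (_≡_; _≢_; refl; sym; trans; cong; cong₂; subst; module ≡-Reasoning)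
open import Tactic.RingSolver using (solve-∀)
open import Tactic.RingSolver.Core.AlmostCommutativeRing using (AlmostCommutativeRing; fromCommutativeRing)

-- Eliminating between n and n-1 multiplies a relation by its own coefficients, so constants turn
-- into polynomials at the first step; the induction can only close over the polynomials. The
-- condition s_r ≥ 2 comes from the end of a word: n/C(2n-2,n-1) = (4n-2)/C(2n,n) supplies a factor
-- n that turns 1/n^i into 1/n^(i-1), so exponent 1 leaves no pole at 0 to argue with. In the
-- expansion such words have coefficient 0, because no admissible composition has weight 1. A pole
-- at 0 spreads along the integers because a and b are 1, X or 4X-2, which have no nonzero integer
-- root. The two equal subscripts of ζ(a)_{n,n} are separated into a lower bound p of the indices
-- and the parameter q of the binomial, and raised one at a time: q yields fin, p yields init, and p
-- after q yields mid. No real number is ever formed: identities hold up to null sequences in the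
-- truncation N, so the passage n → ∞ requires bounds uniform in N.

ring : AlmostCommutativeRing 0ℓ 0ℓ
ring = fromCommutativeRing ℚₚ.+-*-commutativeRing (λ x → dec⇒maybe (0ℚ ℚₚ.≟ x))

-- Arithmetic and order of the rationals

*-cong-0ˡ : ∀ {x} y → x ≡ 0ℚ → x * y ≡ 0ℚ
*-cong-0ˡ y refl = ℚₚ.*-zeroˡ y

*-cong-0ʳ : ∀ x {y} → y ≡ 0ℚ → x * y ≡ 0ℚ
*-cong-0ʳ x refl = ℚₚ.*-zeroʳ x

opaque
  reciprocal : ∀ x → x ≢ 0ℚ → ∃ λ y → y * x ≡ 1ℚ
  reciprocal x x≢0 = ℚ.1/_ x , ℚₚ.*-inverseˡ x
    where
    instance
      x-nonZero : ℚ.NonZero x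
      x-nonZero = ℚ.≢-nonZero x≢0

*-cancelˡ-0 : ∀ x {y} → x ≢ 0ℚ → x * y ≡ 0ℚ → y ≡ 0ℚ
*-cancelˡ-0 x {y} x≢0 xy≡0 with reciprocal x x≢0
... | r , rx≡1 = begin
  y           ≡⟨ ℚₚ.*-identityˡ y ⟨
  1ℚ * y      ≡⟨ cong (_* y) rx≡1 ⟨
  r * x * y   ≡⟨ ℚₚ.*-assoc r x y ⟩
  r * (x * y) ≡⟨ *-cong-0ʳ r xy≡0 ⟩
  0ℚ          ∎
  where open ≡-Reasoning

*-nonZero : ∀ {x y} → x ≢ 0ℚ → y ≢ 0ℚ → x * y ≢ 0ℚ
*-nonZero {x} x≢0 y≢0 xy≡0 = y≢0 (*-cancelˡ-0 x x≢0 xy≡0)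

x-y≡0⇒x≡y : ∀ x y → x - y ≡ 0ℚ → x ≡ y
x-y≡0⇒x≡y x y eq = begin
  x           ≡⟨ lemma x y ⟩
  x - y + y   ≡⟨ cong (_+ y) eq ⟩
  0ℚ + y      ≡⟨ ℚₚ.+-identityˡ y ⟩
  y           ∎
  where
  open ≡-Reasoning
  lemma : ∀ x y → x ≡ x - y + y
  lemma = solve-∀ ring

x≡y⇒x-y≡0 : ∀ {x y} → x ≡ y → x - y ≡ 0ℚ
x≡y⇒x-y≡0 {x} refl = ℚₚ.+-inverseʳ x

+-nonNeg : ∀ {x y} → 0ℚ ℚ.≤ x → 0ℚ ℚ.≤ y → 0ℚ ℚ.≤ x + y
+-nonNeg = ℚₚ.+-mono-≤

+-pos : ∀ {x y} → 0ℚ ℚ.< x → 0ℚ ℚ.≤ y → 0ℚ ℚ.< x + y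
+-pos = ℚₚ.+-mono-<-≤

*-monoʳ-≤ : ∀ {r x y} → 0ℚ ℚ.≤ r → x ℚ.≤ y → r * x ℚ.≤ r * y
*-monoʳ-≤ {r} 0≤r = ℚₚ.*-monoˡ-≤-nonNeg r
  where instance _ = ℚ.nonNegative 0≤r

*-monoˡ-≤ : ∀ {r x y} → 0ℚ ℚ.≤ r → x ℚ.≤ y → x * r ℚ.≤ y * r
*-monoˡ-≤ {r} 0≤r = ℚₚ.*-monoʳ-≤-nonNeg r
  where instance _ = ℚ.nonNegative 0≤r

*-mono-≤ : ∀ {w x y z} → 0ℚ ℚ.≤ w → 0ℚ ℚ.≤ z → w ℚ.≤ x → y ℚ.≤ z → w * y ℚ.≤ x * z
*-mono-≤ 0≤w 0≤z w≤x y≤z = ℚₚ.≤-trans (*-monoʳ-≤ 0≤w y≤z) (*-monoˡ-≤ 0≤z w≤x)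

*-nonNeg : ∀ {x y} → 0ℚ ℚ.≤ x → 0ℚ ℚ.≤ y → 0ℚ ℚ.≤ x * y
*-nonNeg {x} {y} 0≤x 0≤y = subst (ℚ._≤ x * y) (ℚₚ.*-zeroʳ x) (*-monoʳ-≤ 0≤x 0≤y)

*-pos : ∀ {x y} → 0ℚ ℚ.< x → 0ℚ ℚ.< y → 0ℚ ℚ.< x * y
*-pos {x} {y} 0<x 0<y = ℚₚ.positive⁻¹ (x * y)
  where instance
    _ = ℚ.positive 0<x
    _ = ℚ.positive 0<y
    _ = ℚₚ.pos*pos⇒pos x y

*-monoʳ-< : ∀ {r x y} → 0ℚ ℚ.< r → x ℚ.< y → r * x ℚ.< r * y
*-monoʳ-< {r} 0<r = ℚₚ.*-monoʳ-<-pos r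
  where instance _ = ℚ.positive 0<r

*-monoˡ-< : ∀ {r x y} → 0ℚ ℚ.< r → x ℚ.< y → x * r ℚ.< y * r
*-monoˡ-< {r} 0<r = ℚₚ.*-monoˡ-<-pos r
  where instance _ = ℚ.positive 0<r

pos⇒≢0 : ∀ {x} → 0ℚ ℚ.< x → x ≢ 0ℚ
pos⇒≢0 0<x refl = ℚₚ.<-irrefl refl 0<x

opaque
  reciprocal-pos : ∀ x → 0ℚ ℚ.< x → ∃ λ y → 0ℚ ℚ.< y × y * x ≡ 1ℚ
  reciprocal-pos x 0<x = ℚ.1/_ x , ℚₚ.positive⁻¹ (ℚ.1/ x) , ℚₚ.*-inverseˡ x
    where
    instance
      x-positive : ℚ.Positive x
      x-positive = ℚ.positive 0<x
      x-nonZero : ℚ.NonZero x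
      x-nonZero = ℚₚ.pos⇒nonZero x
      1/x-positive : ℚ.Positive (ℚ.1/ x)
      1/x-positive = ℚₚ.1/pos⇒pos x

-- Natural numbers in ℚ and their reciprocals

ι : ℕ → ℚ
ι zero    = 0ℚ
ι (suc n) = 1ℚ + ι n

ι-nonNeg : ∀ n → 0ℚ ℚ.≤ ι n
ι-nonNeg zero    = ℚₚ.≤-refl
ι-nonNeg (suc n) = +-nonNeg (ℚₚ.nonNegative⁻¹ 1ℚ) (ι-nonNeg n)

ι-pos : ∀ n → 0ℚ ℚ.< ι (suc n)
ι-pos n = +-pos (ℚₚ.positive⁻¹ 1ℚ) (ι-nonNeg n)

ι-suc≢0 : ∀ n → ι (suc n) ≢ 0ℚ
ι-suc≢0 n = pos⇒≢0 (ι-pos n)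

ι-+ : ∀ m n → ι (m ℕ.+ n) ≡ ι m + ι n
ι-+ zero    n = sym (ℚₚ.+-identityˡ (ι n))
ι-+ (suc m) n = trans (cong (1ℚ +_) (ι-+ m n)) (sym (ℚₚ.+-assoc 1ℚ (ι m) (ι n)))

ι-* : ∀ m n → ι (m ℕ.* n) ≡ ι m * ι n
ι-* zero    n = sym (ℚₚ.*-zeroˡ (ι n))
ι-* (suc m) n = begin
  ι (n ℕ.+ m ℕ.* n)  ≡⟨ ι-+ n (m ℕ.* n) ⟩
  ι n + ι (m ℕ.* n)  ≡⟨ cong (λ x → ι n + x) (ι-* m n) ⟩
  ι n + ι m * ι n    ≡⟨ lemma (ι m) (ι n) ⟩
  (1ℚ + ι m) * ι n   ∎
  where
  open ≡-Reasoning
  lemma : ∀ x y → y + x * y ≡ (1ℚ + x) * y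
  lemma = solve-∀ ring

ι-mono-≤ : ∀ {m n} → m ≤ n → ι m ℚ.≤ ι n
ι-mono-≤ {n = n} z≤n = ι-nonNeg n
ι-mono-≤ (s≤s m≤n)   = ℚₚ.+-monoʳ-≤ 1ℚ (ι-mono-≤ m≤n)

toℚᵘ-ι : ∀ n → ℚ.toℚᵘ (ι n) ℚᵘ.≃ ℚᵘ.mkℚᵘ (ℤ.+ n) 0
toℚᵘ-ι zero    = ℚᵘ.*≡* refl
toℚᵘ-ι (suc n) = ℚᵘₚ.≃-trans (ℚₚ.toℚᵘ-homo-+ 1ℚ (ι n))
  (ℚᵘₚ.≃-trans (ℚᵘₚ.+-congʳ ℚᵘ.1ℚᵘ (toℚᵘ-ι n)) (ℚᵘ.*≡* (lemma (ℤ.+ n))))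
  where
  lemma : ∀ x → (ℤ.1ℤ ℤ.* ℤ.1ℤ ℤ.+ x ℤ.* ℤ.1ℤ) ℤ.* ℤ.1ℤ ≡ (ℤ.1ℤ ℤ.+ x) ℤ.* ℤ.1ℤ
  lemma = ℤ-solve-∀

inv-ι : ∀ n → inv (suc n) * ι (suc n) ≡ 1ℚ
inv-ι n = ℚₚ.toℚᵘ-injective (ℚᵘₚ.≃-trans (ℚₚ.toℚᵘ-homo-* (inv (suc n)) (ι (suc n)))
  (ℚᵘₚ.≃-trans (ℚᵘₚ.*-cong (ℚₚ.toℚᵘ-fromℚᵘ (ℚᵘ.mkℚᵘ (ℤ.+ 1) n)) (toℚᵘ-ι (suc n)))
    (ℚᵘ.*≡* (cong ℤ.+_ lemma))))
  where
  lemma : (1 ℕ.* suc n) ℕ.* 1 ≡ 1 ℕ.* (suc n ℕ.* 1)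
  lemma = ℕₚ.*-assoc 1 (suc n) 1

inv-unique : ∀ n {x} → x * ι (suc n) ≡ 1ℚ → x ≡ inv (suc n)
inv-unique n {x} eq = begin
  x                                ≡⟨ ℚₚ.*-identityʳ x ⟨
  x * 1ℚ                           ≡⟨ cong (x *_) (inv-ι n) ⟨
  x * (inv (suc n) * ι (suc n))    ≡⟨ lemma x (inv (suc n)) (ι (suc n)) ⟩
  x * ι (suc n) * inv (suc n)      ≡⟨ cong (_* inv (suc n)) eq ⟩
  1ℚ * inv (suc n)                 ≡⟨ ℚₚ.*-identityˡ _ ⟩
  inv (suc n)                      ∎
  where
  open ≡-Reasoning
  lemma : ∀ x y z → x * (y * z) ≡ x * z * y
  lemma = solve-∀ ring

-- The default value `inv zero = 0ℚ` is itself multiplicative; for positive arguments both sides are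
-- inverse to the same product.
inv-* : ∀ m n → inv (m ℕ.* n) ≡ inv m * inv n
inv-* zero    n = sym (ℚₚ.*-zeroˡ (inv n))
inv-* (suc m) zero = trans (cong inv (ℕₚ.*-zeroʳ m)) (sym (ℚₚ.*-zeroʳ (inv (suc m))))
inv-* (suc m) (suc n) = sym (inv-unique (n ℕ.+ m ℕ.* suc n) (begin
  inv (suc m) * inv (suc n) * ι (suc m ℕ.* suc n)        ≡⟨ cong (inv (suc m) * inv (suc n) *_) (ι-* (suc m) (suc n)) ⟩
  inv (suc m) * inv (suc n) * (ι (suc m) * ι (suc n))    ≡⟨ lemma (inv (suc m)) (inv (suc n)) (ι (suc m)) (ι (suc n)) ⟩
  (inv (suc m) * ι (suc m)) * (inv (suc n) * ι (suc n))  ≡⟨ cong₂ _*_ (inv-ι m) (inv-ι n) ⟩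
  1ℚ                                                     ∎))
  where
  open ≡-Reasoning
  lemma : ∀ a b c d → a * b * (c * d) ≡ (a * c) * (b * d)
  lemma = solve-∀ ring

inv-pos : ∀ n → 0ℚ ℚ.< inv (suc n)
inv-pos n = ℚₚ.positive⁻¹ (inv (suc n))
  where instance _ = ℚₚ.normalize-pos 1 (suc n)

inv-nonNeg : ∀ n → 0ℚ ℚ.≤ inv n
inv-nonNeg zero    = ℚₚ.≤-refl
inv-nonNeg (suc n) = ℚₚ.<⇒≤ (inv-pos n)

inv-antimono : ∀ {m n} → 1 ≤ m → m ≤ n → inv n ℚ.≤ inv m
inv-antimono {suc m} {suc n} _ m≤n = begin
  inv (suc n)                              ≡⟨ ℚₚ.*-identityʳ _ ⟨
  inv (suc n) * 1ℚ                         ≡⟨ cong (inv (suc n) *_) (inv-ι m) ⟨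
  inv (suc n) * (inv (suc m) * ι (suc m))  ≤⟨ *-monoʳ-≤ (inv-nonNeg (suc n)) (*-monoʳ-≤ (inv-nonNeg (suc m)) (ι-mono-≤ m≤n)) ⟩
  inv (suc n) * (inv (suc m) * ι (suc n))  ≡⟨ lemma (inv (suc n)) (inv (suc m)) (ι (suc n)) ⟩
  inv (suc n) * ι (suc n) * inv (suc m)    ≡⟨ cong (_* inv (suc m)) (inv-ι n) ⟩
  1ℚ * inv (suc m)                         ≡⟨ ℚₚ.*-identityˡ _ ⟩
  inv (suc m)                              ∎
  where
  open ℚₚ.≤-Reasoning
  lemma : ∀ x y z → x * (y * z) ≡ x * z * y
  lemma = solve-∀ ring

inv-≤1 : ∀ n → inv n ℚ.≤ 1ℚ
inv-≤1 zero    = ℚₚ.nonNegative⁻¹ 1ℚ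
inv-≤1 (suc n) = inv-antimono {1} {suc n} (s≤s z≤n) (s≤s z≤n)

opaque
  -- A nonnegative fraction is at most its numerator, and a negative one is at most 0.
  archimedean : ∀ x → ∃ λ n → x ℚ.≤ ι n
  archimedean x@(ℚ.mkℚ (ℤ.+ n) d-1 _) = n , ℚₚ.toℚᵘ-cancel-≤ (ℚᵘₚ.≤-respʳ-≃ (ℚᵘₚ.≃-sym (toℚᵘ-ι n)) (ℚᵘ.*≤* lemma))
    where
    lemma : ℤ.+ n ℤ.* ℤ.+ 1 ℤ.≤ ℤ.+ n ℤ.* ℤ.+ suc d-1
    lemma = ℤₚ.*-monoˡ-≤-nonNeg (ℤ.+ n) (ℤ.+≤+ (s≤s z≤n))
  archimedean x@(ℚ.mkℚ (ℤ.-[1+ n ]) d-1 _) = 0 , ℚₚ.<⇒≤ (ℚₚ.negative⁻¹ x)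

opaque
  inv-small : ∀ ε → 0ℚ ℚ.< ε → ∃ λ n → ∀ m → n < m → inv m ℚ.< ε
  inv-small ε 0<ε with reciprocal-pos ε 0<ε
  ... | r , 0<r , rε≡1 with archimedean r
  ... | n , r≤n = n , bound
    where
    open ℚₚ.≤-Reasoning
    lemma : ∀ x y z → x * y * z ≡ (x * z) * y
    lemma = solve-∀ ring
    bound : ∀ m → n < m → inv m ℚ.< ε
    bound (suc m) (s≤s n≤m) = begin-strict
      inv (suc m)                 ≡⟨ ℚₚ.*-identityʳ _ ⟨
      inv (suc m) * 1ℚ            ≡⟨ cong (inv (suc m) *_) rε≡1 ⟨
      inv (suc m) * (r * ε)       ≤⟨ *-monoʳ-≤ (inv-nonNeg (suc m)) (*-monoˡ-≤ (ℚₚ.<⇒≤ 0<ε) (ℚₚ.≤-trans r≤n (ι-mono-≤ n≤m))) ⟩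
      inv (suc m) * (ι m * ε)     <⟨ *-monoʳ-< (inv-pos m) (*-monoˡ-< 0<ε (subst (ℚ._< ι (suc m)) (ℚₚ.+-identityˡ (ι m)) (ℚₚ.+-monoˡ-< (ι m) (ℚₚ.positive⁻¹ 1ℚ)))) ⟩
      inv (suc m) * (ι (suc m) * ε) ≡⟨ ℚₚ.*-assoc (inv (suc m)) (ι (suc m)) ε ⟨
      inv (suc m) * ι (suc m) * ε ≡⟨ cong (_* ε) (inv-ι m) ⟩
      1ℚ * ε                      ≡⟨ ℚₚ.*-identityˡ ε ⟩
      ε                           ∎

-- Null sequences

opaque
  halve : ∀ ε → 0ℚ ℚ.< ε → ∃ λ δ → 0ℚ ℚ.< δ × δ + δ ≡ ε
  halve ε 0<ε = ½ * ε , *-pos (ℚₚ.positive⁻¹ ½) 0<ε , trans (sym (ℚₚ.*-distribʳ-+ ε ½ ½)) (ℚₚ.*-identityˡ ε)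

opaque
  scale : ∀ c ε → 0ℚ ℚ.< ε → ∃ λ δ → 0ℚ ℚ.< δ × (∀ x → ∣ x ∣ ℚ.< δ → ∣ c * x ∣ ℚ.< ε)
  -- Adding 1 to ∣ c ∣ keeps the divisor positive when c = 0.
  scale c ε 0<ε with reciprocal-pos (1ℚ + ∣ c ∣) (+-pos (ℚₚ.positive⁻¹ 1ℚ) (ℚₚ.0≤∣p∣ c))
  ... | r , 0<r , r[1+c]≡1 = r * ε , *-pos 0<r 0<ε , bound
    where
    open ℚₚ.≤-Reasoning
    D : ℚ
    D = 1ℚ + ∣ c ∣
    lemma : ∀ x y z → x * (y * z) ≡ y * x * z
    lemma = solve-∀ ring
    bound : ∀ x → ∣ x ∣ ℚ.< r * ε → ∣ c * x ∣ ℚ.< ε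
    bound x x<rε = begin-strict
      ∣ c * x ∣       ≡⟨ ℚₚ.∣p*q∣≡∣p∣*∣q∣ c x ⟩
      ∣ c ∣ * ∣ x ∣   ≤⟨ *-monoˡ-≤ (ℚₚ.0≤∣p∣ x) (subst (ℚ._≤ D) (ℚₚ.+-identityˡ ∣ c ∣) (ℚₚ.+-monoˡ-≤ ∣ c ∣ (ℚₚ.nonNegative⁻¹ 1ℚ))) ⟩
      D * ∣ x ∣       <⟨ *-monoʳ-< (+-pos (ℚₚ.positive⁻¹ 1ℚ) (ℚₚ.0≤∣p∣ c)) x<rε ⟩
      D * (r * ε)     ≡⟨ lemma D r ε ⟩
      r * D * ε       ≡⟨ cong (_* ε) r[1+c]≡1 ⟩
      1ℚ * ε          ≡⟨ ℚₚ.*-identityˡ ε ⟩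
      ε               ∎

-- Sequences in N are compared only for large N, as the truncated identities need N to exceed n.
null-cong : ∀ {f g} N₀ → (∀ N → N₀ ≤ N → f N ≡ g N) → TendsToZero f → TendsToZero g
null-cong {f} {g} N₀ f≡g f→0 ε 0<ε with f→0 ε 0<ε
... | N₁ , small = N₀ ℕ.⊔ N₁ , λ N N≥ → subst (λ x → ∣ x ∣ ℚ.< ε)
  (f≡g N (ℕₚ.≤-trans (ℕₚ.m≤m⊔n N₀ N₁) N≥)) (small N (ℕₚ.≤-trans (ℕₚ.m≤n⊔m N₀ N₁) N≥))

null-≗ : ∀ {f g} → (∀ N → f N ≡ g N) → TendsToZero f → TendsToZero g
null-≗ f≡g = null-cong 0 (λ N _ → f≡g N)

null-bound : ∀ {f g} N₀ → (∀ N → N₀ ≤ N → ∣ f N ∣ ℚ.≤ ∣ g N ∣) → TendsToZero g → TendsToZero f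
null-bound N₀ f≤g g→0 ε 0<ε with g→0 ε 0<ε
... | N₁ , small = N₀ ℕ.⊔ N₁ , λ N N≥ → ℚₚ.≤-<-trans
  (f≤g N (ℕₚ.≤-trans (ℕₚ.m≤m⊔n N₀ N₁) N≥)) (small N (ℕₚ.≤-trans (ℕₚ.m≤n⊔m N₀ N₁) N≥))

null-0 : TendsToZero (λ _ → 0ℚ)
null-0 ε 0<ε = 0 , λ _ _ → 0<ε

null-+ : ∀ {f g} → TendsToZero f → TendsToZero g → TendsToZero (λ N → f N + g N)
null-+ {f} {g} f→0 g→0 ε 0<ε with halve ε 0<ε
... | δ , 0<δ , δ+δ≡ε with f→0 δ 0<δ | g→0 δ 0<δ
... | N₀ , f< | N₁ , g< = N₀ ℕ.⊔ N₁ , λ N N≥ → begin-strict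
  ∣ f N + g N ∣      ≤⟨ ℚₚ.∣p+q∣≤∣p∣+∣q∣ (f N) (g N) ⟩
  ∣ f N ∣ + ∣ g N ∣  <⟨ ℚₚ.+-mono-< (f< N (ℕₚ.≤-trans (ℕₚ.m≤m⊔n N₀ N₁) N≥)) (g< N (ℕₚ.≤-trans (ℕₚ.m≤n⊔m N₀ N₁) N≥)) ⟩
  δ + δ ≡⟨ δ+δ≡ε ⟩
  ε                  ∎
  where open ℚₚ.≤-Reasoning

null-* : ∀ c {f} → TendsToZero f → TendsToZero (λ N → c * f N)
null-* c {f} f→0 ε 0<ε with scale c ε 0<ε
... | δ , 0<δ , scaled with f→0 δ 0<δ
... | N₀ , f< = N₀ , λ N N≥ → scaled (f N) (f< N N≥)

null-neg : ∀ {f} → TendsToZero f → TendsToZero (λ N → - f N)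
null-neg {f} f→0 ε 0<ε with f→0 ε 0<ε
... | N₀ , f< = N₀ , λ N N≥ → subst (ℚ._< ε) (sym (ℚₚ.∣-p∣≡∣p∣ (f N))) (f< N N≥)

null-const : ∀ c → TendsToZero (λ _ → c) → c ≡ 0ℚ
null-const c c→0 with c ℚₚ.≟ 0ℚ
... | yes c≡0 = c≡0
... | no c≢0 with c→0 ∣ c ∣ (ℚₚ.≰⇒> (λ ∣c∣≤0 → c≢0 (ℚₚ.∣p∣≡0⇒p≡0 c (ℚₚ.≤-antisym ∣c∣≤0 (ℚₚ.0≤∣p∣ c)))))
... | N , c< = ⊥-elim (ℚₚ.<-irrefl refl (c< N ℕₚ.≤-refl))

infix 4 _∼_
record _∼_ (f g : ℕ → ℚ) : Set where
  constructor null-difference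
  field
    difference-null : TendsToZero (λ N → f N - g N)

open _∼_

∼-reflexive : ∀ {f g} N₀ → (∀ N → N₀ ≤ N → f N ≡ g N) → f ∼ g
∼-reflexive N₀ f≡g = null-difference (null-cong N₀ (λ N N≥ → sym (x≡y⇒x-y≡0 (f≡g N N≥))) null-0)

∼-sym : ∀ {f g} → f ∼ g → g ∼ f
∼-sym {f} {g} f∼g = null-difference (null-≗ (λ N → lemma (f N) (g N)) (null-neg (difference-null f∼g)))
  where
  lemma : ∀ x y → - (x - y) ≡ y - x
  lemma = solve-∀ ring

∼-trans : ∀ {f g h} → f ∼ g → g ∼ h → f ∼ h
∼-trans {f} {g} {h} f∼g g∼h = null-difference (null-≗ (λ N → lemma (f N) (g N) (h N))
  (null-+ (difference-null f∼g) (difference-null g∼h)))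
  where
  lemma : ∀ x y z → (x - y) + (y - z) ≡ x - z
  lemma = solve-∀ ring

∼-+ : ∀ {f f′ g g′} → f ∼ f′ → g ∼ g′ → (λ N → f N + g N) ∼ (λ N → f′ N + g′ N)
∼-+ {f} {f′} {g} {g′} f∼ g∼ = null-difference (null-≗ (λ N → lemma (f N) (f′ N) (g N) (g′ N))
  (null-+ (difference-null f∼) (difference-null g∼)))
  where
  lemma : ∀ x x′ y y′ → (x - x′) + (y - y′) ≡ x + y - (x′ + y′)
  lemma = solve-∀ ring

∼-* : ∀ c {f g} → f ∼ g → (λ N → c * f N) ∼ (λ N → c * g N)
∼-* c {f} {g} f∼g = null-difference (null-≗ (λ N → lemma c (f N) (g N)) (null-* c (difference-null f∼g)))
  where
  lemma : ∀ c x y → c * (x - y) ≡ c * x - c * y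
  lemma = solve-∀ ring

null-∼ : ∀ {f g} → f ∼ g → TendsToZero g → TendsToZero f
null-∼ {f} {g} f∼g g→0 = null-≗ (λ N → lemma (f N) (g N)) (null-+ (difference-null f∼g) g→0)
  where
  lemma : ∀ x y → (x - y) + y ≡ x
  lemma = solve-∀ ring

-- The threshold n₀ must not depend on N, because N is chosen only after a far value of n has been
-- fixed.
UniformlySmall : (ℕ → ℕ → ℚ) → Set
UniformlySmall f = ∀ ε → 0ℚ ℚ.< ε → ∃ λ n₀ → ∀ n N → n₀ ≤ n → ∣ f n N ∣ ℚ.< ε

small-+ : ∀ {f g} → UniformlySmall f → UniformlySmall g → UniformlySmall (λ n N → f n N + g n N)
small-+ {f} {g} f→0 g→0 ε 0<ε with halve ε 0<ε
... | δ , 0<δ , δ+δ≡ε with f→0 δ 0<δ | g→0 δ 0<δ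
... | m₀ , f< | m₁ , g< = m₀ ℕ.⊔ m₁ , λ n N n≥ → begin-strict
  ∣ f n N + g n N ∣        ≤⟨ ℚₚ.∣p+q∣≤∣p∣+∣q∣ (f n N) (g n N) ⟩
  ∣ f n N ∣ + ∣ g n N ∣    <⟨ ℚₚ.+-mono-< (f< n N (ℕₚ.≤-trans (ℕₚ.m≤m⊔n m₀ m₁) n≥)) (g< n N (ℕₚ.≤-trans (ℕₚ.m≤n⊔m m₀ m₁) n≥)) ⟩
  δ + δ       ≡⟨ δ+δ≡ε ⟩
  ε                        ∎
  where open ℚₚ.≤-Reasoning

small-* : ∀ c {f} → UniformlySmall f → UniformlySmall (λ n N → c * f n N)
small-* c {f} f→0 ε 0<ε with scale c ε 0<ε
... | δ , 0<δ , scaled with f→0 δ 0<δ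
... | n₀ , f< = n₀ , λ n N n≥ → scaled (f n N) (f< n N n≥)

small-0 : UniformlySmall (λ _ _ → 0ℚ)
small-0 ε 0<ε = 0 , λ _ _ _ → 0<ε

small-inv-bound : ∀ {f} → (∀ n N → 0ℚ ℚ.≤ f (suc n) N) → (∀ n N → f (suc n) N ℚ.≤ inv (suc n)) → UniformlySmall f
small-inv-bound {f} f≥0 f≤ ε 0<ε with inv-small ε 0<ε
... | n₀ , inv< = suc n₀ , bound
  where
  bound : ∀ n N → suc n₀ ≤ n → ∣ f n N ∣ ℚ.< ε
  bound (suc n) N n≥ = ℚₚ.≤-<-trans
    (ℚₚ.≤-trans (ℚₚ.≤-reflexive (ℚₚ.0≤p⇒∣p∣≡p (f≥0 n N))) (f≤ n N)) (inv< (suc n) n≥)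

-- Finitely many null differences lead from n to a value where the whole family is below ε/2. This
-- is how a recurrence in n and decay in n together become an identity.
null-of-constant-limit : ∀ f → (∀ n → f n ∼ f (suc n)) → UniformlySmall f → ∀ n → TendsToZero (f n)
null-of-constant-limit f step f→0 n ε 0<ε with halve ε 0<ε
... | δ , 0<δ , δ+δ≡ε with f→0 δ 0<δ
... | n₀ , f< with difference-null (chain n₀) δ 0<δ
  where
  chain : ∀ d → f n ∼ f (d ℕ.+ n)
  chain zero    = ∼-reflexive 0 (λ _ _ → refl)
  chain (suc d) = ∼-trans (chain d) (step (d ℕ.+ n))
... | N₀ , close = N₀ , λ N N≥ → begin-strict
  ∣ f n N ∣                                  ≡⟨ cong ∣_∣ (lemma (f n N) (f (n₀ ℕ.+ n) N)) ⟩
  ∣ f n N - f (n₀ ℕ.+ n) N + f (n₀ ℕ.+ n) N ∣ ≤⟨ ℚₚ.∣p+q∣≤∣p∣+∣q∣ (f n N - f (n₀ ℕ.+ n) N) _ ⟩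
  ∣ f n N - f (n₀ ℕ.+ n) N ∣ + ∣ f (n₀ ℕ.+ n) N ∣ <⟨ ℚₚ.+-mono-< (close N N≥) (f< (n₀ ℕ.+ n) N (ℕₚ.m≤m+n n₀ n)) ⟩
  δ + δ                         ≡⟨ δ+δ≡ε ⟩
  ε                                          ∎
  where
  open ℚₚ.≤-Reasoning
  lemma : ∀ x y → x ≡ x - y + y
  lemma = solve-∀ ring

-- Polynomials over ℚ

infixl 6 _⊕_
infixl 7 _⊗_
infixl 8 _⊚_
-- Expressions rather than coefficient lists: evaluation then computes, and identities go to the
-- ring solver. Composition `_⊚_` provides shifts and reflections. Coefficient lists serve only to
-- count roots and to measure growth.
data Poly : Set where
  con   : ℚ → Poly
  X     : Poly
  _⊕_   : Poly → Poly → Poly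
  _⊗_   : Poly → Poly → Poly
  _⊚_   : Poly → Poly → Poly

⟦_⟧ : Poly → ℚ → ℚ
⟦ con c ⟧     x = c
⟦ X ⟧         x = x
⟦ p ⊕ q ⟧     x = ⟦ p ⟧ x + ⟦ q ⟧ x
⟦ p ⊗ q ⟧     x = ⟦ p ⟧ x * ⟦ q ⟧ x
⟦ p ⊚ q ⟧     x = ⟦ p ⟧ (⟦ q ⟧ x)

horner : List ℚ → ℚ → ℚ
horner []       x = 0ℚ
horner (c ∷ cs) x = c + x * horner cs x

addˡ : List ℚ → List ℚ → List ℚ
addˡ []       ds       = ds
addˡ (c ∷ cs) []       = c ∷ cs
addˡ (c ∷ cs) (d ∷ ds) = c + d ∷ addˡ cs ds

mulˡ : List ℚ → List ℚ → List ℚ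
mulˡ []       ds = []
mulˡ (c ∷ cs) ds = addˡ (map (c *_) ds) (0ℚ ∷ mulˡ cs ds)

compˡ : List ℚ → List ℚ → List ℚ
compˡ []       ds = []
compˡ (c ∷ cs) ds = addˡ (c ∷ []) (mulˡ ds (compˡ cs ds))

horner-add : ∀ cs ds x → horner (addˡ cs ds) x ≡ horner cs x + horner ds x
horner-add []       ds       x = sym (ℚₚ.+-identityˡ _)
horner-add (c ∷ cs) []       x = sym (ℚₚ.+-identityʳ _)
horner-add (c ∷ cs) (d ∷ ds) x = trans (cong (λ y → c + d + x * y) (horner-add cs ds x))
  (lemma c d x (horner cs x) (horner ds x))
  where
  lemma : ∀ c d x y z → c + d + x * (y + z) ≡ c + x * y + (d + x * z)
  lemma = solve-∀ ring

horner-scale : ∀ c ds x → horner (map (c *_) ds) x ≡ c * horner ds x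
horner-scale c []       x = sym (ℚₚ.*-zeroʳ c)
horner-scale c (d ∷ ds) x = trans (cong (λ y → c * d + x * y) (horner-scale c ds x)) (lemma c d x (horner ds x))
  where
  lemma : ∀ c d x y → c * d + x * (c * y) ≡ c * (d + x * y)
  lemma = solve-∀ ring

horner-mul : ∀ cs ds x → horner (mulˡ cs ds) x ≡ horner cs x * horner ds x
horner-mul []       ds x = sym (ℚₚ.*-zeroˡ (horner ds x))
horner-mul (c ∷ cs) ds x = begin
  horner (addˡ (map (c *_) ds) (0ℚ ∷ mulˡ cs ds)) x              ≡⟨ horner-add (map (c *_) ds) _ x ⟩
  horner (map (c *_) ds) x + (0ℚ + x * horner (mulˡ cs ds) x)    ≡⟨ cong₂ (λ y z → y + (0ℚ + x * z)) (horner-scale c ds x) (horner-mul cs ds x) ⟩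
  c * horner ds x + (0ℚ + x * (horner cs x * horner ds x))       ≡⟨ lemma c x (horner cs x) (horner ds x) ⟩
  (c + x * horner cs x) * horner ds x                            ∎
  where
  open ≡-Reasoning
  lemma : ∀ c x y z → c * z + (0ℚ + x * (y * z)) ≡ (c + x * y) * z
  lemma = solve-∀ ring

horner-comp : ∀ cs ds x → horner (compˡ cs ds) x ≡ horner cs (horner ds x)
horner-comp []       ds x = refl
horner-comp (c ∷ cs) ds x = begin
  horner (addˡ (c ∷ []) (mulˡ ds (compˡ cs ds))) x            ≡⟨ horner-add (c ∷ []) (mulˡ ds (compˡ cs ds)) x ⟩
  horner (c ∷ []) x + horner (mulˡ ds (compˡ cs ds)) x        ≡⟨ cong (horner (c ∷ []) x +_) (horner-mul ds (compˡ cs ds) x) ⟩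
  horner (c ∷ []) x + horner ds x * horner (compˡ cs ds) x    ≡⟨ cong (λ y → horner (c ∷ []) x + horner ds x * y) (horner-comp cs ds x) ⟩
  horner (c ∷ []) x + horner ds x * horner cs (horner ds x)   ≡⟨ lemma c x (horner ds x * horner cs (horner ds x)) ⟩
  c + horner ds x * horner cs (horner ds x)                   ∎
  where
  open ≡-Reasoning
  lemma : ∀ c x y → c + x * 0ℚ + y ≡ c + y
  lemma = solve-∀ ring

coefficients : Poly → List ℚ
coefficients (con c)     = c ∷ []
coefficients X           = 0ℚ ∷ 1ℚ ∷ []
coefficients (p ⊕ q)     = addˡ (coefficients p) (coefficients q)
coefficients (p ⊗ q)     = mulˡ (coefficients p) (coefficients q)
coefficients (p ⊚ q)     = compˡ (coefficients p) (coefficients q)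

horner-coefficients : ∀ p x → horner (coefficients p) x ≡ ⟦ p ⟧ x
horner-coefficients (con c) x = lemma c x
  where
  lemma : ∀ c x → c + x * 0ℚ ≡ c
  lemma = solve-∀ ring
horner-coefficients X x = lemma x
  where
  lemma : ∀ x → 0ℚ + x * (1ℚ + x * 0ℚ) ≡ x
  lemma = solve-∀ ring
horner-coefficients (p ⊕ q) x = trans (horner-add (coefficients p) (coefficients q) x)
  (cong₂ _+_ (horner-coefficients p x) (horner-coefficients q x))
horner-coefficients (p ⊗ q) x = trans (horner-mul (coefficients p) (coefficients q) x)
  (cong₂ _*_ (horner-coefficients p x) (horner-coefficients q x))
horner-coefficients (p ⊚ q) x = trans (horner-comp (coefficients p) (coefficients q) x)
  (trans (cong (horner (coefficients p)) (horner-coefficients q x)) (horner-coefficients p (⟦ q ⟧ x)))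

-- Synthetic division by x - r: the coefficients of the quotient are the values at r of the
-- successive Horner tails.
quotient : ℚ → List ℚ → List ℚ
quotient r []           = []
quotient r (c ∷ [])     = []
quotient r (c ∷ d ∷ cs) = horner (d ∷ cs) r ∷ quotient r (d ∷ cs)

length-quotient : ∀ r c cs → length (quotient r (c ∷ cs)) ≡ length cs
length-quotient r c []       = refl
length-quotient r c (d ∷ cs) = cong suc (length-quotient r d cs)

horner-quotient : ∀ r cs x → horner cs x ≡ horner cs r + (x - r) * horner (quotient r cs) x
horner-quotient r [] x = lemma r x
  where
  lemma : ∀ r x → 0ℚ ≡ 0ℚ + (x - r) * 0ℚ
  lemma = solve-∀ ring
horner-quotient r (c ∷ []) x = lemma r c x
  where
  lemma : ∀ r c x → c + x * 0ℚ ≡ c + r * 0ℚ + (x - r) * 0ℚ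
  lemma = solve-∀ ring
horner-quotient r (c ∷ cs@(_ ∷ _)) x = trans (cong (λ y → c + x * y) (horner-quotient r cs x))
  (lemma r c x (horner cs r) (horner (quotient r cs) x))
  where
  lemma : ∀ r c x y z → c + x * (y + (x - r) * z) ≡ c + r * y + (x - r) * (y + x * z)
  lemma = solve-∀ ring

ι-<⇒≢ : ∀ {m n} → m < n → ι n - ι m ≢ 0ℚ
ι-<⇒≢ {m} {n} m<n eq = ι-suc≢0 (n ∸ suc m) (begin
  ι (suc (n ∸ suc m))                  ≡⟨ lemma (ι (suc (n ∸ suc m))) (ι m) ⟩
  ι (suc (n ∸ suc m)) + ι m - ι m      ≡⟨ cong (_- ι m) (sym (ι-+ (suc (n ∸ suc m)) m)) ⟩
  ι (suc (n ∸ suc m) ℕ.+ m) - ι m      ≡⟨ cong (λ k → ι k - ι m) (trans (sym (ℕₚ.+-suc (n ∸ suc m) m)) (ℕₚ.m∸n+n≡m m<n)) ⟩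
  ι n - ι m                            ≡⟨ eq ⟩
  0ℚ                                   ∎)
  where
  open ≡-Reasoning
  lemma : ∀ x y → x ≡ x + y - y
  lemma = solve-∀ ring

-- The root ι n₀ is divided off; the quotient is shorter and still vanishes at all later integers,
-- where x - ι n₀ is nonzero.
horner-identity : ∀ d cs → length cs ≤ d → ∀ n₀ → (∀ n → n₀ ≤ n → horner cs (ι n) ≡ 0ℚ) → ∀ x → horner cs x ≡ 0ℚ
horner-identity d       []       _         n₀ vanish x = refl
horner-identity (suc d) (c ∷ cs) (s≤s len) n₀ vanish x = begin
  horner (c ∷ cs) x                       ≡⟨ horner-quotient r (c ∷ cs) x ⟩
  horner (c ∷ cs) r + (x - r) * horner q x ≡⟨ cong₂ (λ y z → y + (x - r) * z) (vanish n₀ ℕₚ.≤-refl) q≡0 ⟩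
  0ℚ + (x - r) * 0ℚ                       ≡⟨ lemma x r ⟩
  0ℚ                                      ∎
  where
  open ≡-Reasoning
  r = ι n₀
  q = quotient r (c ∷ cs)
  lemma : ∀ x r → 0ℚ + (x - r) * 0ℚ ≡ 0ℚ
  lemma = solve-∀ ring
  vanish-q : ∀ n → suc n₀ ≤ n → horner q (ι n) ≡ 0ℚ
  vanish-q n n> = *-cancelˡ-0 (ι n - r) (ι-<⇒≢ n>) (begin
    (ι n - r) * horner q (ι n)                          ≡⟨ ℚₚ.+-identityˡ _ ⟨
    0ℚ + (ι n - r) * horner q (ι n)                     ≡⟨ cong (_+ (ι n - r) * horner q (ι n)) (vanish n₀ ℕₚ.≤-refl) ⟨
    horner (c ∷ cs) r + (ι n - r) * horner q (ι n)      ≡⟨ horner-quotient r (c ∷ cs) (ι n) ⟨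
    horner (c ∷ cs) (ι n)                               ≡⟨ vanish n (ℕₚ.<⇒≤ n>) ⟩
    0ℚ                                                  ∎)
  q≡0 : horner q x ≡ 0ℚ
  q≡0 = horner-identity d q (subst (_≤ d) (sym (length-quotient r c cs)) len) (suc n₀) vanish-q x

Zero : Poly → Set
Zero p = ∀ x → ⟦ p ⟧ x ≡ 0ℚ

poly-identity : ∀ p n₀ → (∀ n → n₀ ≤ n → ⟦ p ⟧ (ι n) ≡ 0ℚ) → Zero p
poly-identity p n₀ vanish x = trans (sym (horner-coefficients p x))
  (horner-identity _ (coefficients p) ℕₚ.≤-refl n₀ (λ n n≥ → trans (horner-coefficients p (ι n)) (vanish n n≥)) x)

-- A decidable dichotomy by induction on the degree: for c + x q, either q = 0 and c decides, or ∣ q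
-- ∣ stays above some δ and x q outgrows c.
horner-growth : ∀ cs → (∀ x → horner cs x ≡ 0ℚ) ⊎
  (∃ λ δ → 0ℚ ℚ.< δ × ∃ λ n₀ → ∀ n → n₀ ≤ n → δ ℚ.≤ ∣ horner cs (ι n) ∣)
horner-growth []       = inj₁ (λ _ → refl)
horner-growth (c ∷ cs) with horner-growth cs
... | inj₁ zero-cs with c ℚₚ.≟ 0ℚ
...   | yes c≡0 = inj₁ (λ x → cong₂ _+_ c≡0 (*-cong-0ʳ x (zero-cs x)))
...   | no c≢0  = inj₂ (∣ c ∣ , ∣c∣>0 , 0 , λ n _ → ℚₚ.≤-reflexive (cong ∣_∣ (sym (trans (cong (c +_) (*-cong-0ʳ (ι n) (zero-cs (ι n)))) (ℚₚ.+-identityʳ c)))))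
  where
  ∣c∣>0 : 0ℚ ℚ.< ∣ c ∣
  ∣c∣>0 = ℚₚ.≰⇒> (λ ∣c∣≤0 → c≢0 (ℚₚ.∣p∣≡0⇒p≡0 c (ℚₚ.≤-antisym ∣c∣≤0 (ℚₚ.0≤∣p∣ c))))
horner-growth (c ∷ cs) | inj₂ (δ , 0<δ , n₀ , grow) with reciprocal-pos δ 0<δ
-- The integer m satisfies m δ ≥ ∣ c ∣, so for n > m the term n q exceeds ∣ c ∣ by at least δ.
... | r , 0<r , rδ≡1 with archimedean (∣ c ∣ * r)
... | m , c/δ≤m = inj₂ (δ , 0<δ , n₀ ℕ.⊔ suc m , bound)
  where
  open ℚₚ.≤-Reasoning
  lemma₁ : ∀ x y → x ≡ x + y - y
  lemma₁ = solve-∀ ring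
  lemma₂ : ∀ x y → x ≡ (y + x) - y
  lemma₂ = solve-∀ ring
  lemma₃ : ∀ δ c m → (1ℚ + m) * δ ≡ δ + m * δ
  lemma₃ = solve-∀ ring
  c≤mδ : ∣ c ∣ ℚ.≤ ι m * δ
  c≤mδ = begin
    ∣ c ∣             ≡⟨ ℚₚ.*-identityʳ ∣ c ∣ ⟨
    ∣ c ∣ * 1ℚ        ≡⟨ cong (∣ c ∣ *_) rδ≡1 ⟨
    ∣ c ∣ * (r * δ)   ≡⟨ ℚₚ.*-assoc ∣ c ∣ r δ ⟨
    ∣ c ∣ * r * δ     ≤⟨ *-monoˡ-≤ (ℚₚ.<⇒≤ 0<δ) c/δ≤m ⟩
    ι m * δ           ∎
  bound : ∀ n → n₀ ℕ.⊔ suc m ≤ n → δ ℚ.≤ ∣ c + ι n * horner cs (ι n) ∣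
  bound n n≥ = begin
    δ                                    ≡⟨ lemma₁ δ ∣ c ∣ ⟩
    δ + ∣ c ∣ - ∣ c ∣                    ≤⟨ ℚₚ.+-monoˡ-≤ (- ∣ c ∣) (begin
      δ + ∣ c ∣                            ≤⟨ ℚₚ.+-monoʳ-≤ δ c≤mδ ⟩
      δ + ι m * δ                          ≡⟨ lemma₃ δ c (ι m) ⟨
      ι (suc m) * δ                        ≤⟨ *-monoˡ-≤ (ℚₚ.<⇒≤ 0<δ) (ι-mono-≤ (ℕₚ.≤-trans (ℕₚ.m≤n⊔m n₀ (suc m)) n≥)) ⟩
      ι n * δ                              ≤⟨ *-monoʳ-≤ (ι-nonNeg n) (grow n (ℕₚ.≤-trans (ℕₚ.m≤m⊔n n₀ (suc m)) n≥)) ⟩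
      ι n * ∣ E ∣                          ≡⟨ cong (_* ∣ E ∣) (ℚₚ.0≤p⇒∣p∣≡p (ι-nonNeg n)) ⟨
      ∣ ι n ∣ * ∣ E ∣                      ≡⟨ ℚₚ.∣p*q∣≡∣p∣*∣q∣ (ι n) E ⟨
      ∣ ι n * E ∣                          ≡⟨ cong ∣_∣ (lemma₂ (ι n * E) c) ⟩
      ∣ (c + ι n * E) - c ∣                ≤⟨ ℚₚ.∣p-q∣≤∣p∣+∣q∣ (c + ι n * E) c ⟩
      ∣ c + ι n * E ∣ + ∣ c ∣              ∎) ⟩
    ∣ c + ι n * E ∣ + ∣ c ∣ - ∣ c ∣      ≡⟨ lemma₁ ∣ c + ι n * E ∣ ∣ c ∣ ⟨
    ∣ c + ι n * E ∣                      ∎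
    where
    E : ℚ
    E = horner cs (ι n)

EventuallyNonZero : Poly → Set
EventuallyNonZero p = ∃ λ n₀ → ∀ n → n₀ ≤ n → ⟦ p ⟧ (ι n) ≢ 0ℚ

opaque
  zero? : ∀ p → Zero p ⊎ EventuallyNonZero p
  zero? p with horner-growth (coefficients p)
  ... | inj₁ p≡0 = inj₁ (λ x → trans (sym (horner-coefficients p x)) (p≡0 x))
  ... | inj₂ (δ , 0<δ , n₀ , grow) = inj₂ (n₀ , λ n n≥ p≡0 → ℚₚ.<-irrefl refl (ℚₚ.<-≤-trans 0<δ
    (ℚₚ.≤-trans (grow n n≥) (ℚₚ.≤-reflexive (cong ∣_∣ (trans (horner-coefficients p (ι n)) p≡0))))))

-- Polynomials have no zero divisors: q vanishes at all large integers, where p does not, and hence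
-- everywhere.
poly-cancel : ∀ p q → EventuallyNonZero p → (∀ x → ⟦ p ⟧ x * ⟦ q ⟧ x ≡ 0ℚ) → Zero q
poly-cancel p q (n₀ , p≢0) pq≡0 = poly-identity q n₀ (λ n n≥ → *-cancelˡ-0 (⟦ p ⟧ (ι n)) (p≢0 n n≥) (pq≡0 (ι n)))

X-eventuallyNonZero : EventuallyNonZero X
X-eventuallyNonZero = 1 , λ { (suc n) _ → ι-suc≢0 n }

infixl 6 _⊖_
_⊖_ : Poly → Poly → Poly
p ⊖ q = p ⊕ con (- 1ℚ) ⊗ q

poly-cancel-≡ : ∀ p q r → EventuallyNonZero p → (∀ x → ⟦ p ⟧ x * ⟦ q ⊖ r ⟧ x ≡ 0ℚ) → ∀ x → ⟦ q ⟧ x ≡ ⟦ r ⟧ x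
poly-cancel-≡ p q r p≢0 multiple x = x-y≡0⇒x≡y (⟦ q ⟧ x) (⟦ r ⟧ x)
  (trans (lemma (⟦ q ⟧ x) (⟦ r ⟧ x)) (poly-cancel p (q ⊖ r) p≢0 multiple x))
  where
  lemma : ∀ x y → x - y ≡ x + - 1ℚ * y
  lemma = solve-∀ ring

σ τ : Poly → Poly
σ p = p ⊚ (X ⊕ con (- 1ℚ))
τ p = p ⊚ (X ⊕ con 1ℚ)

x+1-1 : ∀ x → x + 1ℚ + - 1ℚ ≡ x
x+1-1 = solve-∀ ring

x-1+1 : ∀ x → x + - 1ℚ + 1ℚ ≡ x
x-1+1 = solve-∀ ring

ι-pred : ∀ n → ι (suc n) + - 1ℚ ≡ ι n
ι-pred n = lemma (ι n)
  where
  lemma : ∀ x → 1ℚ + x + - 1ℚ ≡ x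
  lemma = solve-∀ ring

σ-eventuallyNonZero : ∀ p → EventuallyNonZero p → EventuallyNonZero (σ p)
σ-eventuallyNonZero p (n₀ , p≢0) = suc n₀ , λ
  { (suc n) (s≤s n≥) σp≡0 → p≢0 n n≥ (trans (cong ⟦ p ⟧ (sym (ι-pred n))) σp≡0) }

negative : ℕ → ℚ
negative n = - 1ℚ * ι n + - 1ℚ

negative-suc : ∀ n → negative (suc n) ≡ negative n + - 1ℚ
negative-suc n = lemma (ι n)
  where
  lemma : ∀ x → - 1ℚ * (1ℚ + x) + - 1ℚ ≡ - 1ℚ * x + - 1ℚ + - 1ℚ
  lemma = solve-∀ ring

negative≢0 : ∀ n → negative n ≢ 0ℚ
negative≢0 n eq = ι-suc≢0 n (trans (lemma (ι n)) (*-cong-0ʳ (- 1ℚ) eq))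
  where
  lemma : ∀ x → 1ℚ + x ≡ - 1ℚ * (- 1ℚ * x + - 1ℚ)
  lemma = solve-∀ ring

-- The involution x ↦ -x - 1 exchanges the negative integers with the natural numbers, and p
-- composed with it is zero only if p is.
negative-nonRoot : ∀ p → EventuallyNonZero p → ∃ λ n → ⟦ p ⟧ (negative n) ≢ 0ℚ
negative-nonRoot p (n₀ , p≢0) with zero? (p ⊚ (con (- 1ℚ) ⊗ X ⊕ con (- 1ℚ)))
... | inj₂ (n , nonZero) = n , nonZero n ℕₚ.≤-refl
... | inj₁ zero-p = ⊥-elim (p≢0 n₀ ℕₚ.≤-refl (trans (cong ⟦ p ⟧ (lemma (ι n₀))) (zero-p (- 1ℚ * (ι n₀ + 1ℚ)))))
  where
  lemma : ∀ x → x ≡ - 1ℚ * (- 1ℚ * (x + 1ℚ)) + - 1ℚ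
  lemma = solve-∀ ring

-- Poles of solutions of first-order difference equations

-- The point 0 is left out: X and its powers, to which this is applied, vanish there, and that zero
-- is what creates the pole.
NonZeroOnIntegers : Poly → Set
NonZeroOnIntegers p = (∀ n → ⟦ p ⟧ (ι (suc n)) ≢ 0ℚ) × (∀ n → ⟦ p ⟧ (negative n) ≢ 0ℚ)

-- The rational function Q / P has no pole at c.
Regular : Poly → Poly → ℚ → Set
Regular P Q c = ∃ λ u → ∃ λ v → ⟦ v ⟧ c ≢ 0ℚ × (∀ x → ⟦ v ⟧ x * ⟦ Q ⟧ x ≡ ⟦ u ⟧ x * ⟦ P ⟧ x)

regular : ∀ P Q c → ⟦ P ⟧ c ≢ 0ℚ → Regular P Q c
regular P Q c Pc≢0 = Q , P , Pc≢0 , λ x → ℚₚ.*-comm (⟦ P ⟧ x) (⟦ Q ⟧ x)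

-- R = Q / P satisfies e · (a · R − b · σ R) = C₀, where e(0) = 0 and C₀(0) ≠ 0:
-- so a R − b σ R has a pole at 0, but at no other integer.
module Pole
  (P Q a b e C₀ : Poly)
  (P≢0 : EventuallyNonZero P)
  (a≢0 : NonZeroOnIntegers a) (b≢0 : NonZeroOnIntegers b) (e≢0 : NonZeroOnIntegers e)
  (equation : ∀ x → ⟦ e ⟧ x * (⟦ a ⟧ x * (⟦ Q ⟧ x * ⟦ σ P ⟧ x) + - 1ℚ * (⟦ b ⟧ x * (⟦ σ Q ⟧ x * ⟦ P ⟧ x)))
                    ≡ ⟦ C₀ ⟧ x * (⟦ P ⟧ x * ⟦ σ P ⟧ x))
  where

  -- Inserting R(x-1) = σu / σv into the equation gives R = (e b σu + C₀ σv) / (e a σv). Clearing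
  -- denominators leaves a factor σP, which is cancelled.
  solved : ∀ u v → (∀ x → ⟦ v ⟧ x * ⟦ Q ⟧ x ≡ ⟦ u ⟧ x * ⟦ P ⟧ x) →
    ∀ x → ⟦ e ⊗ a ⊗ σ v ⟧ x * ⟦ Q ⟧ x ≡ ⟦ e ⊗ b ⊗ σ u ⊕ C₀ ⊗ σ v ⟧ x * ⟦ P ⟧ x
  solved u v vQ≡uP =
    poly-cancel-≡ (σ P) (e ⊗ a ⊗ σ v ⊗ Q) ((e ⊗ b ⊗ σ u ⊕ C₀ ⊗ σ v) ⊗ P) (σ-eventuallyNonZero P P≢0) multiple
    where
    lemma₁ : ∀ e a b c P p Q q u v → p * (e * a * v * Q + - 1ℚ * ((e * b * u + c * v) * P)) ≡
      v * (e * (a * (Q * p) + - 1ℚ * (b * (q * P))) - c * (P * p)) + e * b * P * (v * q - u * p)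
    lemma₁ = solve-∀ ring
    multiple : ∀ x → ⟦ σ P ⟧ x * ⟦ e ⊗ a ⊗ σ v ⊗ Q ⊖ (e ⊗ b ⊗ σ u ⊕ C₀ ⊗ σ v) ⊗ P ⟧ x ≡ 0ℚ
    multiple x = trans (lemma₁ (⟦ e ⟧ x) (⟦ a ⟧ x) (⟦ b ⟧ x) (⟦ C₀ ⟧ x) (⟦ P ⟧ x) (⟦ σ P ⟧ x) (⟦ Q ⟧ x) (⟦ σ Q ⟧ x) (⟦ σ u ⟧ x) (⟦ σ v ⟧ x))
      (cong₂ _+_ (*-cong-0ʳ (⟦ σ v ⟧ x) (x≡y⇒x-y≡0 (equation x)))
                 (*-cong-0ʳ (⟦ e ⟧ x * ⟦ b ⟧ x * ⟦ P ⟧ x) (x≡y⇒x-y≡0 (vQ≡uP (x + - 1ℚ)))))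

  regular-up : ∀ c → ⟦ e ⟧ c ≢ 0ℚ → ⟦ a ⟧ c ≢ 0ℚ → Regular P Q (c + - 1ℚ) → Regular P Q c
  regular-up c ec≢0 ac≢0 (u , v , vc≢0 , vQ≡uP) =
    e ⊗ b ⊗ σ u ⊕ C₀ ⊗ σ v , e ⊗ a ⊗ σ v , *-nonZero (*-nonZero ec≢0 ac≢0) vc≢0 , solved u v vQ≡uP

  -- Here the equation is solved for the other unknown, R(x-1) = (e a u - C₀ v) / (e b v), and `τ`
  -- moves this fraction from c to c - 1.
  regular-down : ∀ c → ⟦ e ⟧ c ≢ 0ℚ → ⟦ b ⟧ c ≢ 0ℚ → Regular P Q c → Regular P Q (c + - 1ℚ)
  regular-down c ec≢0 bc≢0 (u , v , vc≢0 , vQ≡uP) =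
    τ (e ⊗ a ⊗ u ⊖ C₀ ⊗ v) , τ (e ⊗ b ⊗ v) ,
    subst (λ y → ⟦ e ⊗ b ⊗ v ⟧ y ≢ 0ℚ) (sym (x-1+1 c)) (*-nonZero (*-nonZero ec≢0 bc≢0) vc≢0) ,
    λ x → subst (λ y → ⟦ e ⊗ b ⊗ v ⟧ (x + 1ℚ) * ⟦ Q ⟧ y ≡ ⟦ e ⊗ a ⊗ u ⊖ C₀ ⊗ v ⟧ (x + 1ℚ) * ⟦ P ⟧ y)
      (x+1-1 x) (poly-cancel-≡ P (e ⊗ b ⊗ v ⊗ σ Q) ((e ⊗ a ⊗ u ⊖ C₀ ⊗ v) ⊗ σ P) P≢0 multiple (x + 1ℚ))
    where
    lemma₁ : ∀ e a b c P p Q q u v → P * (e * b * v * q + - 1ℚ * ((e * a * u + - 1ℚ * (c * v)) * p)) ≡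
      - 1ℚ * v * (e * (a * (Q * p) + - 1ℚ * (b * (q * P))) - c * (P * p)) + e * a * p * (v * Q - u * P)
    lemma₁ = solve-∀ ring
    multiple : ∀ x → ⟦ P ⟧ x * ⟦ e ⊗ b ⊗ v ⊗ σ Q ⊖ (e ⊗ a ⊗ u ⊖ C₀ ⊗ v) ⊗ σ P ⟧ x ≡ 0ℚ
    multiple x = trans (lemma₁ (⟦ e ⟧ x) (⟦ a ⟧ x) (⟦ b ⟧ x) (⟦ C₀ ⟧ x) (⟦ P ⟧ x) (⟦ σ P ⟧ x) (⟦ Q ⟧ x) (⟦ σ Q ⟧ x) (⟦ u ⟧ x) (⟦ v ⟧ x))
      (cong₂ _+_ (*-cong-0ʳ (- 1ℚ * ⟦ v ⟧ x) (x≡y⇒x-y≡0 (equation x)))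
                 (*-cong-0ʳ (⟦ e ⟧ x * ⟦ a ⟧ x * ⟦ σ P ⟧ x) (x≡y⇒x-y≡0 (vQ≡uP x))))

  -- The descent applies the equation at n, ..., 1, where e and b do not vanish. The mirrored ascent
  -- from a negative point has to stop at -1, since the equation at 0 is the singular one.
  regular-at-0 : ∀ n → Regular P Q (ι n) → Regular P Q 0ℚ
  regular-at-0 zero    reg = reg
  regular-at-0 (suc n) reg = regular-at-0 n (subst (Regular P Q) (ι-pred n)
    (regular-down (ι (suc n)) (proj₁ e≢0 n) (proj₁ b≢0 n) reg))

  regular-at-−1 : ∀ n → Regular P Q (negative n) → Regular P Q (negative 0)
  regular-at-−1 zero    reg = reg
  regular-at-−1 (suc n) reg = regular-at-−1 n
    (regular-up (negative n) (proj₂ e≢0 n) (proj₂ a≢0 n) (subst (Regular P Q) (negative-suc n) reg))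

  -- If R were regular at -1 and at 0, then a R - b σR would be regular at 0, whereas C₀ / e is not.
  -- Concretely, F = 0 compares two fractions for R; at 0, where e vanishes, it leaves w C₀ σv = 0.
  not-regular-at-both : ⟦ e ⟧ 0ℚ ≡ 0ℚ → ⟦ C₀ ⟧ 0ℚ ≢ 0ℚ → Regular P Q (negative 0) → Regular P Q 0ℚ → ⊥
  not-regular-at-both e0≡0 C0≢0 (u , v , v−1≢0 , vQ≡uP) (z , w , w0≢0 , wQ≡zP) =
    *-nonZero w0≢0 (*-nonZero C0≢0 σv0≢0) (begin
      ⟦ w ⟧ 0ℚ * (⟦ C₀ ⟧ 0ℚ * ⟦ σ v ⟧ 0ℚ)
        ≡⟨ lemma₃ (⟦ e ⟧ 0ℚ) (⟦ a ⟧ 0ℚ) (⟦ b ⟧ 0ℚ) (⟦ C₀ ⟧ 0ℚ) (⟦ σ u ⟧ 0ℚ) (⟦ σ v ⟧ 0ℚ) (⟦ w ⟧ 0ℚ) (⟦ z ⟧ 0ℚ) ⟩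
      ⟦ e ⟧ 0ℚ * (⟦ a ⟧ 0ℚ * ⟦ σ v ⟧ 0ℚ * ⟦ z ⟧ 0ℚ - ⟦ w ⟧ 0ℚ * (⟦ b ⟧ 0ℚ * ⟦ σ u ⟧ 0ℚ)) + - 1ℚ * ⟦ F ⟧ 0ℚ
        ≡⟨ cong₂ (λ x y → x * _ + - 1ℚ * y) e0≡0 (poly-cancel P F P≢0 multiple 0ℚ) ⟩
      0ℚ * (⟦ a ⟧ 0ℚ * ⟦ σ v ⟧ 0ℚ * ⟦ z ⟧ 0ℚ - ⟦ w ⟧ 0ℚ * (⟦ b ⟧ 0ℚ * ⟦ σ u ⟧ 0ℚ)) + - 1ℚ * 0ℚ
        ≡⟨ lemma₂ (⟦ a ⟧ 0ℚ * ⟦ σ v ⟧ 0ℚ * ⟦ z ⟧ 0ℚ - ⟦ w ⟧ 0ℚ * (⟦ b ⟧ 0ℚ * ⟦ σ u ⟧ 0ℚ)) ⟩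
      0ℚ ∎)
    where
    open ≡-Reasoning
    F : Poly
    F = e ⊗ a ⊗ σ v ⊗ z ⊖ w ⊗ (e ⊗ b ⊗ σ u ⊕ C₀ ⊗ σ v)
    σv0≢0 : ⟦ σ v ⟧ 0ℚ ≢ 0ℚ
    σv0≢0 = v−1≢0
    lemma₁ : ∀ d f P Q w z → P * (d * z + - 1ℚ * (w * f)) ≡ w * (d * Q - f * P) - d * (w * Q - z * P)
    lemma₁ = solve-∀ ring
    lemma₂ : ∀ x → 0ℚ * x + - 1ℚ * 0ℚ ≡ 0ℚ
    lemma₂ = solve-∀ ring
    lemma₃ : ∀ e a b c u v w z → w * (c * v) ≡
      e * (a * v * z - w * (b * u)) + - 1ℚ * (e * a * v * z + - 1ℚ * (w * (e * b * u + c * v)))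
    lemma₃ = solve-∀ ring
    multiple : ∀ x → ⟦ P ⟧ x * ⟦ F ⟧ x ≡ 0ℚ
    multiple x = trans (lemma₁ (⟦ e ⊗ a ⊗ σ v ⟧ x) (⟦ e ⊗ b ⊗ σ u ⊕ C₀ ⊗ σ v ⟧ x) (⟦ P ⟧ x) (⟦ Q ⟧ x) (⟦ w ⟧ x) (⟦ z ⟧ x))
      (cong₂ _-_ (*-cong-0ʳ (⟦ w ⟧ x) (x≡y⇒x-y≡0 (solved u v vQ≡uP x)))
                 (*-cong-0ʳ (⟦ e ⊗ a ⊗ σ v ⟧ x) (x≡y⇒x-y≡0 (wQ≡zP x))))

  contradiction : ⟦ e ⟧ 0ℚ ≡ 0ℚ → ⟦ C₀ ⟧ 0ℚ ≢ 0ℚ → ⊥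
  -- R is regular wherever P does not vanish, which supplies a starting point on either side of 0.
  contradiction e0≡0 C0≢0 with negative-nonRoot P P≢0
  ... | n , P−n≢0 = not-regular-at-both e0≡0 C0≢0
    (regular-at-−1 n (regular P Q (negative n) P−n≢0))
    (regular-at-0 (proj₁ P≢0) (regular P Q (ι (proj₁ P≢0)) (proj₂ P≢0 (proj₁ P≢0) ℕₚ.≤-refl)))

powX : ℕ → Poly
powX zero    = con 1ℚ
powX (suc m) = X ⊗ powX m

powX-≢0 : ∀ {x} m → x ≢ 0ℚ → ⟦ powX m ⟧ x ≢ 0ℚ
powX-≢0 zero    x≢0 = ℚₚ.1≢0
powX-≢0 (suc m) x≢0 = *-nonZero x≢0 (powX-≢0 m x≢0)

powX-nonZeroOnIntegers : ∀ m → NonZeroOnIntegers (powX m)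
powX-nonZeroOnIntegers m = (λ n → powX-≢0 m (ι-suc≢0 n)) , (λ n → powX-≢0 m (negative≢0 n))

-- Σ_{j < J} x^{J-1-j} F j, which is x^J times Σ_{j < J} x^{-(j+1)} F j
hornerSum : ℕ → (ℕ → Poly) → Poly
hornerSum zero    F = con 0ℚ
hornerSum (suc J) F = F J ⊕ X ⊗ hornerSum J F

-- The coefficient of the highest pole order is the constant term of the numerator, so it is refuted
-- first. Once it is 0, the equation can be divided by X and J drops by one.
no-poles : ∀ J (c : ℕ → ℚ) P Q a b → EventuallyNonZero P → NonZeroOnIntegers a → NonZeroOnIntegers b →
  (∀ x → ⟦ powX J ⟧ x * (⟦ a ⟧ x * (⟦ Q ⟧ x * ⟦ σ P ⟧ x) + - 1ℚ * (⟦ b ⟧ x * (⟦ σ Q ⟧ x * ⟦ P ⟧ x)))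
         ≡ ⟦ hornerSum J (λ j → con (c j)) ⟧ x * (⟦ P ⟧ x * ⟦ σ P ⟧ x)) →
  ∀ j → j < J → c j ≡ 0ℚ
no-poles (suc J) c P Q a b P≢0 a≢0 b≢0 equation with c J ℚₚ.≟ 0ℚ
... | no cJ≢0 = ⊥-elim (Pole.contradiction P Q a b (powX (suc J)) (hornerSum (suc J) (λ j → con (c j)))
  P≢0 a≢0 b≢0 (powX-nonZeroOnIntegers (suc J)) equation (ℚₚ.*-zeroˡ (⟦ powX J ⟧ 0ℚ))
  (λ C0≡0 → cJ≢0 (trans (sym (lemma (c J) (⟦ hornerSum J (λ j → con (c j)) ⟧ 0ℚ))) C0≡0)))
  where
  lemma : ∀ c y → c + 0ℚ * y ≡ c
  lemma = solve-∀ ring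
... | yes cJ≡0 = λ j j<1+J → case (ℕₚ.m≤n⇒m<n∨m≡n (ℕₚ.≤-pred j<1+J))
  where
  A D H : Poly
  A = a ⊗ (Q ⊗ σ P) ⊖ b ⊗ (σ Q ⊗ P)
  D = P ⊗ σ P
  H = hornerSum J (λ j → con (c j))
  lemma : ∀ x p A h D c → x * (p * A + - 1ℚ * (h * D)) ≡ (x * p * A - (c + x * h) * D) + c * D
  lemma = solve-∀ ring
  multiple : ∀ x → x * ⟦ powX J ⊗ A ⊖ H ⊗ D ⟧ x ≡ 0ℚ
  multiple x = trans (lemma x (⟦ powX J ⟧ x) (⟦ A ⟧ x) (⟦ H ⟧ x) (⟦ D ⟧ x) (c J))
    (cong₂ _+_ (x≡y⇒x-y≡0 (equation x)) (*-cong-0ˡ (⟦ D ⟧ x) cJ≡0))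
  rest : ∀ j → j < J → c j ≡ 0ℚ
  rest = no-poles J c P Q a b P≢0 a≢0 b≢0
    (poly-cancel-≡ X (powX J ⊗ A) (H ⊗ D) X-eventuallyNonZero multiple)
  case : ∀ {j} → j < J ⊎ j ≡ J → c j ≡ 0ℚ
  case {j} (inj₁ j<J) = rest j j<J
  case (inj₂ refl)    = cJ≡0

-- Finite sums and inverse binomial coefficients

sumRange-empty : ∀ lo hi f → hi ≤ lo → sumRange lo hi f ≡ 0ℚ
sumRange-empty lo hi f hi≤lo rewrite ℕₚ.m≤n⇒m∸n≡0 hi≤lo = refl

sumRange-last : ∀ lo hi f → lo ≤ hi → sumRange lo (suc hi) f ≡ sumRange lo hi f + f (suc hi)
sumRange-last lo hi f lo≤hi rewrite ℕₚ.+-∸-assoc 1 lo≤hi =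
  cong (λ k → sumRange lo hi f + f (suc k)) (ℕₚ.m+[n∸m]≡n lo≤hi)

-- `sumRange` recurses on hi ∸ lo; this view restores an induction on hi that starts from an empty
-- range.
data RangeView (lo : ℕ) : ℕ → Set where
  empty : ∀ {hi} → hi ≤ lo → RangeView lo hi
  snoc  : ∀ {hi} → lo ≤ hi → RangeView lo hi → RangeView lo (suc hi)

rangeView : ∀ lo hi → RangeView lo hi
rangeView lo zero = empty z≤n
rangeView lo (suc hi) with lo ℕₚ.≤? hi
... | yes lo≤hi = snoc lo≤hi (rangeView lo hi)
... | no lo≰hi  = empty (ℕₚ.≰⇒> lo≰hi)

module _ (lo : ℕ) (f g : ℕ → ℚ) where

  sumRange-cong : ∀ hi → (∀ j → lo < j → j ≤ hi → f j ≡ g j) → sumRange lo hi f ≡ sumRange lo hi g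
  sumRange-cong hi = go (rangeView lo hi)
    where
    go : ∀ {hi} → RangeView lo hi → (∀ j → lo < j → j ≤ hi → f j ≡ g j) → sumRange lo hi f ≡ sumRange lo hi g
    go (empty {hi} hi≤lo) f≡g = trans (sumRange-empty lo hi f hi≤lo) (sym (sumRange-empty lo hi g hi≤lo))
    go (snoc {hi} lo≤hi view) f≡g = trans (sumRange-last lo hi f lo≤hi) (trans
      (cong₂ _+_ (go view (λ j lo<j j≤hi → f≡g j lo<j (ℕₚ.m≤n⇒m≤1+n j≤hi))) (f≡g (suc hi) (s≤s lo≤hi) ℕₚ.≤-refl))
      (sym (sumRange-last lo hi g lo≤hi)))

  sumRange-mono : ∀ hi → (∀ j → lo < j → j ≤ hi → f j ℚ.≤ g j) → sumRange lo hi f ℚ.≤ sumRange lo hi g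
  sumRange-mono hi = go (rangeView lo hi)
    where
    go : ∀ {hi} → RangeView lo hi → (∀ j → lo < j → j ≤ hi → f j ℚ.≤ g j) → sumRange lo hi f ℚ.≤ sumRange lo hi g
    go (empty {hi} hi≤lo) f≤g =
      ℚₚ.≤-reflexive (trans (sumRange-empty lo hi f hi≤lo) (sym (sumRange-empty lo hi g hi≤lo)))
    go (snoc {hi} lo≤hi view) f≤g = ℚₚ.≤-trans (ℚₚ.≤-reflexive (sumRange-last lo hi f lo≤hi)) (ℚₚ.≤-trans
      (ℚₚ.+-mono-≤ (go view (λ j lo<j j≤hi → f≤g j lo<j (ℕₚ.m≤n⇒m≤1+n j≤hi))) (f≤g (suc hi) (s≤s lo≤hi) ℕₚ.≤-refl))
      (ℚₚ.≤-reflexive (sym (sumRange-last lo hi g lo≤hi))))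

  sumRange-+ : ∀ hi → sumRange lo hi (λ j → f j + g j) ≡ sumRange lo hi f + sumRange lo hi g
  sumRange-+ hi = go (rangeView lo hi)
    where
    lemma : ∀ w x y z → w + x + (y + z) ≡ w + y + (x + z)
    lemma = solve-∀ ring
    go : ∀ {hi} → RangeView lo hi → sumRange lo hi (λ j → f j + g j) ≡ sumRange lo hi f + sumRange lo hi g
    go (empty {hi} hi≤lo) = trans (sumRange-empty lo hi _ hi≤lo)
      (sym (cong₂ _+_ (sumRange-empty lo hi f hi≤lo) (sumRange-empty lo hi g hi≤lo)))
    go (snoc {hi} lo≤hi view) = trans (sumRange-last lo hi _ lo≤hi) (trans
      (cong (_+ (f (suc hi) + g (suc hi))) (go view)) (trans
      (lemma (sumRange lo hi f) (sumRange lo hi g) (f (suc hi)) (g (suc hi)))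
      (sym (cong₂ _+_ (sumRange-last lo hi f lo≤hi) (sumRange-last lo hi g lo≤hi)))))

sumRange-* : ∀ lo c f hi → sumRange lo hi (λ j → c * f j) ≡ c * sumRange lo hi f
sumRange-* lo c f hi = go (rangeView lo hi)
  where
  go : ∀ {hi} → RangeView lo hi → sumRange lo hi (λ j → c * f j) ≡ c * sumRange lo hi f
  go (empty {hi} hi≤lo) = trans (sumRange-empty lo hi _ hi≤lo) (sym (*-cong-0ʳ c (sumRange-empty lo hi f hi≤lo)))
  go (snoc {hi} lo≤hi view) = trans (sumRange-last lo hi _ lo≤hi) (trans (cong (_+ c * f (suc hi)) (go view))
    (trans (sym (ℚₚ.*-distribˡ-+ c _ _)) (cong (c *_) (sym (sumRange-last lo hi f lo≤hi)))))

sumRange-first : ∀ lo hi f → lo < hi → sumRange lo hi f ≡ f (suc lo) + sumRange (suc lo) hi f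
sumRange-first lo hi f lo<hi with rangeView (suc lo) hi
... | empty hi≤1+lo with ℕₚ.≤-antisym hi≤1+lo lo<hi
...   | refl = trans (sumRange-last lo lo f ℕₚ.≤-refl) (trans (ℚₚ.+-comm (sumRange lo lo f) (f (suc lo)))
  (cong (f (suc lo) +_) (trans (sumRange-empty lo lo f ℕₚ.≤-refl) (sym (sumRange-empty (suc lo) (suc lo) f ℕₚ.≤-refl)))))
sumRange-first lo (suc hi) f lo<hi | snoc lo<hi′ _ = begin
  sumRange lo (suc hi) f                                  ≡⟨ sumRange-last lo hi f (ℕₚ.<⇒≤ lo<hi′) ⟩
  sumRange lo hi f + f (suc hi)                           ≡⟨ cong (_+ f (suc hi)) (sumRange-first lo hi f lo<hi′) ⟩
  f (suc lo) + sumRange (suc lo) hi f + f (suc hi)        ≡⟨ ℚₚ.+-assoc (f (suc lo)) _ _ ⟩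
  f (suc lo) + (sumRange (suc lo) hi f + f (suc hi))      ≡⟨ cong (f (suc lo) +_) (sumRange-last (suc lo) hi f lo<hi′) ⟨
  f (suc lo) + sumRange (suc lo) (suc hi) f               ∎
  where open ≡-Reasoning

sumRange-zero : ∀ lo hi → sumRange lo hi (λ _ → 0ℚ) ≡ 0ℚ
sumRange-zero lo hi = trans (sumRange-* lo 0ℚ (λ _ → 0ℚ) hi) (ℚₚ.*-zeroˡ (sumRange lo hi (λ _ → 0ℚ)))

sumRange-nonNeg : ∀ lo hi f → (∀ j → lo < j → j ≤ hi → 0ℚ ℚ.≤ f j) → 0ℚ ℚ.≤ sumRange lo hi f
sumRange-nonNeg lo hi f f≥0 = subst (ℚ._≤ sumRange lo hi f) (sumRange-zero lo hi) (sumRange-mono lo (λ _ → 0ℚ) f hi f≥0)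

nC0≡1 : ∀ n → n C 0 ≡ 1
nC0≡1 n = trans (nCk≡nC[n∸k] {0} {n} z≤n) (nCn≡1 n)

C-absorption : ∀ n k → suc k ℕ.* (suc n C suc k) ≡ suc n ℕ.* (n C k)
C-absorption zero    zero    = refl
C-absorption zero    (suc k) = ℕₚ.*-zeroʳ k
C-absorption (suc n) k = begin
  suc k ℕ.* (suc (suc n) C suc k)                                 ≡⟨ cong (suc k ℕ.*_) (sym (nCk+nC[k+1]≡[n+1]C[k+1] (suc n) k)) ⟩
  suc k ℕ.* ((suc n C k) ℕ.+ (suc n C suc k))                     ≡⟨ ℕₚ.*-distribˡ-+ (suc k) (suc n C k) _ ⟩
  suc k ℕ.* (suc n C k) ℕ.+ suc k ℕ.* (suc n C suc k)             ≡⟨ cong (suc k ℕ.* (suc n C k) ℕ.+_) (C-absorption n k) ⟩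
  (suc n C k) ℕ.+ k ℕ.* (suc n C k) ℕ.+ suc n ℕ.* (n C k)         ≡⟨ ℕₚ.+-assoc (suc n C k) _ _ ⟩
  (suc n C k) ℕ.+ (k ℕ.* (suc n C k) ℕ.+ suc n ℕ.* (n C k))       ≡⟨ cong ((suc n C k) ℕ.+_) (previous k) ⟩
  (suc n C k) ℕ.+ suc n ℕ.* (suc n C k)                           ∎
  where
  open ≡-Reasoning
  previous : ∀ k → k ℕ.* (suc n C k) ℕ.+ suc n ℕ.* (n C k) ≡ suc n ℕ.* (suc n C k)
  previous zero    = cong (suc n ℕ.*_) (trans (nC0≡1 n) (sym (nC0≡1 (suc n))))
  previous (suc k) = begin
    suc k ℕ.* (suc n C suc k) ℕ.+ suc n ℕ.* (n C suc k)  ≡⟨ cong (ℕ._+ suc n ℕ.* (n C suc k)) (C-absorption n k) ⟩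
    suc n ℕ.* (n C k) ℕ.+ suc n ℕ.* (n C suc k)          ≡⟨ ℕₚ.*-distribˡ-+ (suc n) (n C k) _ ⟨
    suc n ℕ.* ((n C k) ℕ.+ (n C suc k))                  ≡⟨ cong (suc n ℕ.*_) (nCk+nC[k+1]≡[n+1]C[k+1] n k) ⟩
    suc n ℕ.* (suc n C suc k)                            ∎

inv-ratio : ∀ a b x y → suc a ℕ.* y ≡ suc b ℕ.* x → inv x ≡ ι (suc b) * inv (suc a) * inv y
inv-ratio a b x y ay≡bx = begin
  inv x                                  ≡⟨ ℚₚ.*-identityˡ (inv x) ⟨
  1ℚ * inv x                             ≡⟨ cong (_* inv x) (inv-ι b) ⟨
  inv (suc b) * ι (suc b) * inv x        ≡⟨ lemma (inv (suc b)) (ι (suc b)) (inv x) ⟩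
  ι (suc b) * (inv (suc b) * inv x)      ≡⟨ cong (ι (suc b) *_) (inv-* (suc b) x) ⟨
  ι (suc b) * inv (suc b ℕ.* x)          ≡⟨ cong (λ k → ι (suc b) * inv k) ay≡bx ⟨
  ι (suc b) * inv (suc a ℕ.* y)          ≡⟨ cong (ι (suc b) *_) (inv-* (suc a) y) ⟩
  ι (suc b) * (inv (suc a) * inv y)      ≡⟨ ℚₚ.*-assoc (ι (suc b)) (inv (suc a)) (inv y) ⟨
  ι (suc b) * inv (suc a) * inv y        ∎
  where
  open ≡-Reasoning
  lemma : ∀ x y z → x * y * z ≡ y * (x * z)
  lemma = solve-∀ ring

ι-*-inv : ∀ m k → ι (m ℕ.+ suc k) * inv (suc k) ≡ 1ℚ + ι m * inv (suc k)
ι-*-inv m k = trans (cong (_* inv (suc k)) (ι-+ m (suc k)))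
  (trans (lemma (ι m) (ι (suc k)) (inv (suc k))) (cong (_+ ι m * inv (suc k)) (inv-ι k)))
  where
  lemma : ∀ m k i → (m + k) * i ≡ i * k + m * i
  lemma = solve-∀ ring

invC : ℕ → ℕ → ℚ
invC m q = inv ((m ℕ.+ q) C q)

-- The quotient of the two binomials is (m+q+1)/(q+1). Its part m/(q+1) lowers an exponent of m by
-- one, which is the origin of the fin terms.
invC-sucʳ : ∀ m q → invC m q ≡ (1ℚ + ι m * inv (suc q)) * invC m (suc q)
invC-sucʳ m q = begin
  invC m q                                                ≡⟨ inv-ratio q (m ℕ.+ q) _ ((m ℕ.+ suc q) C suc q) absorb ⟩
  ι (suc (m ℕ.+ q)) * inv (suc q) * invC m (suc q)        ≡⟨ cong (λ k → ι k * inv (suc q) * invC m (suc q)) (ℕₚ.+-suc m q) ⟨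
  ι (m ℕ.+ suc q) * inv (suc q) * invC m (suc q)          ≡⟨ cong (_* invC m (suc q)) (ι-*-inv m q) ⟩
  (1ℚ + ι m * inv (suc q)) * invC m (suc q)               ∎
  where
  open ≡-Reasoning
  absorb : suc q ℕ.* ((m ℕ.+ suc q) C suc q) ≡ suc (m ℕ.+ q) ℕ.* ((m ℕ.+ q) C q)
  absorb = trans (cong (λ k → suc q ℕ.* (k C suc q)) (ℕₚ.+-suc m q)) (C-absorption (m ℕ.+ q) q)

C-absorptionˡ : ∀ m q → suc m ℕ.* ((suc m ℕ.+ q) C q) ≡ suc (m ℕ.+ q) ℕ.* ((m ℕ.+ q) C q)
C-absorptionˡ m zero = cong₂ ℕ._*_ (cong suc (sym (ℕₚ.+-identityʳ m)))
  (trans (nC0≡1 (suc m ℕ.+ 0)) (sym (nC0≡1 (m ℕ.+ 0))))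
C-absorptionˡ m q@(suc q′) = ℕₚ.+-cancelʳ-≡ (q ℕ.* y) _ _ (begin
  suc m ℕ.* y ℕ.+ q ℕ.* y                          ≡⟨ ℕₚ.*-distribʳ-+ y (suc m) q ⟨
  suc (m ℕ.+ q) ℕ.* y                              ≡⟨ cong (suc (m ℕ.+ q) ℕ.*_) (sym (nCk+nC[k+1]≡[n+1]C[k+1] (m ℕ.+ q) q′)) ⟩
  suc (m ℕ.+ q) ℕ.* (((m ℕ.+ q) C q′) ℕ.+ x)       ≡⟨ ℕₚ.*-distribˡ-+ (suc (m ℕ.+ q)) ((m ℕ.+ q) C q′) x ⟩
  suc (m ℕ.+ q) ℕ.* ((m ℕ.+ q) C q′) ℕ.+ suc (m ℕ.+ q) ℕ.* x ≡⟨ cong (ℕ._+ suc (m ℕ.+ q) ℕ.* x) (sym (C-absorption (m ℕ.+ q) q′)) ⟩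
  q ℕ.* y ℕ.+ suc (m ℕ.+ q) ℕ.* x                  ≡⟨ ℕₚ.+-comm (q ℕ.* y) _ ⟩
  suc (m ℕ.+ q) ℕ.* x ℕ.+ q ℕ.* y                  ∎)
  where
  open ≡-Reasoning
  x y : ℕ
  x = (m ℕ.+ q) C q
  y = (suc m ℕ.+ q) C q

-- The quotient taken in the other argument. Read as a difference in m, it is the source of the
-- telescoping sums.
invC-sucˡ : ∀ m q → invC m q ≡ (1ℚ + ι q * inv (suc m)) * invC (suc m) q
invC-sucˡ m q = begin
  invC m q                                                ≡⟨ inv-ratio m (m ℕ.+ q) _ ((suc m ℕ.+ q) C q) (C-absorptionˡ m q) ⟩
  ι (suc (m ℕ.+ q)) * inv (suc m) * invC (suc m) q        ≡⟨ cong (λ k → ι k * inv (suc m) * invC (suc m) q) (ℕₚ.+-comm (suc m) q) ⟩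
  ι (q ℕ.+ suc m) * inv (suc m) * invC (suc m) q          ≡⟨ cong (_* invC (suc m) q) (ι-*-inv q m) ⟩
  (1ℚ + ι q * inv (suc m)) * invC (suc m) q               ∎
  where open ≡-Reasoning

invC-nonNeg : ∀ m q → 0ℚ ℚ.≤ invC m q
invC-nonNeg m q = inv-nonNeg ((m ℕ.+ q) C q)

invC-≤1 : ∀ m q → invC m q ℚ.≤ 1ℚ
invC-≤1 m q = inv-≤1 ((m ℕ.+ q) C q)

invC-≢0 : ∀ m q → invC m q ≢ 0ℚ
invC-≢0 m zero    eq = ℚₚ.1≢0 (trans (sym (cong inv (nC0≡1 (m ℕ.+ 0)))) eq)
invC-≢0 m (suc q) eq = invC-≢0 m q (trans (invC-sucʳ m q) (*-cong-0ʳ (1ℚ + ι m * inv (suc q)) eq))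

2ℚ 4ℚ : ℚ
2ℚ = 1ℚ + 1ℚ
4ℚ = 2ℚ + 2ℚ

invC-half : ∀ n → invC n (suc n) ≡ 2ℚ * invC (suc n) (suc n)
invC-half n = trans (invC-sucˡ n (suc n)) (cong (λ x → (1ℚ + x) * invC (suc n) (suc n))
  (trans (ℚₚ.*-comm (ι (suc n)) (inv (suc n))) (inv-ι n)))

-- The route goes through C(2n+1,n+1), which is half of C(2n+2,n+1). The factor 4x - 2 at x = n + 1
-- reappears as `κ []`.
central : ∀ n → ι (suc n) * invC n n ≡ (4ℚ * ι (suc n) + - 2ℚ) * invC (suc n) (suc n)
central n = begin
  ι (suc n) * invC n n
    ≡⟨ cong (ι (suc n) *_) (trans (invC-sucʳ n n) (cong ((1ℚ + ι n * inv (suc n)) *_) (invC-half n))) ⟩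
  ι (suc n) * ((1ℚ + ι n * inv (suc n)) * (2ℚ * invC (suc n) (suc n)))
    ≡⟨ lemma₁ (ι n) (inv (suc n)) (invC (suc n) (suc n)) ⟩
  (ι (suc n) + ι n * (inv (suc n) * ι (suc n))) * (2ℚ * invC (suc n) (suc n))
    ≡⟨ cong (λ x → (ι (suc n) + ι n * x) * (2ℚ * invC (suc n) (suc n))) (inv-ι n) ⟩
  (ι (suc n) + ι n * 1ℚ) * (2ℚ * invC (suc n) (suc n))
    ≡⟨ lemma₂ (ι n) (invC (suc n) (suc n)) ⟩
  (4ℚ * ι (suc n) + - 2ℚ) * invC (suc n) (suc n)
    ∎
  where
  open ≡-Reasoning
  lemma₁ : ∀ x i w → (1ℚ + x) * ((1ℚ + x * i) * (2ℚ * w)) ≡ (1ℚ + x + x * (i * (1ℚ + x))) * (2ℚ * w)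
  lemma₁ = solve-∀ ring
  lemma₂ : ∀ x w → (1ℚ + x + x * 1ℚ) * (2ℚ * w) ≡ (4ℚ * (1ℚ + x) + - 2ℚ) * w
  lemma₂ = solve-∀ ring

-- Nested sums

-- The letter j stands for the exponent j + 1.
Word : Set
Word = List ℕ

nested : Word → ℕ → ℕ → ℚ
nested []      n N = invC n n
nested (j ∷ s) n N = sumRange n N (λ m → inv (m ^ suc j) * nested s m N)

nested-step : ∀ j s n N → n < N →
  nested (j ∷ s) n N ≡ nested (j ∷ s) (suc n) N + inv (suc n ^ suc j) * nested s (suc n) N
nested-step j s n N n<N = trans (sumRange-first n N (λ m → inv (m ^ suc j) * nested s m N) n<N)
  (ℚₚ.+-comm (inv (suc n ^ suc j) * nested s (suc n) N) _)

-- The powers of 1/2 dominate 1/C(2n,n), and the sum of all later powers is at most the current one,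
-- so a single bound serves nested sums of every depth.
halfPow : ℕ → ℚ
halfPow zero    = 1ℚ
halfPow (suc n) = ½ * halfPow n

½+½ : ∀ x → ½ * x + ½ * x ≡ x
½+½ x = trans (sym (ℚₚ.*-distribʳ-+ x ½ ½)) (ℚₚ.*-identityˡ x)

½-nonNeg : 0ℚ ℚ.≤ ½
½-nonNeg = ℚₚ.nonNegative⁻¹ ½

halfPow-nonNeg : ∀ n → 0ℚ ℚ.≤ halfPow n
halfPow-nonNeg zero    = ℚₚ.nonNegative⁻¹ 1ℚ
halfPow-nonNeg (suc n) = *-nonNeg ½-nonNeg (halfPow-nonNeg n)

halfPow-≤1 : ∀ n → halfPow n ℚ.≤ 1ℚ
halfPow-≤1 zero    = ℚₚ.≤-refl
halfPow-≤1 (suc n) = begin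
  ½ * halfPow n                      ≡⟨ ℚₚ.+-identityˡ (½ * halfPow n) ⟨
  0ℚ + ½ * halfPow n                 ≤⟨ ℚₚ.+-monoˡ-≤ (½ * halfPow n) (*-nonNeg ½-nonNeg (halfPow-nonNeg n)) ⟩
  ½ * halfPow n + ½ * halfPow n      ≡⟨ ½+½ (halfPow n) ⟩
  halfPow n                          ≤⟨ halfPow-≤1 n ⟩
  1ℚ                                 ∎
  where open ℚₚ.≤-Reasoning

ι*halfPow≤1 : ∀ n → ι n * halfPow n ℚ.≤ 1ℚ
ι*halfPow≤1 zero    = ℚₚ.≤-trans (ℚₚ.≤-reflexive (ℚₚ.*-zeroˡ 1ℚ)) (ℚₚ.nonNegative⁻¹ 1ℚ)
ι*halfPow≤1 (suc n) = begin
  (1ℚ + ι n) * (½ * halfPow n)             ≡⟨ lemma (ι n) ½ (halfPow n) ⟩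
  ½ * halfPow n + ½ * (ι n * halfPow n)    ≤⟨ ℚₚ.+-mono-≤ (*-monoʳ-≤ ½-nonNeg (halfPow-≤1 n)) (*-monoʳ-≤ ½-nonNeg (ι*halfPow≤1 n)) ⟩
  ½ * 1ℚ + ½ * 1ℚ                          ≡⟨ ½+½ 1ℚ ⟩
  1ℚ                                       ∎
  where
  open ℚₚ.≤-Reasoning
  lemma : ∀ x h y → (1ℚ + x) * (h * y) ≡ h * y + h * (x * y)
  lemma = solve-∀ ring

halfPow-≤inv : ∀ n → halfPow (suc n) ℚ.≤ inv (suc n)
halfPow-≤inv n = begin
  halfPow (suc n)                                 ≡⟨ ℚₚ.*-identityˡ (halfPow (suc n)) ⟨
  1ℚ * halfPow (suc n)                            ≡⟨ cong (_* halfPow (suc n)) (inv-ι n) ⟨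
  inv (suc n) * ι (suc n) * halfPow (suc n)       ≡⟨ ℚₚ.*-assoc (inv (suc n)) (ι (suc n)) (halfPow (suc n)) ⟩
  inv (suc n) * (ι (suc n) * halfPow (suc n))     ≤⟨ *-monoʳ-≤ (inv-nonNeg (suc n)) (ι*halfPow≤1 (suc n)) ⟩
  inv (suc n) * 1ℚ                                ≡⟨ ℚₚ.*-identityʳ (inv (suc n)) ⟩
  inv (suc n)                                     ∎
  where open ℚₚ.≤-Reasoning

sumRange-halfPow : ∀ n N → sumRange n N halfPow ℚ.≤ halfPow n
sumRange-halfPow n N = go (rangeView n N)
  where
  exact : ∀ {N} → RangeView n N → n ≤ N → sumRange n N halfPow + halfPow N ≡ halfPow n
  exact (empty {N} N≤n) n≤N = trans (cong₂ (λ x k → x + halfPow k) (sumRange-empty n N halfPow N≤n) (ℕₚ.≤-antisym N≤n n≤N)) (ℚₚ.+-identityˡ (halfPow n))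
  exact (snoc {N} n≤N view) _ = begin
    sumRange n (suc N) halfPow + ½ * halfPow N                      ≡⟨ cong (_+ ½ * halfPow N) (sumRange-last n N halfPow n≤N) ⟩
    sumRange n N halfPow + ½ * halfPow N + ½ * halfPow N            ≡⟨ ℚₚ.+-assoc (sumRange n N halfPow) (½ * halfPow N) (½ * halfPow N) ⟩
    sumRange n N halfPow + (½ * halfPow N + ½ * halfPow N)          ≡⟨ cong (sumRange n N halfPow +_) (½+½ (halfPow N)) ⟩
    sumRange n N halfPow + halfPow N                                ≡⟨ exact view n≤N ⟩
    halfPow n                                                       ∎
    where open ≡-Reasoning
  open ℚₚ.≤-Reasoning
  go : ∀ {N} → RangeView n N → sumRange n N halfPow ℚ.≤ halfPow n
  go (empty {N} N≤n) = ℚₚ.≤-trans (ℚₚ.≤-reflexive (sumRange-empty n N halfPow N≤n)) (halfPow-nonNeg n)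
  go {N = N} view@(snoc {N′} n≤N′ _) = begin
    sumRange n N halfPow                   ≡⟨ ℚₚ.+-identityʳ (sumRange n N halfPow) ⟨
    sumRange n N halfPow + 0ℚ              ≤⟨ ℚₚ.+-monoʳ-≤ (sumRange n N halfPow) (halfPow-nonNeg N) ⟩
    sumRange n N halfPow + halfPow N       ≡⟨ exact view (ℕₚ.m≤n⇒m≤1+n n≤N′) ⟩
    halfPow n                              ∎

invC-≤halfPow : ∀ n → invC n n ℚ.≤ halfPow n
invC-≤halfPow zero    = ℚₚ.≤-refl
invC-≤halfPow (suc n) = begin
  w′                    ≡⟨ ½+½ w′ ⟨
  ½ * w′ + ½ * w′       ≡⟨ ℚₚ.*-distribˡ-+ ½ w′ w′ ⟨
  ½ * (w′ + w′)         ≤⟨ *-monoʳ-≤ ½-nonNeg (ℚₚ.≤-trans 2w′≤w (invC-≤halfPow n)) ⟩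
  ½ * halfPow n         ∎
  where
  open ℚₚ.≤-Reasoning
  w w′ : ℚ
  w  = invC n n
  w′ = invC (suc n) (suc n)
  lemma₁ : ∀ x w′ → (1ℚ + x) * (w′ + w′) + (x + x) * w′ ≡ (4ℚ * (1ℚ + x) + - 2ℚ) * w′
  lemma₁ = solve-∀ ring
  2w′≤w : w′ + w′ ℚ.≤ w
  2w′≤w = ℚₚ.*-cancelˡ-≤-pos (ι (suc n)) (begin
    ι (suc n) * (w′ + w′)                          ≡⟨ ℚₚ.+-identityʳ (ι (suc n) * (w′ + w′)) ⟨
    ι (suc n) * (w′ + w′) + 0ℚ                     ≤⟨ ℚₚ.+-monoʳ-≤ (ι (suc n) * (w′ + w′)) (*-nonNeg (+-nonNeg (ι-nonNeg n) (ι-nonNeg n)) (invC-nonNeg (suc n) (suc n))) ⟩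
    ι (suc n) * (w′ + w′) + (ι n + ι n) * w′       ≡⟨ lemma₁ (ι n) w′ ⟩
    (4ℚ * ι (suc n) + - 2ℚ) * w′                   ≡⟨ central n ⟨
    ι (suc n) * w                                  ∎)
    where instance _ = ℚ.positive (ι-pos n)

nested-nonNeg : ∀ s n N → 0ℚ ℚ.≤ nested s n N
nested-nonNeg []      n N = invC-nonNeg n n
nested-nonNeg (j ∷ s) n N = sumRange-nonNeg n N _ (λ m _ _ → *-nonNeg (inv-nonNeg (m ^ suc j)) (nested-nonNeg s m N))

nested-≤halfPow : ∀ s n N → nested s n N ℚ.≤ halfPow n
nested-≤halfPow []      n N = invC-≤halfPow n
nested-≤halfPow (j ∷ s) n N = ℚₚ.≤-trans (sumRange-mono n _ halfPow N bound) (sumRange-halfPow n N)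
  where
  open ℚₚ.≤-Reasoning
  bound : ∀ m → n < m → m ≤ N → inv (m ^ suc j) * nested s m N ℚ.≤ halfPow m
  bound m _ _ = begin
    inv (m ^ suc j) * nested s m N    ≤⟨ *-monoˡ-≤ (nested-nonNeg s m N) (inv-≤1 (m ^ suc j)) ⟩
    1ℚ * nested s m N                 ≡⟨ ℚₚ.*-identityˡ (nested s m N) ⟩
    nested s m N                      ≤⟨ nested-≤halfPow s m N ⟩
    halfPow m                         ∎

nested-small : ∀ s → UniformlySmall (nested s)
nested-small s = small-inv-bound (λ n N → nested-nonNeg s (suc n) N)
  (λ n N → ℚₚ.≤-trans (nested-≤halfPow s (suc n) N) (halfPow-≤inv n))

-- Sums over letters and over words of bounded length

∑ : ℕ → (ℕ → ℚ) → ℚ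
∑ zero    f = 0ℚ
∑ (suc J) f = f J + ∑ J f

∑-cong : ∀ J {f g} → (∀ j → j < J → f j ≡ g j) → ∑ J f ≡ ∑ J g
∑-cong zero    f≡g = refl
∑-cong (suc J) f≡g = cong₂ _+_ (f≡g J ℕₚ.≤-refl) (∑-cong J (λ j j<J → f≡g j (ℕₚ.m≤n⇒m≤1+n j<J)))

∑-+ : ∀ J f g → ∑ J (λ j → f j + g j) ≡ ∑ J f + ∑ J g
∑-+ zero    f g = refl
∑-+ (suc J) f g = trans (cong (f J + g J +_) (∑-+ J f g)) (lemma (f J) (g J) (∑ J f) (∑ J g))
  where
  lemma : ∀ w x y z → w + x + (y + z) ≡ w + y + (x + z)
  lemma = solve-∀ ring

∑-* : ∀ J c f → ∑ J (λ j → c * f j) ≡ c * ∑ J f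
∑-* zero    c f = sym (ℚₚ.*-zeroʳ c)
∑-* (suc J) c f = trans (cong (c * f J +_) (∑-* J c f)) (sym (ℚₚ.*-distribˡ-+ c (f J) (∑ J f)))

∑-zero : ∀ J {f} → (∀ j → j < J → f j ≡ 0ℚ) → ∑ J f ≡ 0ℚ
∑-zero zero    f≡0 = refl
∑-zero (suc J) f≡0 = cong₂ _+_ (f≡0 J ℕₚ.≤-refl) (∑-zero J (λ j j<J → f≡0 j (ℕₚ.m≤n⇒m≤1+n j<J)))

∑-single : ∀ J {f} i → i < J → (∀ j → j ≢ i → f j ≡ 0ℚ) → ∑ J f ≡ f i
∑-single (suc J) {f} i i<1+J f≡0 with ℕₚ.m≤n⇒m<n∨m≡n (ℕₚ.≤-pred i<1+J)
... | inj₂ refl = trans (cong (f J +_) (∑-zero J (λ j j<J → f≡0 j (ℕₚ.<⇒≢ j<J)))) (ℚₚ.+-identityʳ (f J))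
... | inj₁ i<J  = trans (cong₂ _+_ (f≡0 J (λ J≡i → ℕₚ.<⇒≢ i<J (sym J≡i))) (∑-single J i i<J f≡0)) (ℚₚ.+-identityˡ (f i))

-- Σ F s over the words s of length at most r in the letters 0, …, J-1
∑ʷ : ℕ → ℕ → (Word → ℚ) → ℚ
∑ʷ J zero    F = F []
∑ʷ J (suc r) F = F [] + ∑ J (λ j → ∑ʷ J r (λ s → F (j ∷ s)))

Valid : ℕ → Word → Set
Valid J = All (_< J)

∑ʷ-cong : ∀ J r {F G} → (∀ s → Valid J s → length s ≤ r → F s ≡ G s) → ∑ʷ J r F ≡ ∑ʷ J r G
∑ʷ-cong J zero    F≡G = F≡G [] [] z≤n
∑ʷ-cong J (suc r) F≡G = cong₂ _+_ (F≡G [] [] z≤n)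
  (∑-cong J (λ j j<J → ∑ʷ-cong J r (λ s valid len → F≡G (j ∷ s) (j<J ∷ valid) (s≤s len))))

∑ʷ-+ : ∀ J r F G → ∑ʷ J r (λ s → F s + G s) ≡ ∑ʷ J r F + ∑ʷ J r G
∑ʷ-+ J zero    F G = refl
∑ʷ-+ J (suc r) F G = trans (cong (F [] + G [] +_) (trans
  (∑-cong J (λ j _ → ∑ʷ-+ J r (λ s → F (j ∷ s)) (λ s → G (j ∷ s))))
  (∑-+ J (λ j → ∑ʷ J r (λ s → F (j ∷ s))) (λ j → ∑ʷ J r (λ s → G (j ∷ s))))))
  (lemma (F []) (G []) _ _)
  where
  lemma : ∀ w x y z → w + x + (y + z) ≡ w + y + (x + z)
  lemma = solve-∀ ring

∑ʷ-* : ∀ J r c F → ∑ʷ J r (λ s → c * F s) ≡ c * ∑ʷ J r F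
∑ʷ-* J zero    c F = refl
∑ʷ-* J (suc r) c F = trans (cong (c * F [] +_) (trans
  (∑-cong J (λ j _ → ∑ʷ-* J r c (λ s → F (j ∷ s)))) (∑-* J c (λ j → ∑ʷ J r (λ s → F (j ∷ s))))))
  (sym (ℚₚ.*-distribˡ-+ c (F []) _))

∑ʷ-zero : ∀ J r {F} → (∀ s → Valid J s → length s ≤ r → F s ≡ 0ℚ) → ∑ʷ J r F ≡ 0ℚ
∑ʷ-zero J r {F} F≡0 = trans (∑ʷ-cong J r (λ s valid len → trans (F≡0 s valid len) (sym (ℚₚ.*-zeroˡ (F s)))))
  (trans (∑ʷ-* J r 0ℚ F) (ℚₚ.*-zeroˡ (∑ʷ J r F)))

∑ʷ-∑ : ∀ J r K (F : ℕ → Word → ℚ) → ∑ʷ J r (λ s → ∑ K (λ k → F k s)) ≡ ∑ K (λ k → ∑ʷ J r (F k))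
∑ʷ-∑ J r zero    F = ∑ʷ-zero J r (λ _ _ _ → refl)
∑ʷ-∑ J r (suc K) F = trans (∑ʷ-+ J r (F K) (λ s → ∑ K (λ k → F k s))) (cong (∑ʷ J r (F K) +_) (∑ʷ-∑ J r K F))

∑ʷ-shrink : ∀ J r {F} → (∀ s → Valid J s → length s ≡ suc r → F s ≡ 0ℚ) → ∑ʷ J (suc r) F ≡ ∑ʷ J r F
∑ʷ-shrink J zero    {F} F≡0 = trans (cong (F [] +_) (∑-zero J (λ j j<J → F≡0 (j ∷ []) (j<J ∷ []) refl))) (ℚₚ.+-identityʳ (F []))
∑ʷ-shrink J (suc r) {F} F≡0 = cong (F [] +_)
  (∑-cong J (λ j j<J → ∑ʷ-shrink J r (λ s valid len → F≡0 (j ∷ s) (j<J ∷ valid) (cong suc len))))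

∑ʷ-small : ∀ J r (c : Word → ℚ) (f : Word → ℕ → ℕ → ℚ) → (∀ s → UniformlySmall (f s)) → UniformlySmall (λ n N → ∑ʷ J r (λ s → c s * f s n N))
∑ʷ-small J zero    c f small = small-* (c []) (small [])
∑ʷ-small J (suc r) c f small = small-+ (small-* (c []) (small []))
  (∑-small J (λ j → ∑ʷ-small J r (λ s → c (j ∷ s)) (λ s → f (j ∷ s)) (λ s → small (j ∷ s))))
  where
  ∑-small : ∀ K {g : ℕ → ℕ → ℕ → ℚ} → (∀ k → UniformlySmall (g k)) → UniformlySmall (λ n N → ∑ K (λ k → g k n N))
  ∑-small zero    g-small = small-0
  ∑-small (suc K) g-small = small-+ (g-small K) (∑-small K g-small)

-- Linear independence of the nested sums over the polynomials

powX-inv : ∀ J m → ⟦ powX J ⟧ (ι (suc m)) * inv (suc m ^ J) ≡ 1ℚ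
powX-inv zero    m = refl
powX-inv (suc J) m = begin
  x * ⟦ powX J ⟧ x * inv (suc m ℕ.* suc m ^ J)              ≡⟨ cong (x * ⟦ powX J ⟧ x *_) (inv-* (suc m) (suc m ^ J)) ⟩
  x * ⟦ powX J ⟧ x * (inv (suc m) * inv (suc m ^ J))        ≡⟨ lemma x (⟦ powX J ⟧ x) (inv (suc m)) (inv (suc m ^ J)) ⟩
  (inv (suc m) * x) * (⟦ powX J ⟧ x * inv (suc m ^ J))      ≡⟨ cong₂ _*_ (inv-ι m) (powX-inv J m) ⟩
  1ℚ                                                        ∎
  where
  open ≡-Reasoning
  x : ℚ
  x = ι (suc m)
  lemma : ∀ a b c d → a * b * (c * d) ≡ (c * a) * (b * d)
  lemma = solve-∀ ring

hornerSum-∑ : ∀ J F m → ⟦ hornerSum J F ⟧ (ι (suc m)) ≡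
  ⟦ powX J ⟧ (ι (suc m)) * ∑ J (λ j → inv (suc m ^ suc j) * ⟦ F j ⟧ (ι (suc m)))
hornerSum-∑ zero    F m = refl
hornerSum-∑ (suc J) F m = begin
  f + x * ⟦ hornerSum J F ⟧ x                    ≡⟨ cong₂ (λ y z → y + x * z) (sym (ℚₚ.*-identityˡ f)) (hornerSum-∑ J F m) ⟩
  1ℚ * f + x * (⟦ powX J ⟧ x * S)                ≡⟨ cong (λ y → y * f + x * (⟦ powX J ⟧ x * S)) (powX-inv (suc J) m) ⟨
  x * ⟦ powX J ⟧ x * i * f + x * (⟦ powX J ⟧ x * S) ≡⟨ lemma x (⟦ powX J ⟧ x) i f S ⟩
  x * ⟦ powX J ⟧ x * (i * f + S)                 ∎
  where
  open ≡-Reasoning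
  x f i S : ℚ
  x = ι (suc m)
  f = ⟦ F J ⟧ x
  i = inv (suc m ^ suc J)
  S = ∑ J (λ j → inv (suc m ^ suc j) * ⟦ F j ⟧ x)
  lemma : ∀ x p i f S → x * p * i * f + x * (p * S) ≡ x * p * (i * f + S)
  lemma = solve-∀ ring

hornerSum-zero : ∀ J F → (∀ j → j < J → Zero (F j)) → Zero (hornerSum J F)
hornerSum-zero zero    F F≡0 x = refl
hornerSum-zero (suc J) F F≡0 x = cong₂ _+_ (F≡0 J ℕₚ.≤-refl x)
  (*-cong-0ʳ x (hornerSum-zero J F (λ j j<J → F≡0 j (ℕₚ.m≤n⇒m≤1+n j<J)) x))

hornerSum-multiple : ∀ J F (c : ℕ → ℚ) p x → (∀ j → j < J → ⟦ F j ⟧ x ≡ c j * p) →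
  ⟦ hornerSum J F ⟧ x ≡ ⟦ hornerSum J (λ j → con (c j)) ⟧ x * p
hornerSum-multiple zero    F c p x F≡ = sym (ℚₚ.*-zeroˡ p)
hornerSum-multiple (suc J) F c p x F≡ = trans
  (cong₂ (λ y z → y + x * z) (F≡ J ℕₚ.≤-refl) (hornerSum-multiple J F c p x (λ j j<J → F≡ j (ℕₚ.m≤n⇒m≤1+n j<J))))
  (lemma (c J) p x (⟦ hornerSum J (λ j → con (c j)) ⟧ x))
  where
  lemma : ∀ c p x y → c * p + x * (y * p) ≡ (c + x * y) * p
  lemma = solve-∀ ring

-- `c 0` sits innermost in the Horner scheme, at the top power of x; when it is 0 the degree falls
-- by one and the letters shift.
hornerSum-tail : ∀ J (c : ℕ → ℚ) x → c 0 ≡ 0ℚ →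
  ⟦ hornerSum (suc J) (λ j → con (c j)) ⟧ x ≡ ⟦ hornerSum J (λ j → con (c (suc j))) ⟧ x
hornerSum-tail zero    c x c0≡0 = cong₂ _+_ c0≡0 (ℚₚ.*-zeroʳ x)
hornerSum-tail (suc J) c x c0≡0 = cong (λ y → c (suc J) + x * y) (hornerSum-tail J c x c0≡0)

-- nested s (n-1) N = κ s (n) / n · nested s n N, up to a term for the tail of s.
κ : Word → Poly
κ []      = con 4ℚ ⊗ X ⊕ con (- 2ℚ)
κ (_ ∷ _) = X

-- The only root of 4x - 2 is 1/2; on the integers considered the sign is determined.
κ[]-nonZeroOnIntegers : NonZeroOnIntegers (κ [])
κ[]-nonZeroOnIntegers = (λ n eq → pos⇒≢0 (pos₁ n) (trans (sym (lemma₁ (ι n))) eq)) ,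
                        (λ n eq → pos⇒≢0 (pos₂ n) (trans (lemma₂ (ι n)) (*-cong-0ʳ (- 1ℚ) eq)))
  where
  lemma₁ : ∀ x → 4ℚ * (1ℚ + x) + - 2ℚ ≡ 2ℚ + 4ℚ * x
  lemma₁ = solve-∀ ring
  lemma₂ : ∀ x → 4ℚ + 2ℚ + 4ℚ * x ≡ - 1ℚ * (4ℚ * (- 1ℚ * x + - 1ℚ) + - 2ℚ)
  lemma₂ = solve-∀ ring
  pos₁ : ∀ n → 0ℚ ℚ.< 2ℚ + 4ℚ * ι n
  pos₁ n = +-pos (ℚₚ.positive⁻¹ 2ℚ) (*-nonNeg (ℚₚ.nonNegative⁻¹ 4ℚ) (ι-nonNeg n))
  pos₂ : ∀ n → 0ℚ ℚ.< 4ℚ + 2ℚ + 4ℚ * ι n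
  pos₂ n = +-pos (ℚₚ.positive⁻¹ (4ℚ + 2ℚ)) (*-nonNeg (ℚₚ.nonNegative⁻¹ 4ℚ) (ι-nonNeg n))

X-nonZeroOnIntegers : NonZeroOnIntegers X
X-nonZeroOnIntegers = ι-suc≢0 , negative≢0

1-nonZeroOnIntegers : NonZeroOnIntegers (con 1ℚ)
1-nonZeroOnIntegers = (λ _ → ℚₚ.1≢0) , (λ _ → ℚₚ.1≢0)

powX-eventuallyNonZero : ∀ J → EventuallyNonZero (powX J)
powX-eventuallyNonZero J = 1 , λ { (suc n) _ → powX-≢0 J (ι-suc≢0 n) }

⊗-eventuallyNonZero : ∀ p q → EventuallyNonZero p → EventuallyNonZero q → EventuallyNonZero (p ⊗ q)
⊗-eventuallyNonZero p q (n₀ , p≢0) (n₁ , q≢0) = n₀ ℕ.⊔ n₁ , λ n n≥ →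
  *-nonZero (p≢0 n (ℕₚ.≤-trans (ℕₚ.m≤m⊔n n₀ n₁) n≥)) (q≢0 n (ℕₚ.≤-trans (ℕₚ.m≤n⊔m n₀ n₁) n≥))

-- The ratio P / P₀ is invariant under x ↦ x - 1, hence constant along n₀, n₀ + 1, ..., and
-- polynomials that agree there agree everywhere.
proportional : ∀ P₀ P n₀ r → (∀ n → n₀ ≤ n → ⟦ P₀ ⟧ (ι n) ≢ 0ℚ) → r * ⟦ P₀ ⟧ (ι n₀) ≡ 1ℚ →
  (∀ x → ⟦ P₀ ⟧ x * ⟦ σ P ⟧ x ≡ ⟦ σ P₀ ⟧ x * ⟦ P ⟧ x) →
  ∀ x → ⟦ P ⟧ x ≡ ⟦ P ⟧ (ι n₀) * r * ⟦ P₀ ⟧ x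
proportional P₀ P n₀ r P₀≢0 rP₀≡1 shifted x = x-y≡0⇒x≡y (⟦ P ⟧ x) (c * ⟦ P₀ ⟧ x)
  (trans (lemma₃ (⟦ P ⟧ x) c (⟦ P₀ ⟧ x)) (poly-identity (P ⊖ con c ⊗ P₀) n₀ vanish x))
  where
  open ≡-Reasoning
  c : ℚ
  c = ⟦ P ⟧ (ι n₀) * r
  lemma₁ : ∀ p r q → p + - 1ℚ * (p * r * q) ≡ p * (1ℚ - r * q)
  lemma₁ = solve-∀ ring
  lemma₂ : ∀ P₀ p₀ P p c → p₀ * (P + - 1ℚ * (c * P₀)) ≡ P₀ * (p + - 1ℚ * (c * p₀)) - (P₀ * p - p₀ * P)
  lemma₂ = solve-∀ ring
  lemma₃ : ∀ p c q → p - c * q ≡ p + - 1ℚ * (c * q)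
  lemma₃ = solve-∀ ring
  along : ∀ d → ⟦ P ⊖ con c ⊗ P₀ ⟧ (ι (d ℕ.+ n₀)) ≡ 0ℚ
  along zero    = trans (lemma₁ (⟦ P ⟧ (ι n₀)) r (⟦ P₀ ⟧ (ι n₀)))
    (*-cong-0ʳ (⟦ P ⟧ (ι n₀)) (x≡y⇒x-y≡0 (sym rP₀≡1)))
  along (suc d) = *-cancelˡ-0 p₀ p₀≢0 (begin
    p₀ * ⟦ P ⊖ con c ⊗ P₀ ⟧ y
      ≡⟨ lemma₂ (⟦ P₀ ⟧ y) p₀ (⟦ P ⟧ y) (⟦ σ P ⟧ y) c ⟩
    ⟦ P₀ ⟧ y * ⟦ P ⊖ con c ⊗ P₀ ⟧ (y + - 1ℚ) - (⟦ P₀ ⟧ y * ⟦ σ P ⟧ y - p₀ * ⟦ P ⟧ y)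
      ≡⟨ cong₂ (λ u v → ⟦ P₀ ⟧ y * u - v)
           (trans (cong ⟦ P ⊖ con c ⊗ P₀ ⟧ (ι-pred (d ℕ.+ n₀))) (along d)) (x≡y⇒x-y≡0 (shifted y)) ⟩
    ⟦ P₀ ⟧ y * 0ℚ - 0ℚ
      ≡⟨ cong (_- 0ℚ) (ℚₚ.*-zeroʳ (⟦ P₀ ⟧ y)) ⟩
    0ℚ ∎)
    where
    y p₀ : ℚ
    y = ι (suc d ℕ.+ n₀)
    p₀ = ⟦ σ P₀ ⟧ y
    p₀≢0 : p₀ ≢ 0ℚ
    p₀≢0 p₀≡0 = P₀≢0 (d ℕ.+ n₀) (ℕₚ.m≤n+m n₀ d) (trans (cong ⟦ P₀ ⟧ (sym (ι-pred (d ℕ.+ n₀)))) p₀≡0)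
  vanish : ∀ n → n₀ ≤ n → ⟦ P ⊖ con c ⊗ P₀ ⟧ (ι n) ≡ 0ℚ
  vanish n n≥ = subst (λ k → ⟦ P ⊖ con c ⊗ P₀ ⟧ (ι k) ≡ 0ℚ) (ℕₚ.m∸n+n≡m n≥) (along (n ∸ n₀))

-- The words whose last exponent is 1. Relations are required to avoid them, because the pole
-- argument at the empty word cannot see their coefficients.
data LastZero : Word → Set where
  here  : LastZero (0 ∷ [])
  there : ∀ {j s} → LastZero s → LastZero (j ∷ s)

module Independence (J : ℕ) where

  Relation : ℕ → (Word → Poly) → Set
  Relation r P = ∀ n → TendsToZero (λ N → ∑ʷ J r (λ s → ⟦ P s ⟧ (ι n) * nested s n N))

  -- The coefficients of n^{J+2} (P₀(n) E(n-1) − P₀(n-1) E(n)), where E is the relation with coefficients P.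
  eliminate : Poly → (Word → Poly) → Word → Poly
  eliminate P₀ P t = X ⊗ (powX J ⊗ (P₀ ⊗ (κ t ⊗ σ (P t)) ⊖ X ⊗ (σ P₀ ⊗ P t))
                          ⊕ X ⊗ (P₀ ⊗ hornerSum J (λ j → σ (P (j ∷ t)))))

  eliminate-zero : ∀ P₀ P t → Zero (P t) → (∀ j → j < J → Zero (P (j ∷ t))) → Zero (eliminate P₀ P t)
  eliminate-zero P₀ P t Pt≡0 Pjt≡0 x = trans
    (cong₂ (λ (u , v) h → x * (⟦ powX J ⟧ x * (⟦ P₀ ⟧ x * (⟦ κ t ⟧ x * u) + - 1ℚ * (x * (⟦ σ P₀ ⟧ x * v))) + x * (⟦ P₀ ⟧ x * h)))
      (cong₂ _,_ (Pt≡0 (x + - 1ℚ)) (Pt≡0 x))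
      (hornerSum-zero J (λ j → σ (P (j ∷ t))) (λ j j<J y → Pjt≡0 j j<J (y + - 1ℚ)) x))
    (lemma x (⟦ powX J ⟧ x) (⟦ P₀ ⟧ x) (⟦ κ t ⟧ x) (⟦ σ P₀ ⟧ x))
    where
    lemma : ∀ x a b c d → x * (a * (b * (c * 0ℚ) + - 1ℚ * (x * (d * 0ℚ))) + x * (b * 0ℚ)) ≡ 0ℚ
    lemma = solve-∀ ring

  -- No longer word feeds the Horner sum here, so only P₀ σP - σP₀ P survives. It vanishes for the
  -- word that P₀ comes from, and so that word is eliminated.
  eliminate-leaf : ∀ P₀ P j t → (∀ i → i < J → Zero (P (i ∷ j ∷ t))) → ∀ x →
    ⟦ eliminate P₀ P (j ∷ t) ⟧ x ≡ ⟦ X ⊗ powX J ⊗ X ⟧ x * ⟦ P₀ ⊗ σ (P (j ∷ t)) ⊖ σ P₀ ⊗ P (j ∷ t) ⟧ x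
  eliminate-leaf P₀ P j t P≡0 x = trans
    (cong (λ h → x * (⟦ powX J ⟧ x * (⟦ P₀ ⟧ x * (x * ⟦ σ (P (j ∷ t)) ⟧ x) + - 1ℚ * (x * (⟦ σ P₀ ⟧ x * ⟦ P (j ∷ t) ⟧ x))) + x * (⟦ P₀ ⟧ x * h)))
      (hornerSum-zero J (λ i → σ (P (i ∷ j ∷ t))) (λ i i<J y → P≡0 i i<J (y + - 1ℚ)) x))
    (lemma x (⟦ powX J ⟧ x) (⟦ P₀ ⟧ x) (⟦ σ (P (j ∷ t)) ⟧ x) (⟦ σ P₀ ⟧ x) (⟦ P (j ∷ t) ⟧ x))
    where
    lemma : ∀ x a b u c v → x * (a * (b * (x * u) + - 1ℚ * (x * (c * v))) + x * (b * 0ℚ)) ≡ x * a * x * (b * u + - 1ℚ * (c * v))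
    lemma = solve-∀ ring

  -- Unfolding the nested sums once, from n-1 to n, passes a part of the coefficient of j ∷ t on to
  -- t; collecting these parts over j produces the Horner sums.
  eliminate-relation : ∀ r P₀ P → (∀ s → Valid J s → suc r < length s → Zero (P s)) →
    Relation (suc r) P → Relation (suc r) (eliminate P₀ P)
  -- The outermost factor X of `eliminate` makes every coefficient vanish at n = 0, where there is
  -- no relation at n-1 to combine with.
  eliminate-relation r P₀ P P≡0 rel zero = null-≗ (λ N → sym (∑ʷ-zero J (suc r) (λ s _ _ →
    *-cong-0ˡ (nested s 0 N) (ℚₚ.*-zeroˡ (⟦ powX J ⊗ (P₀ ⊗ (κ s ⊗ σ (P s)) ⊖ X ⊗ (σ P₀ ⊗ P s)) ⊕ X ⊗ (P₀ ⊗ hornerSum J (λ j → σ (P (j ∷ s)))) ⟧ 0ℚ))))) null-0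
  eliminate-relation r P₀ P P≡0 rel (suc m) = null-cong (suc m) combine
    (null-+ (null-* (x * pJ * ⟦ P₀ ⟧ x * x) (rel m)) (null-* (- 1ℚ * x * pJ * x * ⟦ σ P₀ ⟧ x) (rel (suc m))))
    where
    open ≡-Reasoning
    x pJ : ℚ
    x = ι (suc m)
    pJ = ⟦ powX J ⟧ x
    E : ℕ → ℕ → ℚ
    E n N = ∑ʷ J (suc r) (λ s → ⟦ P s ⟧ (ι n) * nested s n N)
    d : Word → ℚ
    d t = ∑ J (λ j → inv (suc m ^ suc j) * ⟦ σ (P (j ∷ t)) ⟧ x)
    σ≡ : ∀ s → ⟦ P s ⟧ (ι m) ≡ ⟦ σ (P s) ⟧ x
    σ≡ s = cong ⟦ P s ⟧ (sym (ι-pred m))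
    module _ (N : ℕ) (m<N : m < N) where
      A D : Word → ℚ
      A s = ⟦ κ s ⟧ x * ⟦ σ (P s) ⟧ x * nested s (suc m) N
      D s = d s * nested s (suc m) N
      tails : Word → ℚ
      tails []      = 0ℚ
      tails (j ∷ t) = inv (suc m ^ suc j) * ⟦ σ (P (j ∷ t)) ⟧ x * nested t (suc m) N
      unfold : ∀ s → x * (⟦ P s ⟧ (ι m) * nested s m N) ≡ A s + x * tails s
      unfold [] = begin
        x * (⟦ P [] ⟧ (ι m) * invC m m)                            ≡⟨ cong (λ p → x * (p * invC m m)) (σ≡ []) ⟩
        x * (⟦ σ (P []) ⟧ x * invC m m)                            ≡⟨ lemma₁ x (⟦ σ (P []) ⟧ x) (invC m m) ⟩
        x * invC m m * ⟦ σ (P []) ⟧ x                              ≡⟨ cong (_* ⟦ σ (P []) ⟧ x) (central m) ⟩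
        ⟦ κ [] ⟧ x * invC (suc m) (suc m) * ⟦ σ (P []) ⟧ x         ≡⟨ lemma₂ x (⟦ κ [] ⟧ x) (⟦ σ (P []) ⟧ x) (invC (suc m) (suc m)) ⟩
        A [] + x * 0ℚ                                              ∎
        where
        lemma₁ : ∀ x p w → x * (p * w) ≡ x * w * p
        lemma₁ = solve-∀ ring
        lemma₂ : ∀ x k p w → k * w * p ≡ k * p * w + x * 0ℚ
        lemma₂ = solve-∀ ring
      unfold (j ∷ t) = begin
        x * (⟦ P (j ∷ t) ⟧ (ι m) * nested (j ∷ t) m N)
          ≡⟨ cong₂ (λ p y → x * (p * y)) (σ≡ (j ∷ t)) (nested-step j t m N m<N) ⟩
        x * (⟦ σ (P (j ∷ t)) ⟧ x * (nested (j ∷ t) (suc m) N + inv (suc m ^ suc j) * nested t (suc m) N))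
          ≡⟨ lemma x (⟦ σ (P (j ∷ t)) ⟧ x) (nested (j ∷ t) (suc m) N) (inv (suc m ^ suc j)) (nested t (suc m) N) ⟩
        A (j ∷ t) + x * tails (j ∷ t) ∎
        where
        lemma : ∀ x p y i z → x * (p * (y + i * z)) ≡ x * p * y + x * (i * p * z)
        lemma = solve-∀ ring
      -- Tails have length at most r. Letting `D` run up to length r + 1 adds nothing, since its
      -- coefficients there come from words of length r + 2, which are zero.
      ∑tails : ∑ʷ J (suc r) tails ≡ ∑ʷ J (suc r) D
      ∑tails = begin
        0ℚ + ∑ J (λ j → ∑ʷ J r (λ t → tails (j ∷ t)))
          ≡⟨ ℚₚ.+-identityˡ _ ⟩
        ∑ J (λ j → ∑ʷ J r (λ t → tails (j ∷ t)))
          ≡⟨ ∑ʷ-∑ J r J (λ j t → tails (j ∷ t)) ⟨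
        ∑ʷ J r (λ t → ∑ J (λ j → tails (j ∷ t)))
          ≡⟨ ∑ʷ-cong J r (λ t _ _ → collect t) ⟩
        ∑ʷ J r D
          ≡⟨ ∑ʷ-shrink J r (λ t valid len → *-cong-0ˡ (nested t (suc m) N) (∑-zero J (λ j j<J → *-cong-0ʳ (inv (suc m ^ suc j))
               (P≡0 (j ∷ t) (j<J ∷ valid) (ℕₚ.≤-reflexive (cong suc (sym len))) (x + - 1ℚ))))) ⟨
        ∑ʷ J (suc r) D ∎
        where
        collect : ∀ t → ∑ J (λ j → tails (j ∷ t)) ≡ D t
        collect t = begin
          ∑ J (λ j → inv (suc m ^ suc j) * ⟦ σ (P (j ∷ t)) ⟧ x * nested t (suc m) N)    ≡⟨ ∑-cong J (λ j _ → ℚₚ.*-comm _ (nested t (suc m) N)) ⟩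
          ∑ J (λ j → nested t (suc m) N * (inv (suc m ^ suc j) * ⟦ σ (P (j ∷ t)) ⟧ x))  ≡⟨ ∑-* J (nested t (suc m) N) _ ⟩
          nested t (suc m) N * d t                                                      ≡⟨ ℚₚ.*-comm (nested t (suc m) N) (d t) ⟩
          D t                                                                           ∎
      shifted : x * E m N ≡ ∑ʷ J (suc r) A + x * ∑ʷ J (suc r) D
      shifted = begin
        x * E m N                                                 ≡⟨ ∑ʷ-* J (suc r) x (λ s → ⟦ P s ⟧ (ι m) * nested s m N) ⟨
        ∑ʷ J (suc r) (λ s → x * (⟦ P s ⟧ (ι m) * nested s m N))   ≡⟨ ∑ʷ-cong J (suc r) (λ s _ _ → unfold s) ⟩
        ∑ʷ J (suc r) (λ s → A s + x * tails s)                    ≡⟨ ∑ʷ-+ J (suc r) A (λ s → x * tails s) ⟩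
        ∑ʷ J (suc r) A + ∑ʷ J (suc r) (λ s → x * tails s)         ≡⟨ cong (∑ʷ J (suc r) A +_) (∑ʷ-* J (suc r) x tails) ⟩
        ∑ʷ J (suc r) A + x * ∑ʷ J (suc r) tails                   ≡⟨ cong (λ y → ∑ʷ J (suc r) A + x * y) ∑tails ⟩
        ∑ʷ J (suc r) A + x * ∑ʷ J (suc r) D                       ∎
      combine : x * pJ * ⟦ P₀ ⟧ x * x * E m N + - 1ℚ * x * pJ * x * ⟦ σ P₀ ⟧ x * E (suc m) N ≡
        ∑ʷ J (suc r) (λ s → ⟦ eliminate P₀ P s ⟧ x * nested s (suc m) N)
      combine = begin
        x * pJ * p₀ * x * E m N + c₃ * E (suc m) N
          ≡⟨ cong (_+ c₃ * E (suc m) N) (trans (ℚₚ.*-assoc c₁ x (E m N)) (cong (c₁ *_) shifted)) ⟩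
        c₁ * (∑ʷ J (suc r) A + x * ∑ʷ J (suc r) D) + c₃ * E (suc m) N
          ≡⟨ lemma₁ c₁ (∑ʷ J (suc r) A) x (∑ʷ J (suc r) D) (c₃ * E (suc m) N) ⟩
        c₁ * ∑ʷ J (suc r) A + c₁ * x * ∑ʷ J (suc r) D + c₃ * E (suc m) N
          ≡⟨ cong₂ _+_ (cong₂ _+_ (∑ʷ-* J (suc r) c₁ A) (∑ʷ-* J (suc r) (c₁ * x) D)) (∑ʷ-* J (suc r) c₃ B) ⟨
        ∑ʷ J (suc r) (λ s → c₁ * A s) + ∑ʷ J (suc r) (λ s → c₁ * x * D s) + ∑ʷ J (suc r) (λ s → c₃ * B s)
          ≡⟨ cong (_+ ∑ʷ J (suc r) (λ s → c₃ * B s)) (∑ʷ-+ J (suc r) (λ s → c₁ * A s) (λ s → c₁ * x * D s)) ⟨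
        ∑ʷ J (suc r) (λ s → c₁ * A s + c₁ * x * D s) + ∑ʷ J (suc r) (λ s → c₃ * B s)
          ≡⟨ ∑ʷ-+ J (suc r) (λ s → c₁ * A s + c₁ * x * D s) (λ s → c₃ * B s) ⟨
        ∑ʷ J (suc r) (λ s → c₁ * A s + c₁ * x * D s + c₃ * B s)
          ≡⟨ ∑ʷ-cong J (suc r) (λ s _ _ → trans
               (lemma₂ x pJ p₀ (⟦ κ s ⟧ x) (⟦ σ (P s) ⟧ x) (nested s (suc m) N) (d s) (⟦ σ P₀ ⟧ x) (⟦ P s ⟧ x))
               (cong (λ h → x * (pJ * (p₀ * (⟦ κ s ⟧ x * ⟦ σ (P s) ⟧ x) + - 1ℚ * (x * (⟦ σ P₀ ⟧ x * ⟦ P s ⟧ x))) + x * (p₀ * h)) * nested s (suc m) N)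
                 (sym (hornerSum-∑ J (λ j → σ (P (j ∷ s))) m)))) ⟩
        ∑ʷ J (suc r) (λ s → ⟦ eliminate P₀ P s ⟧ x * nested s (suc m) N) ∎
        where
        p₀ c₁ c₃ : ℚ
        p₀ = ⟦ P₀ ⟧ x
        c₁ = x * pJ * p₀
        c₃ = - 1ℚ * x * pJ * x * ⟦ σ P₀ ⟧ x
        B : Word → ℚ
        B s = ⟦ P s ⟧ x * nested s (suc m) N
        lemma₁ : ∀ c a x b e → c * (a + x * b) + e ≡ c * a + c * x * b + e
        lemma₁ = solve-∀ ring
        lemma₂ : ∀ x a p k u y d q v → x * a * p * (k * u * y) + x * a * p * x * (d * y) + - 1ℚ * x * a * x * q * (v * y) ≡
          x * (a * (p * (k * u) + - 1ℚ * (x * (q * v))) + x * (p * (a * d))) * y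
        lemma₂ = solve-∀ ring

  words : ℕ → List Word
  words zero    = [] ∷ []
  words (suc r) = cartesianProductWith _∷_ (upTo J) (words r)

  words-complete : ∀ s → Valid J s → s ∈ words (length s)
  words-complete []      []            = here refl
  words-complete (j ∷ s) (j<J ∷ valid) = ∈-cartesianProductWith⁺ _∷_ (∈-upTo⁺ j<J) (words-complete s valid)

  words-sound : ∀ r s → s ∈ words r → Valid J s × length s ≡ r
  words-sound zero    [] (here refl) = [] , refl
  words-sound (suc r) s s∈ with ∈-cartesianProductWith⁻ _∷_ (upTo J) (words r) s∈
  ... | j , t , j∈ , t∈ , refl with words-sound r t t∈
  ... | valid , len = ∈-upTo⁻ j∈ ∷ valid , cong suc len

  -- Words shorter than r are unrestricted. The list L of words of length r that may still occur is
  -- the parameter that elimination shortens.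
  Supported : ℕ → List Word → (Word → Poly) → Set
  Supported r L P = ∀ s → Valid J s → r ≤ length s → (length s ≡ r × s ∈ L) ⊎ Zero (P s)

  -- The situation once the eliminated relation is known to be trivial: its coefficients at the
  -- words j ∷ t₀ make every P (j ∷ t₀) a constant multiple of P₀, and the one at t₀ becomes a
  -- difference equation for Q / P₀.
  module TopWord
    (j₀ : ℕ) (t₀ : Word) (P : Word → Poly) (valid : Valid J t₀)
    (n₀ : ℕ) (P₀≢0 : ∀ n → n₀ ≤ n → ⟦ P (j₀ ∷ t₀) ⟧ (ι n) ≢ 0ℚ)
    (leaf : ∀ j → j < J → ∀ i → i < J → Zero (P (i ∷ j ∷ t₀)))
    (eliminated : ∀ s → Valid J s → Zero (eliminate (P (j₀ ∷ t₀)) P s))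
    where

    P₀ Q : Poly
    P₀ = P (j₀ ∷ t₀)
    Q  = P t₀

    inverse : ∃ λ r → r * ⟦ P₀ ⟧ (ι n₀) ≡ 1ℚ
    inverse = reciprocal (⟦ P₀ ⟧ (ι n₀)) (P₀≢0 n₀ ℕₚ.≤-refl)

    c : ℕ → ℚ
    c j = ⟦ P (j ∷ t₀) ⟧ (ι n₀) * proj₁ inverse

    c-j₀ : c j₀ ≡ 1ℚ
    c-j₀ = trans (ℚₚ.*-comm _ (proj₁ inverse)) (proj₂ inverse)

    c-multiple : ∀ j → j < J → ∀ x → ⟦ P (j ∷ t₀) ⟧ x ≡ c j * ⟦ P₀ ⟧ x
    c-multiple j j<J = proportional P₀ (P (j ∷ t₀)) n₀ (proj₁ inverse) P₀≢0 (proj₂ inverse)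
      (poly-cancel-≡ (X ⊗ powX J ⊗ X) (P₀ ⊗ σ (P (j ∷ t₀))) (σ P₀ ⊗ P (j ∷ t₀))
        (⊗-eventuallyNonZero (X ⊗ powX J) X
          (⊗-eventuallyNonZero X (powX J) X-eventuallyNonZero (powX-eventuallyNonZero J)) X-eventuallyNonZero)
        (λ x → trans (sym (eliminate-leaf P₀ P j t₀ (leaf j j<J) x)) (eliminated (j ∷ t₀) (j<J ∷ valid) x)))

    Hc : Poly
    Hc = hornerSum J (λ j → con (c j))

    -- With R = Q / P₀ this says x R - κ σR = Σ c_j / x^j, after multiplication by powers of x and
    -- by P₀ σP₀.
    reduced : ∀ x → ⟦ X ⊗ (powX J ⊗ (P₀ ⊗ (κ t₀ ⊗ σ Q) ⊖ X ⊗ (σ P₀ ⊗ Q)) ⊕ X ⊗ (P₀ ⊗ (Hc ⊗ σ P₀))) ⟧ x ≡ 0ℚ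
    reduced x = trans
      (cong (λ h → x * (⟦ powX J ⟧ x * (⟦ P₀ ⟧ x * (⟦ κ t₀ ⟧ x * ⟦ σ Q ⟧ x) + - 1ℚ * (x * (⟦ σ P₀ ⟧ x * ⟦ Q ⟧ x))) + x * (⟦ P₀ ⟧ x * h)))
        (sym (hornerSum-multiple J (λ j → σ (P (j ∷ t₀))) c (⟦ σ P₀ ⟧ x) x (λ j j<J → c-multiple j j<J (x + - 1ℚ)))))
      (eliminated t₀ valid x)

    c-j₀≢0 : c j₀ ≢ 0ℚ
    c-j₀≢0 c≡0 = ℚₚ.1≢0 (trans (sym c-j₀) c≡0)

  -- Here κ is 4x - 2, so no factor x can be removed from x R - κ σR = Σ c_j / x^j, and the term j =
  -- 0 has no pole. The condition on last letters gives c 0 = 0, which leaves the pole orders 1,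
  -- ..., J - 1.
  contradiction-[] : ∀ j₀ P → j₀ < J → (∀ s → LastZero s → Zero (P s)) →
    ∀ n₀ → (∀ n → n₀ ≤ n → ⟦ P (j₀ ∷ []) ⟧ (ι n) ≢ 0ℚ) →
    (∀ j → j < J → ∀ i → i < J → Zero (P (i ∷ j ∷ []))) →
    (∀ s → Valid J s → Zero (eliminate (P (j₀ ∷ [])) P s)) → ⊥
  contradiction-[] j₀ P j₀<J lastZero n₀ P₀≢0 leaf eliminated = main J j₀<J refl
    where
    open TopWord j₀ [] P [] n₀ P₀≢0 leaf eliminated
    c0≡0 : c 0 ≡ 0ℚ
    c0≡0 = *-cong-0ˡ (proj₁ inverse) (lastZero (0 ∷ []) here (ι n₀))
    main : ∀ J′ → j₀ < J′ → J ≡ J′ → ⊥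
    main (suc J′) j₀<1+J′ refl = c-j₀≢0 (all j₀ j₀<1+J′)
      where
      H : Poly
      H = hornerSum J′ (λ j → con (c (suc j)))
      lemma : ∀ x a k p q u v h → x * x * (a * (x * (v * q) + - 1ℚ * (k * (u * p))) + - 1ℚ * (h * (p * q)))
        ≡ - 1ℚ * (x * (x * a * (p * (k * u) + - 1ℚ * (x * (q * v))) + x * (p * (h * q))))
      lemma = solve-∀ ring
      multiple : ∀ x → x * x * ⟦ powX J′ ⊗ (X ⊗ (Q ⊗ σ P₀) ⊖ κ [] ⊗ (σ Q ⊗ P₀)) ⊖ H ⊗ (P₀ ⊗ σ P₀) ⟧ x ≡ 0ℚ
      multiple x = trans
        (lemma x (⟦ powX J′ ⟧ x) (⟦ κ [] ⟧ x) (⟦ P₀ ⟧ x) (⟦ σ P₀ ⟧ x) (⟦ σ Q ⟧ x) (⟦ Q ⟧ x) (⟦ H ⟧ x))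
        (*-cong-0ʳ (- 1ℚ) (trans
          (cong (λ h → x * (x * ⟦ powX J′ ⟧ x * (⟦ P₀ ⟧ x * (⟦ κ [] ⟧ x * ⟦ σ Q ⟧ x) + - 1ℚ * (x * (⟦ σ P₀ ⟧ x * ⟦ Q ⟧ x))) + x * (⟦ P₀ ⟧ x * (h * ⟦ σ P₀ ⟧ x))))
            (sym (hornerSum-tail J′ c x c0≡0)))
          (reduced x)))
      c∘suc≡0 : ∀ j → j < J′ → c (suc j) ≡ 0ℚ
      c∘suc≡0 = no-poles J′ (λ j → c (suc j)) P₀ Q X (κ []) (n₀ , P₀≢0) X-nonZeroOnIntegers κ[]-nonZeroOnIntegers
        (poly-cancel-≡ (X ⊗ X) (powX J′ ⊗ (X ⊗ (Q ⊗ σ P₀) ⊖ κ [] ⊗ (σ Q ⊗ P₀))) (H ⊗ (P₀ ⊗ σ P₀))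
          (⊗-eventuallyNonZero X X X-eventuallyNonZero X-eventuallyNonZero) multiple)
      all : ∀ j → j < suc J′ → c j ≡ 0ℚ
      all zero    _         = c0≡0
      all (suc j) (s≤s j<J) = c∘suc≡0 j j<J

  -- Here κ is X, so a factor x cancels and R - σR = Σ c_j / x^(j+1): every c_j belongs to a genuine
  -- pole.
  contradiction-∷ : ∀ j₀ i₀ t₀ P → j₀ < J → Valid J (i₀ ∷ t₀) →
    ∀ n₀ → (∀ n → n₀ ≤ n → ⟦ P (j₀ ∷ i₀ ∷ t₀) ⟧ (ι n) ≢ 0ℚ) →
    (∀ j → j < J → ∀ i → i < J → Zero (P (i ∷ j ∷ i₀ ∷ t₀))) →
    (∀ s → Valid J s → Zero (eliminate (P (j₀ ∷ i₀ ∷ t₀)) P s)) → ⊥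
  contradiction-∷ j₀ i₀ t₀ P j₀<J valid n₀ P₀≢0 leaf eliminated = c-j₀≢0
    (no-poles J c P₀ Q (con 1ℚ) (con 1ℚ) (n₀ , P₀≢0) 1-nonZeroOnIntegers 1-nonZeroOnIntegers
      (poly-cancel-≡ (X ⊗ X) (powX J ⊗ (con 1ℚ ⊗ (Q ⊗ σ P₀) ⊖ con 1ℚ ⊗ (σ Q ⊗ P₀))) (Hc ⊗ (P₀ ⊗ σ P₀))
        (⊗-eventuallyNonZero X X X-eventuallyNonZero X-eventuallyNonZero) multiple) j₀ j₀<J)
    where
    open TopWord j₀ (i₀ ∷ t₀) P valid n₀ P₀≢0 leaf eliminated
    lemma : ∀ x a p q u v h → x * x * (a * (1ℚ * (v * q) + - 1ℚ * (1ℚ * (u * p))) + - 1ℚ * (h * (p * q)))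
      ≡ - 1ℚ * (x * (a * (p * (x * u) + - 1ℚ * (x * (q * v))) + x * (p * (h * q))))
    lemma = solve-∀ ring
    multiple : ∀ x → x * x * ⟦ powX J ⊗ (con 1ℚ ⊗ (Q ⊗ σ P₀) ⊖ con 1ℚ ⊗ (σ Q ⊗ P₀)) ⊖ Hc ⊗ (P₀ ⊗ σ P₀) ⟧ x ≡ 0ℚ
    multiple x = trans
      (lemma x (⟦ powX J ⟧ x) (⟦ P₀ ⟧ x) (⟦ σ P₀ ⟧ x) (⟦ σ Q ⟧ x) (⟦ Q ⟧ x) (⟦ Hc ⟧ x))
      (*-cong-0ʳ (- 1ℚ) (reduced x))

  OnlyTrivialRelations : ℕ → List Word → Set
  OnlyTrivialRelations r L = ∀ P → Supported r L P → (∀ s → LastZero s → Zero (P s)) → Relation r P →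
    ∀ s → Valid J s → Zero (P s)

  -- Eliminating s₀ gives a relation supported on L, which is trivial by induction. Its vanishing at
  -- the words that share the tail of s₀, and at that tail itself, feeds the pole argument.
  leading-coefficient-zero : ∀ r s₀ L → Valid J s₀ × length s₀ ≡ suc r → OnlyTrivialRelations (suc r) L →
    ∀ P → Supported (suc r) (s₀ ∷ L) P → (∀ s → LastZero s → Zero (P s)) → Relation (suc r) P → ¬ EventuallyNonZero (P s₀)
  leading-coefficient-zero r s₀ L (valid₀ , len₀) smaller P supported lastZero rel (n₀ , P₀≢0) =
    impossible s₀ refl valid₀ len₀
    where
    longer : ∀ s → Valid J s → suc r < length s → Zero (P s)
    longer s valid len with supported s valid (ℕₚ.<⇒≤ len)
    ... | inj₂ zero-s   = zero-s
    ... | inj₁ (eq , _) = ⊥-elim (ℕₚ.<⇒≢ len (sym eq))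
    children : ∀ s → Valid J s → suc r ≤ length s → ∀ j → j < J → Zero (P (j ∷ s))
    children s valid len j j<J = longer (j ∷ s) (j<J ∷ valid) (s≤s len)
    self : ∀ s → Valid J s → suc r ≡ length s → Zero (eliminate (P s) P s)
    self (j ∷ t) valid len x = trans (eliminate-leaf (P (j ∷ t)) P j t (children (j ∷ t) valid (ℕₚ.≤-reflexive len)) x)
      (*-cong-0ʳ (⟦ X ⊗ powX J ⊗ X ⟧ x) (lemma (⟦ P (j ∷ t) ⟧ x) (⟦ σ (P (j ∷ t)) ⟧ x)))
      where
      lemma : ∀ p q → p * q + - 1ℚ * (q * p) ≡ 0ℚ
      lemma = solve-∀ ring
    supported′ : Supported (suc r) L (eliminate (P s₀) P)
    supported′ s valid len with supported s valid len
    ... | inj₂ zero-s           = inj₂ (eliminate-zero (P s₀) P s zero-s (children s valid len))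
    ... | inj₁ (eq , here refl) = inj₂ (self s valid (sym eq))
    ... | inj₁ (eq , there s∈)  = inj₁ (eq , s∈)
    eliminated : ∀ s → Valid J s → Zero (eliminate (P s₀) P s)
    eliminated = smaller (eliminate (P s₀) P) supported′
      (λ s last → eliminate-zero (P s₀) P s (lastZero s last) (λ j _ → lastZero (j ∷ s) (there last)))
      (eliminate-relation r (P s₀) P longer rel)
    impossible : ∀ s → s ≡ s₀ → Valid J s → length s ≡ suc r → ⊥
    impossible (j₀ ∷ []) refl (j₀<J ∷ valid) len =
      contradiction-[] j₀ P j₀<J lastZero n₀ P₀≢0
        (λ j j<J → children (j ∷ []) (j<J ∷ []) (ℕₚ.≤-reflexive (sym len))) eliminated
    impossible (j₀ ∷ i₀ ∷ t₀) refl (j₀<J ∷ valid) len =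
      contradiction-∷ j₀ i₀ t₀ P j₀<J valid n₀ P₀≢0
        (λ j j<J → children (j ∷ i₀ ∷ t₀) (j<J ∷ valid) (ℕₚ.≤-reflexive (sym len))) eliminated

  extend : ∀ r s₀ L → Valid J s₀ × length s₀ ≡ suc r → OnlyTrivialRelations (suc r) L → OnlyTrivialRelations (suc r) (s₀ ∷ L)
  extend r s₀ L sound smaller P supported lastZero rel with zero? (P s₀)
  ... | inj₂ P₀≢0 = ⊥-elim (leading-coefficient-zero r s₀ L sound smaller P supported lastZero rel P₀≢0)
  ... | inj₁ zero-s₀ = smaller P supported′ lastZero rel
    where
    supported′ : Supported (suc r) L P
    supported′ s valid len with supported s valid len
    ... | inj₂ zero-s           = inj₂ zero-s
    ... | inj₁ (eq , here refl) = inj₂ zero-s₀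
    ... | inj₁ (eq , there s∈)  = inj₁ (eq , s∈)

  independent : ∀ r L → (∀ s → s ∈ L → Valid J s × length s ≡ r) → OnlyTrivialRelations r L
  independent zero L sound P supported lastZero rel s valid with supported s valid z≤n
  ... | inj₂ zero-s = zero-s
  independent zero L sound P supported lastZero rel [] valid | inj₁ _ = poly-identity (P []) 0 (λ n _ →
    *-cancelˡ-0 (invC n n) (invC-≢0 n n) (trans (ℚₚ.*-comm (invC n n) (⟦ P [] ⟧ (ι n)))
      (null-const (⟦ P [] ⟧ (ι n) * invC n n) (rel n))))
  independent (suc r) [] sound P supported lastZero rel = independent r (words r) (words-sound r) P supported′ lastZero
    (λ n → null-≗ (λ N → ∑ʷ-shrink J r (λ s valid len → *-cong-0ˡ (nested s n N) (top s valid (ℕₚ.≤-reflexive (sym len)) (ι n)))) (rel n))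
    where
    top : ∀ s → Valid J s → suc r ≤ length s → Zero (P s)
    top s valid len with supported s valid len
    ... | inj₂ zero-s = zero-s
    supported′ : Supported r (words r) P
    supported′ s valid len with ℕₚ.m≤n⇒m<n∨m≡n len
    ... | inj₁ r<len = inj₂ (top s valid r<len)
    ... | inj₂ refl  = inj₁ (refl , words-complete s valid)
  independent (suc r) (s₀ ∷ L) sound =
    extend r s₀ L (sound s₀ (here refl)) (independent (suc r) L (λ s s∈ → sound s (there s∈)))

  nested-independent : ∀ r (c : Word → ℚ) → (∀ s → Valid J s → r < length s → c s ≡ 0ℚ) → (∀ s → LastZero s → c s ≡ 0ℚ) →
    (∀ n → TendsToZero (λ N → ∑ʷ J r (λ s → c s * nested s n N))) → ∀ s → Valid J s → c s ≡ 0ℚ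
  nested-independent r c long≡0 last≡0 rel s valid =
    independent r (words r) (words-sound r) (λ s → con (c s)) supported (λ s last _ → last≡0 s last) rel s valid 0ℚ
    where
    supported : Supported r (words r) (λ s → con (c s))
    supported s valid len with ℕₚ.m≤n⇒m<n∨m≡n len
    ... | inj₁ r<len = inj₂ (λ _ → long≡0 s valid r<len)
    ... | inj₂ refl  = inj₁ (refl , words-complete s valid)

-- The composition fin a

dualWord-++ : ∀ u v → dualWord (u ++ v) ≡ dualWord v ++ dualWord u
dualWord-++ u v = trans (cong reverse (map-++ not u v)) (reverse-++ (map not u) (map not v))

dualWord-involutive : ∀ w → dualWord (dualWord w) ≡ w
dualWord-involutive w = begin
  reverse (map not (reverse (map not w)))  ≡⟨ cong reverse (reverse-map not (map not w)) ⟩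
  reverse (reverse (map not (map not w)))  ≡⟨ reverse-involutive (map not (map not w)) ⟩
  map not (map not w)                      ≡⟨ map-∘ w ⟨
  map (λ b → not (not b)) w                ≡⟨ map-id-local (universal not-involutive w) ⟩
  w                                        ∎
  where open ≡-Reasoning

replicate-snoc : ∀ n (b : Bool) w → replicate n b ++ b ∷ w ≡ b ∷ replicate n b ++ w
replicate-snoc zero    b w = refl
replicate-snoc (suc n) b w = cong (b ∷_) (replicate-snoc n b w)

dualWord-trues : ∀ n → dualWord (replicate n true) ≡ replicate n false
dualWord-trues zero    = refl
dualWord-trues (suc n) = begin
  dualWord ((true ∷ []) ++ replicate n true)       ≡⟨ dualWord-++ (true ∷ []) (replicate n true) ⟩
  dualWord (replicate n true) ++ false ∷ []        ≡⟨ cong (_++ false ∷ []) (dualWord-trues n) ⟩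
  replicate n false ++ false ∷ []                  ≡⟨ replicate-snoc n false [] ⟩
  false ∷ replicate n false ++ []                  ≡⟨ cong (false ∷_) (++-identityʳ (replicate n false)) ⟩
  false ∷ replicate n false                        ∎
  where open ≡-Reasoning

fromWordAux-block : ∀ c k w → fromWordAux c (replicate k false ++ true ∷ w) ≡ suc (c ℕ.+ k) ∷ fromWord w
fromWordAux-block c zero    w = cong (λ n → suc n ∷ fromWord w) (sym (ℕₚ.+-identityʳ c))
fromWordAux-block c (suc k) w = trans (fromWordAux-block (suc c) k w) (cong (λ n → suc n ∷ fromWord w) (sym (ℕₚ.+-suc c k)))

fromWord-word : ∀ a → All (1 ≤_) a → fromWord (word a) ≡ a
fromWord-word []          []        = refl
fromWord-word (suc a ∷ as) (_ ∷ pos) = trans (fromWordAux-block 0 a (word as)) (cong (suc a ∷_) (fromWord-word as pos))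

word-fromWordAux : ∀ c v → word (fromWordAux c (v ++ true ∷ [])) ≡ replicate c false ++ (v ++ true ∷ [])
word-fromWordAux c []          = refl
word-fromWordAux c (false ∷ v) = trans (word-fromWordAux (suc c) v) (sym (replicate-snoc c false (v ++ true ∷ [])))
word-fromWordAux c (true ∷ v)  = cong (λ w → replicate c false ++ true ∷ w) (word-fromWordAux 0 v)

fromWordAux-positive : ∀ c w → All (1 ≤_) (fromWordAux c w)
fromWordAux-positive c []          = []
fromWordAux-positive c (false ∷ w) = fromWordAux-positive (suc c) w
fromWordAux-positive c (true ∷ w)  = s≤s z≤n ∷ fromWordAux-positive 0 w

word-snoc : ∀ c k → word (c ++ suc k ∷ []) ≡ word c ++ replicate k false ++ true ∷ []
word-snoc []       k = refl
word-snoc (x ∷ c) k = trans (cong (λ w → replicate (x ∸ 1) false ++ true ∷ w) (word-snoc c k))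
  (sym (++-assoc (replicate (x ∸ 1) false) (true ∷ word c) (replicate k false ++ true ∷ [])))

init-snoc : ∀ (c : List ℕ) x → init (c ++ x ∷ []) ≡ c
init-snoc []          x = refl
init-snoc (y ∷ [])    x = refl
init-snoc (y ∷ z ∷ c) x = cong (y ∷_) (init-snoc (z ∷ c) x)

-- The word of a nonempty admissible composition begins with 0, so its dual ends in 1 and is decoded
-- without loss.
word-dual : ∀ a → Admissible a → word (dual a) ≡ dualWord (word a)
word-dual []                _ = refl
word-dual (suc zero ∷ as)   adm with Admissible.headOK adm
... | cons (s≤s ())
word-dual (zero ∷ as)       adm with Admissible.headOK adm
... | cons ()
word-dual (suc (suc m) ∷ as) _ = subst (λ w → word (fromWord w) ≡ w)
  (sym (dualWord-++ (false ∷ []) (word (suc m ∷ as))))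
  (word-fromWordAux 0 (dualWord (word (suc m ∷ as))))

-- w(a) = 0 1^k w(b) means that the last block of the dual of a is 0^k 1, preceded by the dual of w(b).
fin-prefix : ∀ k a b → Admissible b → word a ≡ false ∷ replicate k true ++ word b → fin a ≡ b
fin-prefix k a b adm wa≡ = begin
  dual (init (dual a))                   ≡⟨ cong (λ x → dual (init x)) dual-a ⟩
  dual (init (dual b ++ suc k ∷ []))     ≡⟨ cong dual (init-snoc (dual b) (suc k)) ⟩
  fromWord (dualWord (word (dual b)))    ≡⟨ cong (λ w → fromWord (dualWord w)) (word-dual b adm) ⟩
  fromWord (dualWord (dualWord (word b))) ≡⟨ cong fromWord (dualWord-involutive (word b)) ⟩
  fromWord (word b)                      ≡⟨ fromWord-word b (Admissible.positive adm) ⟩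
  b                                      ∎
  where
  open ≡-Reasoning
  dualWord-a : dualWord (word a) ≡ word (dual b ++ suc k ∷ [])
  dualWord-a = begin
    dualWord (word a)                                              ≡⟨ cong dualWord wa≡ ⟩
    dualWord ((false ∷ replicate k true) ++ word b)                ≡⟨ dualWord-++ (false ∷ replicate k true) (word b) ⟩
    dualWord (word b) ++ dualWord ((false ∷ []) ++ replicate k true) ≡⟨ cong (dualWord (word b) ++_) (dualWord-++ (false ∷ []) (replicate k true)) ⟩
    dualWord (word b) ++ dualWord (replicate k true) ++ true ∷ []  ≡⟨ cong₂ (λ u v → u ++ v ++ true ∷ []) (sym (word-dual b adm)) (dualWord-trues k) ⟩
    word (dual b) ++ replicate k false ++ true ∷ []                ≡⟨ word-snoc (dual b) k ⟨
    word (dual b ++ suc k ∷ [])                                    ∎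
  dual-a : dual a ≡ dual b ++ suc k ∷ []
  dual-a = trans (cong fromWord dualWord-a) (fromWord-word (dual b ++ suc k ∷ [])
    (++⁺ (fromWordAux-positive 0 (dualWord (word b))) (s≤s z≤n ∷ [])))

-- If `as` has k leading ones, the word of 2 ∷ as begins with 0 followed by k + 1 letters 1, which
-- is exactly what fin removes; so this is fin (2 ∷ as).
strip : List ℕ → List ℕ
strip (suc zero ∷ as) = strip as
strip as              = as

ones : List ℕ → ℕ
ones (suc zero ∷ as) = suc (ones as)
ones as              = 0

strip-positive : ∀ as → All (1 ≤_) as → Admissible (strip as)
strip-positive []                  pos       = record { positive = [] ; headOK = nil }
strip-positive (suc zero ∷ as)     (_ ∷ pos) = strip-positive as pos
strip-positive (suc (suc a) ∷ as)  pos       = record { positive = pos ; headOK = cons (s≤s (s≤s z≤n)) }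

word-strip : ∀ as → All (1 ≤_) as → word as ≡ replicate (ones as) true ++ word (strip as)
word-strip []                 pos       = refl
word-strip (suc zero ∷ as)    (_ ∷ pos) = cong (true ∷_) (word-strip as pos)
word-strip (suc (suc a) ∷ as) pos       = refl

weight-strip : ∀ as → ones as ℕ.+ weight (strip as) ≡ weight as
weight-strip []                 = refl
weight-strip (zero ∷ as)        = refl
weight-strip (suc zero ∷ as)    = cong suc (weight-strip as)
weight-strip (suc (suc a) ∷ as) = refl

fin-2 : ∀ as → All (1 ≤_) as → fin (2 ∷ as) ≡ strip as
fin-2 as pos = fin-prefix (suc (ones as)) (2 ∷ as) (strip as) (strip-positive as pos)
  (cong (λ w → false ∷ true ∷ w) (word-strip as pos))

fin-3+ : ∀ m as → All (1 ≤_) as → fin (suc (suc (suc m)) ∷ as) ≡ suc (suc m) ∷ as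
fin-3+ m as pos = fin-prefix 0 (suc (suc (suc m)) ∷ as) (suc (suc m) ∷ as)
  (record { positive = s≤s z≤n ∷ pos ; headOK = cons (s≤s (s≤s z≤n)) }) refl

init-positive : ∀ a → All (1 ≤_) a → All (1 ≤_) (init a)
init-positive []          pos       = []
init-positive (x ∷ [])    pos       = []
init-positive (x ∷ y ∷ a) (p ∷ pos) = p ∷ init-positive (y ∷ a) pos

init-admissible : ∀ a → Admissible a → Admissible (init a)
init-admissible a adm = record { positive = init-positive a (Admissible.positive adm) ; headOK = head a (Admissible.headOK adm) }
  where
  head : ∀ a → HeadOK a → HeadOK (init a)
  head []          nil         = nil
  head (x ∷ [])    (cons 2≤x)  = nil
  head (x ∷ y ∷ a) (cons 2≤x)  = cons 2≤x

data FinView : List ℕ → Set where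
  is-[] : FinView []
  is-2  : ∀ as → All (1 ≤_) as → FinView (2 ∷ as)
  is-3+ : ∀ m as → All (1 ≤_) as → FinView (suc (suc (suc m)) ∷ as)

finView : ∀ a → Admissible a → FinView a
finView [] adm = is-[]
finView (zero ∷ as) adm with Admissible.headOK adm
... | cons ()
finView (suc zero ∷ as) adm with Admissible.headOK adm
... | cons (s≤s ())
finView (suc (suc zero) ∷ as) adm with Admissible.positive adm
... | _ ∷ pos = is-2 as pos
finView (suc (suc (suc m)) ∷ as) adm with Admissible.positive adm
... | _ ∷ pos = is-3+ m as pos

fin-admissible : ∀ a → Admissible a → Admissible (fin a)
fin-admissible a adm with finView a adm
... | is-[]          = adm
... | is-2 as pos    = subst Admissible (sym (fin-2 as pos)) (strip-positive as pos)
... | is-3+ m as pos = subst Admissible (sym (fin-3+ m as pos)) (record { positive = s≤s z≤n ∷ pos ; headOK = cons (s≤s (s≤s z≤n)) })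

lastPart : ℕ → List ℕ → ℕ
lastPart a []       = a
lastPart a (b ∷ as) = lastPart b as

weight-init : ∀ a as → lastPart a as ℕ.+ weight (init (a ∷ as)) ≡ weight (a ∷ as)
weight-init a []       = refl
weight-init a (b ∷ as) = begin
  lastPart b as ℕ.+ (a ℕ.+ weight (init (b ∷ as)))   ≡⟨ ℕₚ.+-assoc (lastPart b as) a _ ⟨
  lastPart b as ℕ.+ a ℕ.+ weight (init (b ∷ as))     ≡⟨ cong (ℕ._+ weight (init (b ∷ as))) (ℕₚ.+-comm (lastPart b as) a) ⟩
  a ℕ.+ lastPart b as ℕ.+ weight (init (b ∷ as))     ≡⟨ ℕₚ.+-assoc a (lastPart b as) _ ⟩
  a ℕ.+ (lastPart b as ℕ.+ weight (init (b ∷ as)))   ≡⟨ cong (a ℕ.+_) (weight-init b as) ⟩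
  a ℕ.+ weight (b ∷ as)                              ∎
  where open ≡-Reasoning

lastPart-positive : ∀ a as → All (1 ≤_) (a ∷ as) → 1 ≤ lastPart a as
lastPart-positive a []       (1≤a ∷ _) = 1≤a
lastPart-positive a (b ∷ as) (_ ∷ pos) = lastPart-positive b as pos

-- Double tails

tailSum-nonNeg : ∀ p as m → 0ℚ ℚ.≤ tailSum p as m
tailSum-nonNeg p []       m       = ℚₚ.nonNegative⁻¹ 1ℚ
tailSum-nonNeg p (b ∷ bs) zero    = ℚₚ.≤-refl
tailSum-nonNeg p (b ∷ bs) (suc m) = sumRange-nonNeg p m _ (λ j _ _ → *-nonNeg (inv-nonNeg (j ^ b)) (tailSum-nonNeg p bs j))

sumRange-mono-suc : ∀ lo hi f → (∀ j → 0ℚ ℚ.≤ f j) → sumRange lo hi f ℚ.≤ sumRange lo (suc hi) f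
sumRange-mono-suc lo hi f f≥0 with ℕₚ.≤-<-connex lo hi
... | inj₁ lo≤hi = begin
  sumRange lo hi f                  ≡⟨ ℚₚ.+-identityʳ (sumRange lo hi f) ⟨
  sumRange lo hi f + 0ℚ             ≤⟨ ℚₚ.+-monoʳ-≤ (sumRange lo hi f) (f≥0 (suc hi)) ⟩
  sumRange lo hi f + f (suc hi)     ≡⟨ sumRange-last lo hi f lo≤hi ⟨
  sumRange lo (suc hi) f            ∎
  where open ℚₚ.≤-Reasoning
... | inj₂ hi<lo = ℚₚ.≤-trans (ℚₚ.≤-reflexive (sumRange-empty lo hi f (ℕₚ.<⇒≤ hi<lo)))
  (sumRange-nonNeg lo (suc hi) f (λ j _ _ → f≥0 j))

sumRange-mono-hi : ∀ lo f → (∀ j → 0ℚ ℚ.≤ f j) → ∀ {hi hi′} → hi ≤ hi′ → sumRange lo hi f ℚ.≤ sumRange lo hi′ f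
sumRange-mono-hi lo f f≥0 {hi} {hi′} hi≤hi′ = subst (λ k → sumRange lo hi f ℚ.≤ sumRange lo k f) (ℕₚ.m∸n+n≡m hi≤hi′) (go (hi′ ∸ hi))
  where
  go : ∀ d → sumRange lo hi f ℚ.≤ sumRange lo (d ℕ.+ hi) f
  go zero    = ℚₚ.≤-refl
  go (suc d) = ℚₚ.≤-trans (go d) (sumRange-mono-suc lo (d ℕ.+ hi) f f≥0)

tailSum-mono : ∀ p as m → tailSum p as m ℚ.≤ tailSum p as (suc m)
tailSum-mono p []       m       = ℚₚ.≤-refl
tailSum-mono p (b ∷ bs) zero    = tailSum-nonNeg p (b ∷ bs) 1
tailSum-mono p (b ∷ bs) (suc m) = sumRange-mono-suc p m _ (λ j → *-nonNeg (inv-nonNeg (j ^ b)) (tailSum-nonNeg p bs j))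

null-inv : TendsToZero inv
null-inv ε 0<ε with inv-small ε 0<ε
... | n , small = suc n , λ N N≥ → subst (ℚ._< ε) (sym (ℚₚ.0≤p⇒∣p∣≡p (inv-nonNeg N))) (small N N≥)

-- Beyond M the terms are below δ, so the sum up to N is at most A + N δ, with A the sum up to M.
-- Division by N makes the first part small as well.
cesàro : ∀ p u → (∀ j → 0ℚ ℚ.≤ u j) → TendsToZero u → TendsToZero (λ N → inv N * sumRange p N u)
cesàro p u u≥0 u→0 ε 0<ε with halve ε 0<ε
... | δ , 0<δ , δ+δ≡ε with u→0 δ 0<δ
... | M , small with null-* (sumRange p M u) null-inv δ 0<δ
... | M′ , small′ = suc M′ , λ { (suc N) N≥ → begin-strict
  ∣ inv (suc N) * sumRange p (suc N) u ∣              ≡⟨ ℚₚ.0≤p⇒∣p∣≡p (*-nonNeg (inv-nonNeg (suc N)) (sumRange-nonNeg p (suc N) u (λ j _ _ → u≥0 j))) ⟩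
  inv (suc N) * sumRange p (suc N) u                  ≤⟨ *-monoʳ-≤ (inv-nonNeg (suc N)) (linear (suc N)) ⟩
  inv (suc N) * (A + ι (suc N) * δ)                   ≡⟨ lemma (inv (suc N)) A (ι (suc N)) δ ⟩
  A * inv (suc N) + inv (suc N) * ι (suc N) * δ       ≡⟨ cong (λ x → A * inv (suc N) + x * δ) (inv-ι N) ⟩
  A * inv (suc N) + 1ℚ * δ                            ≡⟨ cong₂ _+_ (sym (ℚₚ.0≤p⇒∣p∣≡p (*-nonNeg A≥0 (inv-nonNeg (suc N))))) (ℚₚ.*-identityˡ δ) ⟩
  ∣ A * inv (suc N) ∣ + δ                             <⟨ ℚₚ.+-monoˡ-< δ (small′ (suc N) (ℕₚ.<⇒≤ N≥)) ⟩
  δ + δ                                               ≡⟨ δ+δ≡ε ⟩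
  ε                                                   ∎ }
  where
  open ℚₚ.≤-Reasoning
  A : ℚ
  A = sumRange p M u
  A≥0 : 0ℚ ℚ.≤ A
  A≥0 = sumRange-nonNeg p M u (λ j _ _ → u≥0 j)
  lemma : ∀ i A n δ → i * (A + n * δ) ≡ A * i + i * n * δ
  lemma = solve-∀ ring
  lemma₂ : ∀ A n δ → A + n * δ + δ ≡ A + (1ℚ + n) * δ
  lemma₂ = solve-∀ ring
  A≤ : ∀ N → A ℚ.≤ A + ι N * δ
  A≤ N = subst (ℚ._≤ A + ι N * δ) (ℚₚ.+-identityʳ A) (ℚₚ.+-monoʳ-≤ A (*-nonNeg (ι-nonNeg N) (ℚₚ.<⇒≤ 0<δ)))
  linear : ∀ N → sumRange p N u ℚ.≤ A + ι N * δ
  linear zero = ℚₚ.≤-trans (ℚₚ.≤-reflexive (sumRange-empty p 0 u z≤n)) (ℚₚ.≤-trans A≥0 (A≤ 0))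
  linear (suc N) with ℕₚ.≤-<-connex (suc N) M | ℕₚ.≤-<-connex p N
  ... | inj₁ 1+N≤M | _        = ℚₚ.≤-trans (sumRange-mono-hi p u u≥0 1+N≤M) (A≤ (suc N))
  ... | inj₂ M<1+N | inj₁ p≤N = begin
    sumRange p (suc N) u            ≡⟨ sumRange-last p N u p≤N ⟩
    sumRange p N u + u (suc N)      ≤⟨ ℚₚ.+-mono-≤ (linear N) (ℚₚ.≤-trans (ℚₚ.≤-reflexive (sym (ℚₚ.0≤p⇒∣p∣≡p (u≥0 (suc N))))) (ℚₚ.<⇒≤ (small (suc N) (ℕₚ.<⇒≤ M<1+N)))) ⟩
    A + ι N * δ + δ                 ≡⟨ lemma₂ A (ι N) δ ⟩
    A + ι (suc N) * δ               ∎
  ... | inj₂ M<1+N | inj₂ N<p = ℚₚ.≤-trans (ℚₚ.≤-reflexive (sumRange-empty p (suc N) u N<p)) (ℚₚ.≤-trans A≥0 (A≤ (suc N)))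

inv-pow-≤ : ∀ m a → 1 ≤ a → inv (suc m ^ a) ℚ.≤ inv (suc m)
inv-pow-≤ m (suc a) _ = inv-antimono (s≤s z≤n) (ℕₚ.m≤m*n (suc m) (suc m ^ a))
  where instance _ = ℕₚ.m^n≢0 (suc m) a

-- Nested harmonic sums are o(N). Since 1/j^b ≤ 1/j, the summands of the outer sum are bounded by a
-- sequence that is null by induction, and its means are null too.
tailSum-null : ∀ p as → All (1 ≤_) as → TendsToZero (λ N → inv N * tailSum p as (suc N))
tailSum-null p []       []          = null-≗ (λ N → sym (ℚₚ.*-identityʳ (inv N))) null-inv
tailSum-null p (b ∷ bs) (1≤b ∷ pos) = null-bound 0 bound
  (cesàro p u (λ j → *-nonNeg (inv-nonNeg j) (tailSum-nonNeg p bs (suc j))) (tailSum-null p bs pos))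
  where
  u : ℕ → ℚ
  u j = inv j * tailSum p bs (suc j)
  terms : ∀ N j → p < j → j ≤ N → inv (j ^ b) * tailSum p bs j ℚ.≤ u j
  terms N (suc j) _ _ = *-mono-≤ (inv-nonNeg (suc j ^ b)) (tailSum-nonNeg p bs (suc (suc j))) (inv-pow-≤ j b 1≤b) (tailSum-mono p bs (suc j))
  bound : ∀ N → 0 ≤ N → ∣ inv N * tailSum p (b ∷ bs) (suc N) ∣ ℚ.≤ ∣ inv N * sumRange p N u ∣
  bound N _ = begin
    ∣ inv N * tailSum p (b ∷ bs) (suc N) ∣   ≡⟨ ℚₚ.0≤p⇒∣p∣≡p (*-nonNeg (inv-nonNeg N) (tailSum-nonNeg p (b ∷ bs) (suc N))) ⟩
    inv N * tailSum p (b ∷ bs) (suc N)       ≤⟨ *-monoʳ-≤ (inv-nonNeg N) (sumRange-mono p _ u N (terms N)) ⟩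
    inv N * sumRange p N u                   ≡⟨ ℚₚ.0≤p⇒∣p∣≡p (*-nonNeg (inv-nonNeg N) (sumRange-nonNeg p N u (λ j _ _ → *-nonNeg (inv-nonNeg j) (tailSum-nonNeg p bs (suc j))))) ⟨
    ∣ inv N * sumRange p N u ∣               ∎
    where open ℚₚ.≤-Reasoning

invC-≤inv : ∀ N q → invC (suc N) (suc q) ℚ.≤ ι (suc q) * inv (suc N)
invC-≤inv N q = begin
  w′                                                  ≡⟨ ℚₚ.*-identityˡ w′ ⟨
  1ℚ * w′                                             ≡⟨ cong (_* w′) (cong₂ _*_ (inv-ι q) (inv-ι N)) ⟨
  inv (suc q) * ι (suc q) * (inv (suc N) * ι (suc N)) * w′ ≡⟨ lemma₁ (inv (suc q)) (ι (suc q)) (inv (suc N)) (ι (suc N)) w′ ⟩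
  ι (suc q) * inv (suc N) * (ι (suc N) * inv (suc q) * w′) ≤⟨ *-monoʳ-≤ (*-nonNeg (ι-nonNeg (suc q)) (inv-nonNeg (suc N))) (begin
    ι (suc N) * inv (suc q) * w′                        ≡⟨ ℚₚ.+-identityˡ (ι (suc N) * inv (suc q) * w′) ⟨
    0ℚ + ι (suc N) * inv (suc q) * w′                   ≤⟨ ℚₚ.+-monoˡ-≤ (ι (suc N) * inv (suc q) * w′) (invC-nonNeg (suc N) (suc q)) ⟩
    w′ + ι (suc N) * inv (suc q) * w′                   ≡⟨ lemma₂ w′ (ι (suc N) * inv (suc q)) ⟩
    (1ℚ + ι (suc N) * inv (suc q)) * w′                 ≡⟨ invC-sucʳ (suc N) q ⟨
    invC (suc N) q                                      ≤⟨ invC-≤1 (suc N) q ⟩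
    1ℚ                                                  ∎) ⟩
  ι (suc q) * inv (suc N) * 1ℚ                        ≡⟨ ℚₚ.*-identityʳ (ι (suc q) * inv (suc N)) ⟩
  ι (suc q) * inv (suc N)                             ∎
  where
  open ℚₚ.≤-Reasoning
  w′ : ℚ
  w′ = invC (suc N) (suc q)
  lemma₁ : ∀ i q j n w → i * q * (j * n) * w ≡ q * j * (n * i * w)
  lemma₁ = solve-∀ ring
  lemma₂ : ∀ w x → w + x * w ≡ (1ℚ + x) * w
  lemma₂ = solve-∀ ring

-- This is the term left at the upper end N by telescoping: the inverse binomial is at most (q+1)/N,
-- while the tail is o(N).
boundary-null : ∀ p q as → All (1 ≤_) as → TendsToZero (λ N → invC N (suc q) * tailSum p as (suc N))
boundary-null p q as pos = null-bound 1 bound (null-* (ι (suc q)) (tailSum-null p as pos))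
  where
  open ℚₚ.≤-Reasoning
  bound : ∀ N → 1 ≤ N → ∣ invC N (suc q) * tailSum p as (suc N) ∣ ℚ.≤ ∣ ι (suc q) * (inv N * tailSum p as (suc N)) ∣
  bound (suc N) _ = begin
    ∣ invC (suc N) (suc q) * T ∣             ≡⟨ ℚₚ.0≤p⇒∣p∣≡p (*-nonNeg (invC-nonNeg (suc N) (suc q)) T≥0) ⟩
    invC (suc N) (suc q) * T                 ≤⟨ *-monoˡ-≤ T≥0 (invC-≤inv N q) ⟩
    ι (suc q) * inv (suc N) * T              ≡⟨ ℚₚ.*-assoc (ι (suc q)) (inv (suc N)) T ⟩
    ι (suc q) * (inv (suc N) * T)            ≡⟨ ℚₚ.0≤p⇒∣p∣≡p (*-nonNeg (ι-nonNeg (suc q)) (*-nonNeg (inv-nonNeg (suc N)) T≥0)) ⟨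
    ∣ ι (suc q) * (inv (suc N) * T) ∣        ∎
    where
    T : ℚ
    T = tailSum p as (suc (suc N))
    T≥0 : 0ℚ ℚ.≤ T
    T≥0 = tailSum-nonNeg p as (suc (suc N))

-- p and q are decoupled so that each can be raised alone. The value at [] is what telescoping over
-- a single index leaves at its lower end.
doubleTail : List ℕ → ℕ → ℕ → ℕ → ℚ
doubleTail []       p q N = invC p q
doubleTail (a ∷ as) p q N = sumRange p N (λ m → invC m q * (inv (m ^ a) * tailSum p as m))

ζTrunc-doubleTail : ∀ a n N → ζTrunc a n N ≡ doubleTail a n n N
ζTrunc-doubleTail []       n N = refl
ζTrunc-doubleTail (a ∷ as) n N = refl

-- `tailSum` and `doubleTail` differ only in the weight of their outermost index; for an arbitrary
-- weight g, splitting off the smallest index is the same computation.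
weighted : (ℕ → ℚ) → ℕ → List ℕ → ℕ → ℚ
weighted g p as N = sumRange p N (λ m → g m * tailSum p as m)

weighted-[] : ∀ g p N → p < N → weighted g p [] N ≡ weighted g (suc p) [] N + g (suc p)
weighted-[] g p N p<N = trans (sumRange-first p N (λ m → g m * 1ℚ) p<N)
  (trans (cong (_+ weighted g (suc p) [] N) (ℚₚ.*-identityʳ (g (suc p)))) (ℚₚ.+-comm (g (suc p)) (weighted g (suc p) [] N)))

mutual
  weighted-∷ : ∀ g p b bs N → p < N → weighted g p (b ∷ bs) N ≡
    weighted g (suc p) (b ∷ bs) N + inv (suc p ^ lastPart b bs) * weighted g (suc p) (init (b ∷ bs)) N
  weighted-∷ g p b bs N p<N = begin
    weighted g p (b ∷ bs) N
      ≡⟨ sumRange-first p N (λ m → g m * tailSum p (b ∷ bs) m) p<N ⟩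
    g (suc p) * tailSum p (b ∷ bs) (suc p) + sumRange (suc p) N (λ m → g m * tailSum p (b ∷ bs) m)
      -- The term m = p + 1 vanishes, as no inner index lies strictly between p and p + 1.
      ≡⟨ cong₂ _+_ (*-cong-0ʳ (g (suc p)) (sumRange-empty p p _ ℕₚ.≤-refl))
           (sumRange-cong (suc p) _ (λ m → G m + i * H m) N (λ m p<m _ → trans (cong (g m *_) (tailSum-init p b bs m p<m))
             (lemma (g m) (tailSum (suc p) (b ∷ bs) m) i (tailSum (suc p) (init (b ∷ bs)) m)))) ⟩
    0ℚ + sumRange (suc p) N (λ m → G m + i * H m)
      ≡⟨ ℚₚ.+-identityˡ _ ⟩
    sumRange (suc p) N (λ m → G m + i * H m)
      ≡⟨ sumRange-+ (suc p) G (λ m → i * H m) N ⟩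
    sumRange (suc p) N G + sumRange (suc p) N (λ m → i * H m)
      ≡⟨ cong (sumRange (suc p) N G +_) (sumRange-* (suc p) i H N) ⟩
    sumRange (suc p) N G + i * sumRange (suc p) N H ∎
    where
    open ≡-Reasoning
    i : ℚ
    i = inv (suc p ^ lastPart b bs)
    G H : ℕ → ℚ
    G m = g m * tailSum (suc p) (b ∷ bs) m
    H m = g m * tailSum (suc p) (init (b ∷ bs)) m
    lemma : ∀ g x i y → g * (x + i * y) ≡ g * x + i * (g * y)
    lemma = solve-∀ ring

  tailSum-init : ∀ p b bs m → suc p < m → tailSum p (b ∷ bs) m ≡
    tailSum (suc p) (b ∷ bs) m + inv (suc p ^ lastPart b bs) * tailSum (suc p) (init (b ∷ bs)) m
  tailSum-init p b []        (suc m) (s≤s p<m) = trans (weighted-[] (λ j → inv (j ^ b)) p m p<m)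
    (cong (weighted (λ j → inv (j ^ b)) (suc p) [] m +_) (sym (ℚₚ.*-identityʳ (inv (suc p ^ b)))))
  tailSum-init p b (b′ ∷ bs) (suc m) (s≤s p<m) = weighted-∷ (λ j → inv (j ^ b)) p b′ bs m p<m

doubleTail-weighted : ∀ a as p q N → doubleTail (a ∷ as) p q N ≡ weighted (λ m → invC m q * inv (m ^ a)) p as N
doubleTail-weighted a as p q N = sumRange-cong p _ _ N (λ m _ _ → sym (ℚₚ.*-assoc (invC m q) (inv (m ^ a)) (tailSum p as m)))

doubleTail-init : ∀ a as p q N → p < N → doubleTail (a ∷ as) p q N ≡
  doubleTail (a ∷ as) (suc p) q N + inv (suc p ^ lastPart a as) * doubleTail (init (a ∷ as)) (suc p) q N
doubleTail-init a [] p q N p<N = begin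
  doubleTail (a ∷ []) p q N                                  ≡⟨ doubleTail-weighted a [] p q N ⟩
  weighted g p [] N                                          ≡⟨ weighted-[] g p N p<N ⟩
  weighted g (suc p) [] N + invC (suc p) q * inv (suc p ^ a) ≡⟨ cong₂ _+_ (sym (doubleTail-weighted a [] (suc p) q N)) (ℚₚ.*-comm (invC (suc p) q) (inv (suc p ^ a))) ⟩
  doubleTail (a ∷ []) (suc p) q N + inv (suc p ^ a) * invC (suc p) q ∎
  where
  open ≡-Reasoning
  g : ℕ → ℚ
  g m = invC m q * inv (m ^ a)
doubleTail-init a (b ∷ bs) p q N p<N = begin
  doubleTail (a ∷ b ∷ bs) p q N                              ≡⟨ doubleTail-weighted a (b ∷ bs) p q N ⟩
  weighted g p (b ∷ bs) N                                    ≡⟨ weighted-∷ g p b bs N p<N ⟩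
  weighted g (suc p) (b ∷ bs) N + inv (suc p ^ lastPart b bs) * weighted g (suc p) (init (b ∷ bs)) N
    ≡⟨ cong₂ (λ x y → x + inv (suc p ^ lastPart b bs) * y) (sym (doubleTail-weighted a (b ∷ bs) (suc p) q N)) (sym (doubleTail-weighted a (init (b ∷ bs)) (suc p) q N)) ⟩
  doubleTail (a ∷ b ∷ bs) (suc p) q N + inv (suc p ^ lastPart b bs) * doubleTail (a ∷ init (b ∷ bs)) (suc p) q N ∎
  where
  open ≡-Reasoning
  g : ℕ → ℚ
  g m = invC m q * inv (m ^ a)

doubleTail-q : ∀ a as p q N → doubleTail (suc a ∷ as) p q N ≡
  doubleTail (suc a ∷ as) p (suc q) N + inv (suc q) * doubleTail (a ∷ as) p (suc q) N
doubleTail-q a as p q N = begin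
  doubleTail (suc a ∷ as) p q N                         ≡⟨ sumRange-cong p _ (λ m → F m + inv (suc q) * G m) N pointwise ⟩
  sumRange p N (λ m → F m + inv (suc q) * G m)          ≡⟨ sumRange-+ p F (λ m → inv (suc q) * G m) N ⟩
  sumRange p N F + sumRange p N (λ m → inv (suc q) * G m) ≡⟨ cong (sumRange p N F +_) (sumRange-* p (inv (suc q)) G N) ⟩
  sumRange p N F + inv (suc q) * sumRange p N G         ∎
  where
  open ≡-Reasoning
  F G : ℕ → ℚ
  F m = invC m (suc q) * (inv (m ^ suc a) * tailSum p as m)
  G m = invC m (suc q) * (inv (m ^ a) * tailSum p as m)
  lemma₁ : ∀ n i w x t → (1ℚ + n * i) * w * (x * t) ≡ w * (x * t) + i * (w * (n * x * t))
  lemma₁ = solve-∀ ring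
  lemma₂ : ∀ n j y → n * (j * y) ≡ j * n * y
  lemma₂ = solve-∀ ring
  pointwise : ∀ m → p < m → m ≤ N → invC m q * (inv (m ^ suc a) * tailSum p as m) ≡ F m + inv (suc q) * G m
  pointwise (suc m) _ _ = begin
    invC (suc m) q * (inv (suc m ^ suc a) * t)
      ≡⟨ cong (_* (inv (suc m ^ suc a) * t)) (invC-sucʳ (suc m) q) ⟩
    (1ℚ + ι (suc m) * inv (suc q)) * invC (suc m) (suc q) * (inv (suc m ^ suc a) * t)
      ≡⟨ lemma₁ (ι (suc m)) (inv (suc q)) (invC (suc m) (suc q)) (inv (suc m ^ suc a)) t ⟩
    F (suc m) + inv (suc q) * (invC (suc m) (suc q) * (ι (suc m) * inv (suc m ^ suc a) * t))
      ≡⟨ cong (λ y → F (suc m) + inv (suc q) * (invC (suc m) (suc q) * (y * t))) (begin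
           ι (suc m) * inv (suc m ℕ.* suc m ^ a)           ≡⟨ cong (ι (suc m) *_) (inv-* (suc m) (suc m ^ a)) ⟩
           ι (suc m) * (inv (suc m) * inv (suc m ^ a))     ≡⟨ lemma₂ (ι (suc m)) (inv (suc m)) (inv (suc m ^ a)) ⟩
           inv (suc m) * ι (suc m) * inv (suc m ^ a)       ≡⟨ cong (_* inv (suc m ^ a)) (inv-ι m) ⟩
           1ℚ * inv (suc m ^ a)                            ≡⟨ ℚₚ.*-identityˡ (inv (suc m ^ a)) ⟩
           inv (suc m ^ a)                                 ∎) ⟩
    F (suc m) + inv (suc q) * G (suc m) ∎
    where
    t : ℚ
    t = tailSum p as (suc m)

-- The weights invC m q / m telescope, so that the sum over the outermost index can be carried out.
invC-telescope : ∀ m q → invC (suc m) (suc q) * inv (suc m ^ 1) ≡ inv (suc q) * (invC m (suc q) - invC (suc m) (suc q))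
invC-telescope m q = sym (begin
  inv (suc q) * (invC m (suc q) - w)                               ≡⟨ cong (λ y → inv (suc q) * (y - w)) (invC-sucˡ m (suc q)) ⟩
  inv (suc q) * ((1ℚ + ι (suc q) * inv (suc m)) * w - w)           ≡⟨ lemma (inv (suc q)) (ι (suc q)) (inv (suc m)) w ⟩
  inv (suc q) * ι (suc q) * (w * inv (suc m))                      ≡⟨ cong (_* (w * inv (suc m))) (inv-ι q) ⟩
  1ℚ * (w * inv (suc m))                                           ≡⟨ ℚₚ.*-identityˡ (w * inv (suc m)) ⟩
  w * inv (suc m)                                                  ≡⟨ cong (λ k → w * inv k) (ℕₚ.*-identityʳ (suc m)) ⟨
  w * inv (suc m ^ 1)                                              ∎)
  where
  open ≡-Reasoning
  w : ℚ
  w = invC (suc m) (suc q)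
  lemma : ∀ i q j w → i * ((1ℚ + q * j) * w - w) ≡ i * q * (w * j)
  lemma = solve-∀ ring

-- Summing the telescoping weight over the outermost index leaves an inverse binomial at the next
-- index, hence the double tail of `as`, and a boundary term at N that is kept exactly.
doubleTail-1 : ∀ as p q N → p ≤ N → doubleTail (1 ∷ as) p (suc q) N ≡
  inv (suc q) * (doubleTail as p (suc q) N - invC N (suc q) * tailSum p as (suc N))
doubleTail-1 as p q N = go as (rangeView p N)
  where
  open ≡-Reasoning
  i : ℚ
  i = inv (suc q)
  w : ℕ → ℚ
  w m = invC m (suc q)
  lemma₀ : ∀ i w → 0ℚ ≡ i * (w - w * 1ℚ)
  lemma₀ = solve-∀ ring
  lemma₁ : ∀ i w → 0ℚ ≡ i * (0ℚ - w * 0ℚ)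
  lemma₁ = solve-∀ ring
  lemma₂ : ∀ i z w v t → i * (z - w * t) + i * (w - v) * t ≡ i * (z - v * t)
  lemma₂ = solve-∀ ring
  lemma₃ : ∀ i z v t f → i * (z - v * t) ≡ i * (z + v * f - v * (t + f))
  lemma₃ = solve-∀ ring
  go : ∀ as {N} → RangeView p N → p ≤ N → doubleTail (1 ∷ as) p (suc q) N ≡ i * (doubleTail as p (suc q) N - w N * tailSum p as (suc N))
  -- Half a step: N advances in the outer sum and in w, but not yet in the sums over `as`. For
  -- nonempty `as` the two terms missing there cancel each other.
  step : ∀ as {N} → RangeView p N → p ≤ N → doubleTail (1 ∷ as) p (suc q) (suc N) ≡
    i * (doubleTail as p (suc q) N - w (suc N) * tailSum p as (suc N))
  step as {N} view p≤N = begin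
    doubleTail (1 ∷ as) p (suc q) (suc N)
      ≡⟨ sumRange-last p N _ p≤N ⟩
    doubleTail (1 ∷ as) p (suc q) N + w (suc N) * (inv (suc N ^ 1) * t)
      ≡⟨ cong₂ _+_ (go as view p≤N) (trans (sym (ℚₚ.*-assoc (w (suc N)) (inv (suc N ^ 1)) t)) (cong (_* t) (invC-telescope N q))) ⟩
    i * (doubleTail as p (suc q) N - w N * t) + i * (w N - w (suc N)) * t
      ≡⟨ lemma₂ i (doubleTail as p (suc q) N) (w N) (w (suc N)) t ⟩
    i * (doubleTail as p (suc q) N - w (suc N) * t) ∎
    where
    t : ℚ
    t = tailSum p as (suc N)
  go as (empty N≤p) p≤N with ℕₚ.≤-antisym N≤p p≤N
  go [] (empty _) _ | refl = trans (sumRange-empty p p _ ℕₚ.≤-refl) (lemma₀ i (w p))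
  go (b ∷ bs) (empty _) _ | refl = trans (sumRange-empty p p _ ℕₚ.≤-refl) (trans (lemma₁ i (w p))
    (cong₂ (λ x y → i * (x - w p * y)) (sym (sumRange-empty p p _ ℕₚ.≤-refl)) (sym (sumRange-empty p p _ ℕₚ.≤-refl))))
  go [] (snoc {N} p≤N view) _ = step [] view p≤N
  go (b ∷ bs) (snoc {N} p≤N view) _ = begin
    doubleTail (1 ∷ b ∷ bs) p (suc q) (suc N)
      ≡⟨ step (b ∷ bs) view p≤N ⟩
    i * (doubleTail (b ∷ bs) p (suc q) N - w (suc N) * tailSum p (b ∷ bs) (suc N))
      ≡⟨ lemma₃ i (doubleTail (b ∷ bs) p (suc q) N) (w (suc N)) (tailSum p (b ∷ bs) (suc N)) f ⟩
    i * (doubleTail (b ∷ bs) p (suc q) N + w (suc N) * f - w (suc N) * (tailSum p (b ∷ bs) (suc N) + f))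
      ≡⟨ cong₂ (λ x y → i * (x - w (suc N) * y)) (sumRange-last p N _ p≤N) (sumRange-last p N _ p≤N) ⟨
    i * (doubleTail (b ∷ bs) p (suc q) (suc N) - w (suc N) * tailSum p (b ∷ bs) (suc (suc N))) ∎
    where
    f : ℚ
    f = inv (suc N ^ b) * tailSum p bs (suc N)

doubleTail-nonNeg : ∀ a p q N → 0ℚ ℚ.≤ doubleTail a p q N
doubleTail-nonNeg []       p q N = invC-nonNeg p q
doubleTail-nonNeg (a ∷ as) p q N = sumRange-nonNeg p N _ (λ m _ _ →
  *-nonNeg (invC-nonNeg m q) (*-nonNeg (inv-nonNeg (m ^ a)) (tailSum-nonNeg p as m)))

-- Lowering the exponent a to 1 only enlarges the terms, and then the telescoped form applies, with
-- a boundary term of favourable sign.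
doubleTail-≤ : ∀ a as → 1 ≤ a → ∀ p q N → doubleTail (a ∷ as) p (suc q) N ℚ.≤ inv (suc q) * doubleTail as p (suc q) N
doubleTail-≤ a as 1≤a p q N with ℕₚ.≤-<-connex p N
... | inj₂ N<p = ℚₚ.≤-trans (ℚₚ.≤-reflexive (sumRange-empty p N _ (ℕₚ.<⇒≤ N<p)))
  (*-nonNeg (inv-nonNeg (suc q)) (doubleTail-nonNeg as p (suc q) N))
... | inj₁ p≤N = begin
  doubleTail (a ∷ as) p (suc q) N    ≤⟨ sumRange-mono p _ _ N terms ⟩
  doubleTail (1 ∷ as) p (suc q) N    ≡⟨ doubleTail-1 as p q N p≤N ⟩
  inv (suc q) * (doubleTail as p (suc q) N - e) ≤⟨ *-monoʳ-≤ (inv-nonNeg (suc q)) (begin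
    doubleTail as p (suc q) N - e      ≤⟨ ℚₚ.+-monoʳ-≤ (doubleTail as p (suc q) N) (ℚₚ.neg-antimono-≤ (*-nonNeg (invC-nonNeg N (suc q)) (tailSum-nonNeg p as (suc N)))) ⟩
    doubleTail as p (suc q) N + 0ℚ     ≡⟨ ℚₚ.+-identityʳ (doubleTail as p (suc q) N) ⟩
    doubleTail as p (suc q) N          ∎) ⟩
  inv (suc q) * doubleTail as p (suc q) N ∎
  where
  open ℚₚ.≤-Reasoning
  e : ℚ
  e = invC N (suc q) * tailSum p as (suc N)
  terms : ∀ m → p < m → m ≤ N → invC m (suc q) * (inv (m ^ a) * tailSum p as m) ℚ.≤ invC m (suc q) * (inv (m ^ 1) * tailSum p as m)
  terms (suc m) _ _ = *-monoʳ-≤ (invC-nonNeg (suc m) (suc q)) (*-monoˡ-≤ (tailSum-nonNeg p as (suc m))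
    (ℚₚ.≤-trans (inv-pow-≤ m a 1≤a) (ℚₚ.≤-reflexive (cong inv (sym (ℕₚ.*-identityʳ (suc m)))))))

doubleTail-≤1 : ∀ a → All (1 ≤_) a → ∀ p q N → doubleTail a p (suc q) N ℚ.≤ 1ℚ
doubleTail-≤1 []       []          p q N = invC-≤1 p (suc q)
doubleTail-≤1 (a ∷ as) (1≤a ∷ pos) p q N = ℚₚ.≤-trans (doubleTail-≤ a as 1≤a p q N)
  (*-mono-≤ (inv-nonNeg (suc q)) (ℚₚ.nonNegative⁻¹ 1ℚ) (inv-≤1 (suc q)) (doubleTail-≤1 as pos p q N))

doubleTail-small : ∀ a → All (1 ≤_) a → UniformlySmall (λ n N → doubleTail a n n N)
doubleTail-small []       []          = nested-small []
doubleTail-small (a ∷ as) (1≤a ∷ pos) = small-inv-bound (λ n N → doubleTail-nonNeg (a ∷ as) (suc n) (suc n) N)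
  (λ n N → ℚₚ.≤-trans (doubleTail-≤ a as 1≤a (suc n) n N)
    (ℚₚ.≤-trans (*-monoʳ-≤ (inv-nonNeg (suc n)) (doubleTail-≤1 as pos (suc n) n N)) (ℚₚ.≤-reflexive (ℚₚ.*-identityʳ (inv (suc n))))))

doubleTail-1-∼ : ∀ as → All (1 ≤_) as → ∀ p q →
  doubleTail (1 ∷ as) p (suc q) ∼ (λ N → inv (suc q) * doubleTail as p (suc q) N)
doubleTail-1-∼ as pos p q = null-difference (null-cong p (λ N p≤N → trans
  (lemma (inv (suc q)) (doubleTail as p (suc q) N) (invC N (suc q) * tailSum p as (suc N)))
  (cong (_- inv (suc q) * doubleTail as p (suc q) N) (sym (doubleTail-1 as p q N p≤N))))
  (null-* (- inv (suc q)) (boundary-null p q as pos)))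
  where
  lemma : ∀ i z e → - i * e ≡ i * (z - e) - i * z
  lemma = solve-∀ ring

-- Each leading 1 telescopes away at the cost of a factor 1/(q+1), until an admissible composition
-- is reached.
doubleTail-strip : ∀ as → All (1 ≤_) as → ∀ p q →
  doubleTail (1 ∷ as) p (suc q) ∼ (λ N → inv (suc q ^ suc (ones as)) * doubleTail (strip as) p (suc q) N)
doubleTail-strip as@[] pos p q = ∼-trans (doubleTail-1-∼ as pos p q)
  (∼-reflexive 0 (λ N _ → cong (λ k → inv k * doubleTail as p (suc q) N) (sym (ℕₚ.*-identityʳ (suc q)))))
doubleTail-strip as@(suc (suc _) ∷ _) pos p q = ∼-trans (doubleTail-1-∼ as pos p q)
  (∼-reflexive 0 (λ N _ → cong (λ k → inv k * doubleTail as p (suc q) N) (sym (ℕₚ.*-identityʳ (suc q)))))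
doubleTail-strip (zero ∷ as) (() ∷ pos)
doubleTail-strip (suc zero ∷ as) (1≤1 ∷ pos) p q =
  ∼-trans (doubleTail-1-∼ (1 ∷ as) (1≤1 ∷ pos) p q)
  (∼-trans
    (∼-* (inv (suc q)) (doubleTail-strip as pos p q))
    (∼-reflexive 0 (λ N _ → trans (sym (ℚₚ.*-assoc (inv (suc q)) (inv (suc q ^ suc (ones as))) (doubleTail (strip as) p (suc q) N)))
      (cong (_* doubleTail (strip as) p (suc q) N) (sym (inv-* (suc q) (suc q ^ suc (ones as))))))))

finExponent : List ℕ → ℕ
finExponent (suc (suc zero) ∷ as) = suc (suc (ones as))
finExponent _                     = 1

weight-fin : ∀ a as → Admissible (a ∷ as) → finExponent (a ∷ as) ℕ.+ weight (fin (a ∷ as)) ≡ weight (a ∷ as)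
weight-fin a as adm with finView (a ∷ as) adm
... | is-2 as pos    = trans (cong (λ x → suc (suc (ones as)) ℕ.+ weight x) (fin-2 as pos)) (cong (λ k → suc (suc k)) (weight-strip as))
... | is-3+ m as pos = cong (λ x → suc (weight x)) (fin-3+ m as pos)

doubleTail-fin : ∀ a as → Admissible (a ∷ as) → ∀ p q → doubleTail (a ∷ as) p q ∼
  (λ N → doubleTail (a ∷ as) p (suc q) N + inv (suc q ^ finExponent (a ∷ as)) * doubleTail (fin (a ∷ as)) p (suc q) N)
doubleTail-fin a as adm p q with finView (a ∷ as) adm
... | is-3+ m as pos = ∼-reflexive 0 (λ N _ → trans (doubleTail-q (suc (suc m)) as p q N)
  (cong₂ (λ k x → doubleTail (suc (suc (suc m)) ∷ as) p (suc q) N + inv k * doubleTail x p (suc q) N)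
    (sym (ℕₚ.*-identityʳ (suc q))) (sym (fin-3+ m as pos))))
... | is-2 as pos = ∼-trans
  (∼-reflexive 0 (λ N _ → doubleTail-q 1 as p q N))
  (∼-trans
    (∼-+ (∼-reflexive {Z₂} 0 (λ _ _ → refl)) (∼-* i (doubleTail-strip as pos p q)))
    (∼-reflexive 0 (λ N _ → cong (Z₂ N +_) (trans (sym (ℚₚ.*-assoc i (inv (suc q ^ suc (ones as))) (doubleTail (strip as) p (suc q) N)))
      (cong₂ (λ c x → c * doubleTail x p (suc q) N) (sym (inv-* (suc q) (suc q ^ suc (ones as)))) (sym (fin-2 as pos)))))))
  where
  i : ℚ
  i = inv (suc q)
  Z₂ : ℕ → ℚ
  Z₂ = doubleTail (2 ∷ as) p (suc q)

initExponent : List ℕ → ℕ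
initExponent []       = 0
initExponent (a ∷ as) = lastPart a as

weight-initExponent : ∀ a → initExponent a ℕ.+ weight (init a) ≡ weight a
weight-initExponent []       = refl
weight-initExponent (a ∷ as) = weight-init a as

-- The empty composition fits the pattern with exponent 0 and `init [] = []`, because C(2n+2,n+1) is
-- twice C(2n+1,n+1). So when fin is empty, its value is counted once as fin and once as mid.
doubleTail-init-diagonal : ∀ a n N → n < N → doubleTail a n (suc n) N ≡
  doubleTail a (suc n) (suc n) N + inv (suc n ^ initExponent a) * doubleTail (init a) (suc n) (suc n) N
doubleTail-init-diagonal []       n N n<N = trans (invC-half n) (lemma (invC (suc n) (suc n)))
  where
  lemma : ∀ w → 2ℚ * w ≡ w + 1ℚ * w
  lemma = solve-∀ ring
doubleTail-init-diagonal (a ∷ as) n N n<N = doubleTail-init a as n (suc n) N n<N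

-- The recurrence between n and n + 1

∑³ : List ℕ → (List ℕ → ℚ) → ℚ
∑³ a f = f (init a) + f (mid a) + f (fin a)

drop : List ℕ → List ℕ → ℕ
drop a x = weight a ∸ weight x

-- Raising q splits off fin; raising p in both resulting terms then splits init off a and mid off
-- fin a. The exponents of n + 1 add up to the weight drops.
doubleTail-step : ∀ a as → Admissible (a ∷ as) → ∀ n → (λ N → doubleTail (a ∷ as) n n N) ∼
  (λ N → doubleTail (a ∷ as) (suc n) (suc n) N + ∑³ (a ∷ as) (λ x → inv (suc n ^ drop (a ∷ as) x) * doubleTail x (suc n) (suc n) N))
doubleTail-step a as adm n = ∼-trans
  (doubleTail-fin a as adm n n)
  (∼-reflexive (suc n) (λ N n<N → begin
    doubleTail (a ∷ as) n (suc n) N + inv (suc n ^ b) * doubleTail F n (suc n) N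
      ≡⟨ cong₂ (λ y z → y + inv (suc n ^ b) * z) (doubleTail-init-diagonal (a ∷ as) n N n<N) (doubleTail-init-diagonal F n N n<N) ⟩
    Z (a ∷ as) N + inv (suc n ^ e) * Z (init (a ∷ as)) N + inv (suc n ^ b) * (Z F N + inv (suc n ^ e′) * Z (init F) N)
      ≡⟨ lemma (Z (a ∷ as) N) (inv (suc n ^ e)) (Z (init (a ∷ as)) N) (inv (suc n ^ b)) (Z F N) (inv (suc n ^ e′)) (Z (init F) N) ⟩
    Z (a ∷ as) N + (inv (suc n ^ e) * Z (init (a ∷ as)) N + inv (suc n ^ b) * inv (suc n ^ e′) * Z (init F) N + inv (suc n ^ b) * Z F N)
      ≡⟨ cong (λ y → Z (a ∷ as) N + (inv (suc n ^ e) * Z (init (a ∷ as)) N + y * Z (init F) N + inv (suc n ^ b) * Z F N))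
           (trans (sym (inv-* (suc n ^ b) (suc n ^ e′))) (cong inv (sym (ℕₚ.^-distribˡ-+-* (suc n) b e′)))) ⟩
    Z (a ∷ as) N + (inv (suc n ^ e) * Z (init (a ∷ as)) N + inv (suc n ^ (b ℕ.+ e′)) * Z (init F) N + inv (suc n ^ b) * Z F N)
      ≡⟨ cong (Z (a ∷ as) N +_) (cong₂ _+_ (cong₂ _+_ (exponent (init (a ∷ as)) N e (weight-init a as))
           (exponent (init F) N (b ℕ.+ e′) (trans (ℕₚ.+-assoc b e′ (weight (init F)))
             (trans (cong (b ℕ.+_) (weight-initExponent F)) (weight-fin a as adm)))))
           (exponent F N b (weight-fin a as adm))) ⟩
    Z (a ∷ as) N + ∑³ (a ∷ as) (λ x → inv (suc n ^ drop (a ∷ as) x) * Z x N) ∎))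
  where
  open ≡-Reasoning
  F : List ℕ
  F = fin (a ∷ as)
  b e e′ : ℕ
  b  = finExponent (a ∷ as)
  e  = initExponent (a ∷ as)
  e′ = initExponent F
  Z : List ℕ → ℕ → ℚ
  Z x = doubleTail x (suc n) (suc n)
  lemma : ∀ z i x b f j m → z + i * x + b * (f + j * m) ≡ z + (i * x + b * j * m + b * f)
  lemma = solve-∀ ring
  exponent : ∀ x N d → d ℕ.+ weight x ≡ weight (a ∷ as) → inv (suc n ^ d) * Z x N ≡ inv (suc n ^ drop (a ∷ as) x) * Z x N
  exponent x N d eq = cong (λ k → inv (suc n ^ k) * Z x N)
    (trans (sym (ℕₚ.m+n∸n≡m d (weight x))) (cong (_∸ weight x) eq))

mid-admissible : ∀ a → Admissible a → Admissible (mid a)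
mid-admissible a adm = init-admissible (fin a) (fin-admissible a adm)

+-≡⇒< : ∀ {d x w} → 1 ≤ d → d ℕ.+ x ≡ w → x < w
+-≡⇒< {suc d} {x} 1≤d refl = s≤s (ℕₚ.m≤n+m x d)

init-weight-< : ∀ a as → Admissible (a ∷ as) → weight (init (a ∷ as)) < weight (a ∷ as)
init-weight-< a as adm = +-≡⇒< (lastPart-positive a as (Admissible.positive adm)) (weight-init a as)

finExponent-positive : ∀ a → 1 ≤ finExponent a
finExponent-positive []                       = s≤s z≤n
finExponent-positive (zero ∷ as)              = s≤s z≤n
finExponent-positive (suc zero ∷ as)          = s≤s z≤n
finExponent-positive (suc (suc zero) ∷ as)    = s≤s z≤n
finExponent-positive (suc (suc (suc _)) ∷ as) = s≤s z≤n

fin-weight-< : ∀ a as → Admissible (a ∷ as) → weight (fin (a ∷ as)) < weight (a ∷ as)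
fin-weight-< a as adm = +-≡⇒< (finExponent-positive (a ∷ as)) (weight-fin a as adm)

mid-weight-< : ∀ a as → Admissible (a ∷ as) → weight (mid (a ∷ as)) < weight (a ∷ as)
mid-weight-< a as adm = ℕₚ.≤-<-trans (subst (weight (mid (a ∷ as)) ≤_) (weight-initExponent (fin (a ∷ as)))
  (ℕₚ.m≤n+m (weight (mid (a ∷ as))) (initExponent (fin (a ∷ as))))) (fin-weight-< a as adm)

record Child (a x : List ℕ) : Set where
  constructor child
  field
    admissible : Admissible x
    weight-<   : weight x < weight a

children : (P : List ℕ → Set) → ∀ a as → Admissible (a ∷ as) → (∀ x → Child (a ∷ as) x → P x) →
  P (init (a ∷ as)) × P (mid (a ∷ as)) × P (fin (a ∷ as))
children P a as adm p =
  p _ (child (init-admissible (a ∷ as) adm) (init-weight-< a as adm)) ,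
  p _ (child (mid-admissible (a ∷ as) adm) (mid-weight-< a as adm)) ,
  p _ (child (fin-admissible (a ∷ as) adm) (fin-weight-< a as adm))

∑³-cong : ∀ a as → Admissible (a ∷ as) → ∀ {f g} → (∀ x → Child (a ∷ as) x → f x ≡ g x) → ∑³ (a ∷ as) f ≡ ∑³ (a ∷ as) g
∑³-cong a as adm {f} {g} f≡g with children (λ x → f x ≡ g x) a as adm f≡g
... | p , q , r = cong₂ _+_ (cong₂ _+_ p q) r

∑³-∼ : ∀ a as → Admissible (a ∷ as) → {f g : List ℕ → ℕ → ℚ} → (∀ x → Child (a ∷ as) x → f x ∼ g x) →
  (λ N → ∑³ (a ∷ as) (λ x → f x N)) ∼ (λ N → ∑³ (a ∷ as) (λ x → g x N))
∑³-∼ a as adm {f} {g} f∼g with children (λ x → f x ∼ g x) a as adm f∼g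
... | p , q , r = ∼-+ (∼-+ p q) r

open Independence using (nested-independent)

-- Expansion in nested sums

indicator : ℕ → ℕ → ℚ
indicator m n with m ℕₚ.≟ n
... | yes _ = 1ℚ
... | no _  = 0ℚ

indicator-≡ : ∀ {m n} → m ≡ n → indicator m n ≡ 1ℚ
indicator-≡ {m} {n} m≡n with m ℕₚ.≟ n
... | yes _  = refl
... | no m≢n = ⊥-elim (m≢n m≡n)

indicator-≢ : ∀ {m n} → m ≢ n → indicator m n ≡ 0ℚ
indicator-≢ {m} {n} m≢n with m ℕₚ.≟ n
... | yes m≡n = ⊥-elim (m≢n m≡n)
... | no _    = refl

-- The coefficient of nested s in the expansion of ζ(a)_{n,n}: the word s records the successive weight drops.
coefficient : Word → List ℕ → ℚ
coefficient []      a = indicator (weight a) 0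
coefficient (j ∷ s) a = ∑³ a (λ x → indicator (suc j ℕ.+ weight x) (weight a) * coefficient s x)

coefficient-∷-[] : ∀ j s → coefficient (j ∷ s) [] ≡ 0ℚ
coefficient-∷-[] j s = lemma (coefficient s [])
  where
  lemma : ∀ x → 0ℚ * x + 0ℚ * x + 0ℚ * x ≡ 0ℚ
  lemma = solve-∀ ring

weight-positive : ∀ a as → Admissible (a ∷ as) → 1 ≤ weight (a ∷ as)
weight-positive a as adm = ℕₚ.≤-trans (s≤s z≤n) (init-weight-< a as adm)

weight-≢1 : ∀ a as → Admissible (a ∷ as) → weight (a ∷ as) ≢ 1
weight-≢1 a as adm eq with Admissible.headOK adm
... | cons 2≤a = ℕₚ.<⇒≢ (ℕₚ.≤-trans 2≤a (ℕₚ.m≤m+n a (weight as))) (sym eq)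

-- Each letter stands for a drop in weight of at least 1, so a chain of descents cannot have more
-- letters than the initial weight.
coefficient-long : ∀ s a → Admissible a → weight a < length s → coefficient s a ≡ 0ℚ
coefficient-long (j ∷ s) []       adm long = coefficient-∷-[] j s
coefficient-long (j ∷ s) (a ∷ as) adm long = ∑³-cong a as adm {g = λ _ → 0ℚ} (λ x (child admˣ x<a) →
  *-cong-0ʳ (indicator (suc j ℕ.+ weight x) (weight (a ∷ as))) (coefficient-long s x admˣ (ℕₚ.<-≤-trans x<a (ℕₚ.≤-pred long))))

-- A last letter 0 would record a drop from weight 1 to weight 0.
coefficient-lastZero : ∀ s a → Admissible a → LastZero s → coefficient s a ≡ 0ℚ
coefficient-lastZero (j ∷ s) []       adm last = coefficient-∷-[] j s
coefficient-lastZero (0 ∷ []) (a ∷ as) adm here = ∑³-cong a as adm {g = λ _ → 0ℚ} (λ x _ → vanish x)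
  where
  vanish : ∀ x → indicator (suc (weight x)) (weight (a ∷ as)) * indicator (weight x) 0 ≡ 0ℚ
  vanish x with weight x ℕₚ.≟ 0
  ... | no _   = ℚₚ.*-zeroʳ (indicator (suc (weight x)) (weight (a ∷ as)))
  ... | yes eq = *-cong-0ˡ 1ℚ (indicator-≢ (λ eq′ → weight-≢1 a as adm (trans (sym eq′) (cong suc eq))))
coefficient-lastZero (j ∷ s) (a ∷ as) adm (there last) = ∑³-cong a as adm {g = λ _ → 0ℚ} (λ x (child admˣ _) →
  *-cong-0ʳ (indicator (suc j ℕ.+ weight x) (weight (a ∷ as))) (coefficient-lastZero s x admˣ last))

∑³-∑ʷ : ∀ J r a (F : Word → List ℕ → ℚ) → ∑ʷ J r (λ s → ∑³ a (F s)) ≡ ∑³ a (λ x → ∑ʷ J r (λ s → F s x))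
∑³-∑ʷ J r a F = trans (∑ʷ-+ J r (λ s → F s (init a) + F s (mid a)) (λ s → F s (fin a)))
  (cong (_+ ∑ʷ J r (λ s → F s (fin a))) (∑ʷ-+ J r (λ s → F s (init a)) (λ s → F s (mid a))))

∑³-∑ : ∀ J a (F : ℕ → List ℕ → ℚ) → ∑ J (λ j → ∑³ a (F j)) ≡ ∑³ a (λ x → ∑ J (λ j → F j x))
∑³-∑ J a F = trans (∑-+ J (λ j → F j (init a) + F j (mid a)) (λ j → F j (fin a)))
  (cong (_+ ∑ J (λ j → F j (fin a))) (∑-+ J (λ j → F j (init a)) (λ j → F j (mid a))))

*-∑³ : ∀ a f c → ∑³ a f * c ≡ ∑³ a (λ x → f x * c)
*-∑³ a f c = lemma (f (init a)) (f (mid a)) (f (fin a)) c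
  where
  lemma : ∀ x y z c → (x + y + z) * c ≡ x * c + y * c + z * c
  lemma = solve-∀ ring

expansion : ℕ → ℕ → List ℕ → ℕ → ℕ → ℚ
expansion J r a n N = ∑ʷ J r (λ s → coefficient s a * nested s n N)

expansion-[] : ∀ J r n N → expansion J r [] n N ≡ invC n n
expansion-[] J zero    n N = ℚₚ.*-identityˡ (invC n n)
expansion-[] J (suc r) n N = trans (cong₂ _+_ (ℚₚ.*-identityˡ (invC n n))
  (∑-zero J (λ j _ → ∑ʷ-zero J r (λ s _ _ → *-cong-0ˡ (nested (j ∷ s) n N) (coefficient-∷-[] j s)))))
  (ℚₚ.+-identityʳ (invC n n))

-- Unfolding every nested sum at n + 1 strips the first letter from its word. For each of init, mid
-- and fin, only the letter one less than the weight drop contributes, and the bound on the weight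
-- keeps it below J. The result has the shape of `doubleTail-step`.
expansion-step : ∀ J r a as → Admissible (a ∷ as) → weight (a ∷ as) ≤ J → ∀ n N → n < N → expansion J (suc r) (a ∷ as) n N ≡
  expansion J (suc r) (a ∷ as) (suc n) N + ∑³ (a ∷ as) (λ x → inv (suc n ^ drop (a ∷ as) x) * expansion J r x (suc n) N)
expansion-step J r a as adm wa≤J n N n<N = begin
  coefficient [] A * invC n n + ∑ J (λ j → ∑ʷ J r (λ s → coefficient (j ∷ s) A * nested (j ∷ s) n N))
    ≡⟨ cong₂ _+_ (*-cong-0ˡ (invC n n) c[]≡0) (∑-cong J (λ j _ → inner j)) ⟩
  0ℚ + ∑ J (λ j → U j + ∑³ A (λ x → T j x))
    ≡⟨ ℚₚ.+-identityˡ _ ⟩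
  ∑ J (λ j → U j + ∑³ A (λ x → T j x))
    ≡⟨ ∑-+ J U (λ j → ∑³ A (λ x → T j x)) ⟩
  ∑ J U + ∑ J (λ j → ∑³ A (λ x → T j x))
    ≡⟨ cong₂ _+_ (trans (sym (ℚₚ.+-identityˡ (∑ J U))) (cong (_+ ∑ J U) (sym (*-cong-0ˡ (invC (suc n) (suc n)) c[]≡0))))
         (trans (∑³-∑ J A T) (∑³-cong a as adm single)) ⟩
  expansion J (suc r) A (suc n) N + ∑³ A (λ x → inv (suc n ^ drop A x) * expansion J r x (suc n) N) ∎
  where
  open ≡-Reasoning
  A : List ℕ
  A = a ∷ as
  c[]≡0 : coefficient [] A ≡ 0ℚ
  c[]≡0 = indicator-≢ (λ eq → ℕₚ.<⇒≢ (weight-positive a as adm) (sym eq))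
  U : ℕ → ℚ
  U j = ∑ʷ J r (λ s → coefficient (j ∷ s) A * nested (j ∷ s) (suc n) N)
  δ : ℕ → List ℕ → ℚ
  δ j x = indicator (suc j ℕ.+ weight x) (weight A)
  T : ℕ → List ℕ → ℚ
  T j x = δ j x * inv (suc n ^ suc j) * expansion J r x (suc n) N
  lemma₁ : ∀ c y i z → c * (y + i * z) ≡ c * y + c * (i * z)
  lemma₁ = solve-∀ ring
  lemma₂ : ∀ d c i y → d * c * (i * y) ≡ d * i * (c * y)
  lemma₂ = solve-∀ ring
  inner : ∀ j → ∑ʷ J r (λ s → coefficient (j ∷ s) A * nested (j ∷ s) n N) ≡ U j + ∑³ A (λ x → T j x)
  inner j = begin
    ∑ʷ J r (λ s → coefficient (j ∷ s) A * nested (j ∷ s) n N)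
      ≡⟨ ∑ʷ-cong J r (λ s _ _ → trans (cong (coefficient (j ∷ s) A *_) (nested-step j s n N n<N))
           (lemma₁ (coefficient (j ∷ s) A) (nested (j ∷ s) (suc n) N) (inv (suc n ^ suc j)) (nested s (suc n) N))) ⟩
    ∑ʷ J r (λ s → coefficient (j ∷ s) A * nested (j ∷ s) (suc n) N + coefficient (j ∷ s) A * (inv (suc n ^ suc j) * nested s (suc n) N))
      ≡⟨ ∑ʷ-+ J r (λ s → coefficient (j ∷ s) A * nested (j ∷ s) (suc n) N) (λ s → coefficient (j ∷ s) A * (inv (suc n ^ suc j) * nested s (suc n) N)) ⟩
    U j + ∑ʷ J r (λ s → coefficient (j ∷ s) A * (inv (suc n ^ suc j) * nested s (suc n) N))
      ≡⟨ cong (U j +_) (∑ʷ-cong J r (λ s _ _ → trans (*-∑³ A (λ x → δ j x * coefficient s x) (inv (suc n ^ suc j) * nested s (suc n) N))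
           (∑³-cong a as adm (λ x _ → lemma₂ (δ j x) (coefficient s x) (inv (suc n ^ suc j)) (nested s (suc n) N))))) ⟩
    U j + ∑ʷ J r (λ s → ∑³ A (λ x → δ j x * inv (suc n ^ suc j) * (coefficient s x * nested s (suc n) N)))
      ≡⟨ cong (U j +_) (trans (∑³-∑ʷ J r A (λ s x → δ j x * inv (suc n ^ suc j) * (coefficient s x * nested s (suc n) N)))
           (∑³-cong a as adm (λ x _ → ∑ʷ-* J r (δ j x * inv (suc n ^ suc j)) (λ s → coefficient s x * nested s (suc n) N)))) ⟩
    U j + ∑³ A (λ x → T j x) ∎
  single : ∀ x → Child A x → ∑ J (λ j → T j x) ≡ inv (suc n ^ drop A x) * expansion J r x (suc n) N
  single x (child _ x<A) = begin
    ∑ J (λ j → T j x)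
      ≡⟨ ∑-single J i i<J (λ j j≢i → *-cong-0ˡ (expansion J r x (suc n) N) (*-cong-0ˡ (inv (suc n ^ suc j))
           (indicator-≢ (λ eq → j≢i (ℕₚ.suc-injective (ℕₚ.+-cancelʳ-≡ (weight x) (suc j) (suc i) (trans eq (sym 1+i+x≡A)))))))) ⟩
    T i x
      ≡⟨ cong₂ (λ d k → d * inv (suc n ^ k) * expansion J r x (suc n) N) (indicator-≡ 1+i+x≡A) 1+i≡drop ⟩
    1ℚ * inv (suc n ^ drop A x) * expansion J r x (suc n) N
      ≡⟨ cong (_* expansion J r x (suc n) N) (ℚₚ.*-identityˡ (inv (suc n ^ drop A x))) ⟩
    inv (suc n ^ drop A x) * expansion J r x (suc n) N ∎
    where
    i : ℕ
    i = weight A ∸ suc (weight x)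
    1+i≡drop : suc i ≡ drop A x
    1+i≡drop = sym (ℕₚ.+-∸-assoc 1 x<A)
    1+i+x≡A : suc i ℕ.+ weight x ≡ weight A
    1+i+x≡A = trans (cong (ℕ._+ weight x) 1+i≡drop) (ℕₚ.m∸n+n≡m (ℕₚ.<⇒≤ x<A))
    i<J : i < J
    i<J = ℕₚ.≤-trans (subst (_≤ weight A) (sym 1+i≡drop) (ℕₚ.m∸n≤m (weight A) (weight x))) wa≤J

-- Both sides obey the same recurrence, and for init, mid and fin they agree by induction. Their
-- difference is therefore independent of n up to null sequences, and it is small for large n.
doubleTail-expansion : ∀ J r a → Admissible a → weight a ≤ r → weight a ≤ J → ∀ n →
  (λ N → doubleTail a n n N) ∼ expansion J r a n
doubleTail-expansion J r [] adm _ _ n = ∼-reflexive 0 (λ N _ → sym (expansion-[] J r n N))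
doubleTail-expansion J zero (a ∷ as) adm wa≤0 _ n = ⊥-elim (ℕₚ.<⇒≱ (weight-positive a as adm) wa≤0)
doubleTail-expansion J (suc r) (a ∷ as) adm wa≤1+r wa≤J n = null-difference (null-of-constant-limit G step small n)
  where
  A : List ℕ
  A = a ∷ as
  G : ℕ → ℕ → ℚ
  G n N = doubleTail A n n N - expansion J (suc r) A n N
  ∼-neg : ∀ {f g} → f ∼ g → (λ N → - f N) ∼ (λ N → - g N)
  ∼-neg {f} {g} f∼g = ∼-trans (∼-reflexive 0 (λ N _ → lemma (f N))) (∼-trans (∼-* (- 1ℚ) f∼g) (∼-reflexive 0 (λ N _ → sym (lemma (g N)))))
    where
    lemma : ∀ x → - x ≡ - 1ℚ * x
    lemma = solve-∀ ring
  lemma : ∀ z s e → z + s - (e + s) ≡ z - e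
  lemma = solve-∀ ring
  step : ∀ n → G n ∼ G (suc n)
  step n = ∼-trans
    (∼-+ (∼-trans (doubleTail-step a as adm n)
           (∼-+ (∼-reflexive {doubleTail A (suc n) (suc n)} 0 (λ _ _ → refl))
             (∑³-∼ a as adm (λ x (child admˣ x<A) → ∼-* (inv (suc n ^ drop A x))
               (doubleTail-expansion J r x admˣ (ℕₚ.≤-pred (ℕₚ.≤-trans x<A wa≤1+r)) (ℕₚ.≤-trans (ℕₚ.<⇒≤ x<A) wa≤J) (suc n))))))
         (∼-neg (∼-reflexive (suc n) (λ N n<N → expansion-step J r a as adm wa≤J n N n<N))))
    (∼-reflexive 0 (λ N _ → lemma (doubleTail A (suc n) (suc n) N)
      (∑³ A (λ x → inv (suc n ^ drop A x) * expansion J r x (suc n) N)) (expansion J (suc r) A (suc n) N)))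
  small : UniformlySmall G
  small = small-+ (doubleTail-small A (Admissible.positive adm)) (small-neg (∑ʷ-small J (suc r) (λ s → coefficient s A) nested nested-small))
    where
    small-neg : ∀ {f} → UniformlySmall f → UniformlySmall (λ n N → - f n N)
    small-neg {f} f-small ε 0<ε with f-small ε 0<ε
    ... | n₀ , f< = n₀ , λ n N n≥ → subst (ℚ._< ε) (sym (ℚₚ.∣-p∣≡∣p∣ (f n N))) (f< n N n≥)

-- Linear combinations and their components

coefficientLin : Word → LinComb → ℚ
coefficientLin s []            = 0ℚ
coefficientLin s ((c , a) ∷ ℓ) = c ℚ./ 1 * coefficient s a + coefficientLin s ℓ

ζTruncLin-expansion : ∀ J r k ℓ → k ≤ r → k ≤ J → AllAdmissible ℓ → Homogeneous k ℓ → ∀ n →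
  ζTruncLin ℓ n ∼ (λ N → ∑ʷ J r (λ s → coefficientLin s ℓ * nested s n N))
ζTruncLin-expansion J r k [] k≤r k≤J [] [] n =
  ∼-reflexive 0 (λ N _ → sym (∑ʷ-zero J r (λ s _ _ → ℚₚ.*-zeroˡ (nested s n N))))
ζTruncLin-expansion J r k ((c , a) ∷ ℓ) k≤r k≤J (adm ∷ adms) (refl ∷ homs) n = ∼-trans
  (∼-+ (∼-* (c ℚ./ 1) (∼-trans (∼-reflexive 0 (λ N _ → ζTrunc-doubleTail a n N)) (doubleTail-expansion J r a adm k≤r k≤J n)))
       (ζTruncLin-expansion J r k ℓ k≤r k≤J adms homs n))
  (∼-reflexive 0 (λ N _ → begin
    c ℚ./ 1 * expansion J r a n N + ∑ʷ J r (λ s → coefficientLin s ℓ * nested s n N)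
      ≡⟨ cong (_+ ∑ʷ J r (λ s → coefficientLin s ℓ * nested s n N)) (∑ʷ-* J r (c ℚ./ 1) (λ s → coefficient s a * nested s n N)) ⟨
    ∑ʷ J r (λ s → c ℚ./ 1 * (coefficient s a * nested s n N)) + ∑ʷ J r (λ s → coefficientLin s ℓ * nested s n N)
      ≡⟨ ∑ʷ-+ J r (λ s → c ℚ./ 1 * (coefficient s a * nested s n N)) (λ s → coefficientLin s ℓ * nested s n N) ⟨
    ∑ʷ J r (λ s → c ℚ./ 1 * (coefficient s a * nested s n N) + coefficientLin s ℓ * nested s n N)
      ≡⟨ ∑ʷ-cong J r (λ s _ _ → lemma (c ℚ./ 1) (coefficient s a) (nested s n N) (coefficientLin s ℓ)) ⟩
    ∑ʷ J r (λ s → (c ℚ./ 1 * coefficient s a + coefficientLin s ℓ) * nested s n N) ∎))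
  where
  open ≡-Reasoning
  lemma : ∀ c a y l → c * (a * y) + l * y ≡ (c * a + l) * y
  lemma = solve-∀ ring

coefficientLin-zero : ∀ s ℓ → All (λ (_ , a) → coefficient s a ≡ 0ℚ) ℓ → coefficientLin s ℓ ≡ 0ℚ
coefficientLin-zero s []            []             = refl
coefficientLin-zero s ((c , a) ∷ ℓ) (zero-a ∷ all) =
  cong₂ _+_ (*-cong-0ʳ (c ℚ./ 1) zero-a) (coefficientLin-zero s ℓ all)

InM⇒coefficients : ∀ J k ℓ → k ≤ J → AllAdmissible ℓ → Homogeneous k ℓ → InM ℓ →
  ∀ s → Valid J s → coefficientLin s ℓ ≡ 0ℚ
InM⇒coefficients J k ℓ k≤J adms homs ℓ∈M = nested-independent J k (λ s → coefficientLin s ℓ)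
  (λ s _ long → coefficientLin-zero s ℓ
    (zipWith (λ (adm , eq) → coefficient-long s _ adm (subst (_< length s) (sym eq) long)) (adms , homs)))
  (λ s last → coefficientLin-zero s ℓ (mapᴬ (λ adm → coefficient-lastZero s _ adm last) adms))
  (λ n → null-∼ (∼-sym (ζTruncLin-expansion J k k ℓ ℕₚ.≤-refl k≤J adms homs n)) (ℓ∈M n))

coefficients⇒InM : ∀ k ℓ → AllAdmissible ℓ → Homogeneous k ℓ →
  (∀ s → Valid k s → coefficientLin s ℓ ≡ 0ℚ) → InM ℓ
coefficients⇒InM k ℓ adms homs zeros n = null-∼ (ζTruncLin-expansion k k k ℓ ℕₚ.≤-refl ℕₚ.≤-refl adms homs n)
  (null-≗ (λ N → sym (∑ʷ-zero k k (λ s valid _ → *-cong-0ˡ (nested s n N) (zeros s valid)))) null-0)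

component-∷ : ∀ s k′ c x ℓ → coefficientLin s (component k′ ((c , x) ∷ ℓ)) ≡
  c ℚ./ 1 * (indicator (weight x) k′ * coefficient s x) + coefficientLin s (component k′ ℓ)
component-∷ s k′ c x ℓ with weight x ℕₚ.≟ k′
... | yes eq = trans (cong (coefficientLin s) (filter-accept (λ p → weight (proj₂ p) ℕₚ.≟ k′) {x = c , x} {xs = ℓ} eq))
  (cong (λ y → c ℚ./ 1 * y + coefficientLin s (component k′ ℓ)) (sym (ℚₚ.*-identityˡ (coefficient s x))))
... | no neq = trans (cong (coefficientLin s) (filter-reject (λ p → weight (proj₂ p) ℕₚ.≟ k′) {x = c , x} {xs = ℓ} neq))
  (sym (trans (cong (_+ coefficientLin s (component k′ ℓ)) (*-cong-0ʳ (c ℚ./ 1) (ℚₚ.*-zeroˡ (coefficient s x)))) (ℚₚ.+-identityˡ _)))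

-- From weight j + 1 + k′, the first letter j asks for a drop of j + 1, that is, for a term of α ℓ
-- of weight k′: prefixing a letter and taking a component are the same selection.
coefficient-component : ∀ j s k′ ℓ → Homogeneous (suc j ℕ.+ k′) ℓ →
  coefficientLin s (component k′ (α ℓ)) ≡ coefficientLin (j ∷ s) ℓ
coefficient-component j s k′ []            []            = refl
coefficient-component j s k′ ((c , a) ∷ ℓ) (eq ∷ homs) = begin
  coefficientLin s (component k′ ((c , init a) ∷ (c , mid a) ∷ (c , fin a) ∷ α ℓ))
    ≡⟨ trans (component-∷ s k′ c (init a) _) (cong (t (init a) +_) (trans (component-∷ s k′ c (mid a) _)
         (cong (t (mid a) +_) (component-∷ s k′ c (fin a) (α ℓ))))) ⟩
  t (init a) + (t (mid a) + (t (fin a) + coefficientLin s (component k′ (α ℓ))))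
    ≡⟨ cong₂ _+_ (shift (init a)) (cong₂ _+_ (shift (mid a)) (cong₂ _+_ (shift (fin a)) (coefficient-component j s k′ ℓ homs))) ⟩
  c ℚ./ 1 * u (init a) + (c ℚ./ 1 * u (mid a) + (c ℚ./ 1 * u (fin a) + coefficientLin (j ∷ s) ℓ))
    ≡⟨ lemma (c ℚ./ 1) (u (init a)) (u (mid a)) (u (fin a)) (coefficientLin (j ∷ s) ℓ) ⟩
  c ℚ./ 1 * (u (init a) + u (mid a) + u (fin a)) + coefficientLin (j ∷ s) ℓ ∎
  where
  open ≡-Reasoning
  t u : List ℕ → ℚ
  t x = c ℚ./ 1 * (indicator (weight x) k′ * coefficient s x)
  u x = indicator (suc j ℕ.+ weight x) (weight a) * coefficient s x
  shift : ∀ x → t x ≡ c ℚ./ 1 * u x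
  shift x = cong (λ d → c ℚ./ 1 * (d * coefficient s x)) same
    where
    same : indicator (weight x) k′ ≡ indicator (suc j ℕ.+ weight x) (weight a)
    same with weight x ℕₚ.≟ k′
    ... | yes x≡k′ = sym (indicator-≡ (trans (cong (suc j ℕ.+_) x≡k′) (sym eq)))
    ... | no x≢k′  = sym (indicator-≢ (λ eq′ → x≢k′ (ℕₚ.+-cancelˡ-≡ (suc j) (weight x) k′ (trans eq′ eq))))
  lemma : ∀ c x y z l → c * x + (c * y + (c * z + l)) ≡ c * (x + y + z) + l
  lemma = solve-∀ ring

α-children : ∀ k ℓ → 1 ≤ k → AllAdmissible ℓ → Homogeneous k ℓ →
  All (λ (_ , x) → Admissible x × weight x < k) (α ℓ)
α-children k []                   1≤k []           []            = []
-- The empty composition, which `init` does not make lighter, has weight 0 and is excluded by 1 ≤ k.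
α-children k ((c , []) ∷ ℓ)       () (adm ∷ adms) (refl ∷ homs)
α-children k ((c , a ∷ as) ∷ ℓ)   1≤k (adm ∷ adms) (refl ∷ homs)
  with children (λ x → Admissible x × weight x < weight (a ∷ as)) a as adm (λ x (child admˣ x<a) → admˣ , x<a)
... | p , q , r = p ∷ q ∷ r ∷ α-children k ℓ 1≤k adms homs

theorem20 : ∀ (k : ℕ) → 1 ≤ k → (ℓ : LinComb) → AllAdmissible ℓ → Homogeneous k ℓ →
    (InM ℓ ⇔ InDirectSumM k (α ℓ)) ×
    (InM ℓ ⇔ (∀ (k' : ℕ) → k' < k → InM (component k' (α ℓ))))
theorem20 k 1≤k ℓ adms homs =
  mk⇔ (λ ℓ∈M → components∈M ℓ∈M , no-component) (λ (comps∈M , _) → ℓ∈M comps∈M) ,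
  mk⇔ components∈M ℓ∈M
  where
  module Component (k′ : ℕ) where
    adms′ : AllAdmissible (component k′ (α ℓ))
    adms′ = filter⁺ (λ p → weight (proj₂ p) ℕₚ.≟ k′) (mapᴬ proj₁ (α-children k ℓ 1≤k adms homs))
    homs′ : Homogeneous k′ (component k′ (α ℓ))
    homs′ = all-filter (λ p → weight (proj₂ p) ℕₚ.≟ k′) (α ℓ)
  components∈M : InM ℓ → ∀ k′ → k′ < k → InM (component k′ (α ℓ))
  -- A word s over the letters below k′ is tested by prefixing j, where j + 1 is the drop from k to
  -- k′; the result is a word over the letters below k.
  components∈M ℓ∈M k′ k′<k = coefficients⇒InM k′ (component k′ (α ℓ)) adms′ homs′ (λ s valid → trans
    (coefficient-component j s k′ ℓ (subst (λ w → Homogeneous w ℓ) (sym 1+j+k′≡k) homs))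
    (InM⇒coefficients k k ℓ ℕₚ.≤-refl adms homs ℓ∈M (j ∷ s) (j<k ∷ mapᴬ (λ i<k′ → ℕₚ.<-trans i<k′ k′<k) valid)))
    where
    open Component k′
    j : ℕ
    j = k ∸ suc k′
    1+j+k′≡k : suc j ℕ.+ k′ ≡ k
    1+j+k′≡k = trans (sym (ℕₚ.+-suc j k′)) (ℕₚ.m∸n+n≡m k′<k)
    j<k : j < k
    j<k = subst (j <_) 1+j+k′≡k (s≤s (ℕₚ.m≤m+n j k′))
  no-component : ∀ k′ → k ≤ k′ → component k′ (α ℓ) ≡ []
  no-component k′ k≤k′ = filter-none (λ p → weight (proj₂ p) ℕₚ.≟ k′)
    (mapᴬ (λ (_ , x<k) x≡k′ → ℕₚ.<⇒≢ (ℕₚ.<-≤-trans x<k k≤k′) x≡k′) (α-children k ℓ 1≤k adms homs))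
  ℓ∈M : (∀ k′ → k′ < k → InM (component k′ (α ℓ))) → InM ℓ
  ℓ∈M comps∈M = coefficients⇒InM k ℓ adms homs zeros
    where
    zeros : ∀ s → Valid k s → coefficientLin s ℓ ≡ 0ℚ
    -- As k ≥ 1, no composition in ℓ is empty, so 1/C(2n,n) itself does not occur in the expansion.
    zeros []      []            = coefficientLin-zero [] ℓ
      (mapᴬ (λ eq → indicator-≢ (λ eq′ → ℕₚ.<⇒≢ 1≤k (trans (sym eq′) eq))) homs)
    zeros (j ∷ s) (j<k ∷ valid) = trans
      (sym (coefficient-component j s k′ ℓ (subst (λ w → Homogeneous w ℓ) (sym 1+j+k′≡k) homs)))
      -- The letters of s are bounded only by k, so independence is applied over the alphabet of
      -- size k to a combination of the smaller weight k′.
      (InM⇒coefficients k k′ (component k′ (α ℓ)) (ℕₚ.<⇒≤ k′<k) adms′ homs′ (comps∈M k′ k′<k) s valid)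
      where
      k′ : ℕ
      k′ = k ∸ suc j
      open Component k′
      1+j+k′≡k : suc j ℕ.+ k′ ≡ k
      1+j+k′≡k = ℕₚ.m+[n∸m]≡n j<k
      k′<k : k′ < k
      k′<k = subst (k′ <_) 1+j+k′≡k (s≤s (ℕₚ.m≤n+m k′ j))
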